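{- Let $\mathbb{T}=(X,\Sigma,E)$ be a syntactic symmetric monoidal closed (SMC) theory, and let $\mathcal{C}_{\mathbb{T}}$ be the quotient of the SMC category $\mathcal{C}_{X,\Sigma}$ (defined in the context) by the smallest congruence which contains all the equations in $E$ and respects the SMC structure. Then $\mathcal{C}_{\mathbb{T}}$ is the classifying category of $\mathbb{T}$: there is a bijection, natural in the SMC category $\mathcal{D}$, between interpretations $\mathbb{T}\to\mathcal{D}$ and strict SMC functors $\mathcal{C}_{\mathbb{T}}\to\mathcal{D}$.
   Context: **Signatures and theories.** For a set $X$, $\overline X$ is the set of formal types generated by $e ::= x \mid I \mid e\otimes e \mid e\multimap e$ ($x\in X$). An SMC signature $(X,\Sigma,s,t)$ is a set $X$, a set $\Sigma$ and functions $s,t:\Sigma\to\overline X$; $\Sigma(a,b)=\{f\in\Sigma: s(f)=a,\ t(f)=b\}$. The sets $\overline\Sigma(a,b)$ of derived terms ($a,b\in\overline X$) are inductively generated by: elements of $\Sigma(a,b)$; formal symbols $\alpha_{abc}:a\otimes(b\otimes c)\to(a\otimes b)\otimes c$, $\lambda_a:I\otimes a\to a$, $\rho_a:a\otimes I\to a$, their formal inverses $\alpha^{ -1}_{abc},\lambda_a^{ -1},\rho_a^{ -1}$, $\sigma_{ab}:a\otimes b\to b\otimes a$, $\epsilon_{ab}:(a\multimap b)\otimes a\to b$, $\eta_{ab}:a\to b\multimap(a\otimes b)$, $\mathrm{id}_a:a\to a$; composites $g\circ f$; and for $f\in\overline\Sigma(a,b)$, $g\in\overline\Sigma(c,d)$,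 terms $f\otimes g\in\overline\Sigma(a\otimes c,b\otimes d)$ and $f\multimap g\in\overline\Sigma(b\multimap c,a\multimap d)$. An equation is an expression $u=v:a\to b$ with $u,v\in\overline\Sigma(a,b)$. A syntactic SMC theory $\mathbb{T}=(X,\Sigma,E)$ is an SMC signature with a set $E$ of equations over it. **Interpretations.** SMC categories come with chosen structure ($\otimes$, $I$, $\multimap$, constraints, $\eta$, $\epsilon$); a strict SMC functor preserves all of it on the nose. An interpretation $F:\mathbb{T}\to\mathcal{D}$ in an SMC category $\mathcal{D}$ is a function $F_X:X\to\mathrm{ob}\,\mathcal{D}$ together with functions $F_{a,b}:\Sigma(a,b)\to\mathcal{D}(\overline{F_X}(a),\overline{F_X}(b))$ for $a,b\in\overline X$, where $\overline{F_X}$ is the unique extension of $F_X$ to $\overline X$ commuting with $I,\otimes,\multimap$, such that $\overline{F_{a,b}}(u)=\overline{F_{a,b}}(v)$ for each equation $u=v:a\to b$ in $E$, where $\overline{F_{a,b}}$ is the unique extension of the $F_{a,b}$ to derived terms commuting with the SMC term constructors. Strict SMC functors $\mathcal{D}\to\mathcal{D}'$ act on interpretations by postcomposition. **The category $\mathcal{C}_{X,\Sigma}$.** $\mathcal{C}_X$ is the free SMC category on the set $X$, with object set $\overline X$. For a list $\Gamma\in\Sigma^*$, put $\mathrm{ty}()=I$, $\mathrm{ty}(\alpha)=s(\alpha)\multimap t(\alpha)$, $\mathrm{ty}(\alpha_1,\dots,\alpha_n)=\mathrm{ty}(\alpha_1,\dots,\alpha_{n-1})\otimes\mathrm{ty}(\alpha_n)$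 for $n\ge 2$. The category $\mathcal{C}'_{X,\Sigma}$ has objects $\overline X$; a morphism $U\to V$ is a pair $(\Gamma,\phi)$ with $\Gamma\in\Sigma^*$ and $\phi:\mathrm{ty}(\Gamma)\otimes U\to V$ in $\mathcal{C}_X$; the identity on $U$ is $()$ with the canonical isomorphism $I\otimes U\to U$; the composite of $(\Gamma,\phi):U\to V$ and $(\Delta,\psi):V\to W$ is $(\Delta+\Gamma,\xi)$ where $+$ is concatenation and $\xi$ is $\mathrm{ty}(\Delta+\Gamma)\otimes U\cong\mathrm{ty}(\Delta)\otimes(\mathrm{ty}(\Gamma)\otimes U)\xrightarrow{\mathrm{ty}(\Delta)\otimes\phi}\mathrm{ty}(\Delta)\otimes V\xrightarrow{\psi}W$. $\mathcal{C}_{X,\Sigma}$ is the quotient of $\mathcal{C}'_{X,\Sigma}$ by the equivalence relation (a congruence) generated by $(\sigma\Gamma,\phi)\sim(\Gamma,\phi\circ(\hat\sigma\otimes U))$ for $\Gamma=(\alpha_1,\dots,\alpha_n)$, $\sigma\in S_n$, $\sigma\Gamma=(\alpha_{\sigma(1)},\dots,\alpha_{\sigma(n)})$, $\phi:\mathrm{ty}(\sigma\Gamma)\otimes U\to V$, where $\hat\sigma:\mathrm{ty}(\Gamma)\to\mathrm{ty}(\sigma\Gamma)$ is the canonical isomorphism permuting tensor factors. Its SMC structure: on objects, the type constructors; the tensor of $(\Gamma,\phi):U\to V$ and $(\Gamma',\phi'):U'\to V'$ is represented by $\Gamma+\Gamma'$ and $\mathrm{ty}(\Gamma+\Gamma')\otimes(U\otimes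 U')\cong(\mathrm{ty}(\Gamma)\otimes U)\otimes(\mathrm{ty}(\Gamma')\otimes U')\xrightarrow{\phi\otimes\phi'}V\otimes V'$; all structure maps are the images of those of $\mathcal{C}_X$ under the functor $\mathcal{C}_X\to\mathcal{C}_{X,\Sigma}$ sending $\phi:U\to V$ to the class of $((),\,I\otimes U\cong U\xrightarrow{\phi}V)$; the closed structure is induced by the bijections $\mathcal{C}_X(\mathrm{ty}(\Gamma)\otimes(U\otimes V),W)\cong\mathcal{C}_X(\mathrm{ty}(\Gamma)\otimes U,V\multimap W)$. **Equations in $\mathcal{C}_{X,\Sigma}$.** Derived terms denote morphisms of $\mathcal{C}_{X,\Sigma}$ via the interpretation sending $x\in X$ to $x$ and $\alpha\in\Sigma(a,b)$ to the class of $((\alpha),\epsilon_{ab})$; a congruence contains the equation $u=v$ if it relates the morphisms denoted by $u$ and $v$. A congruence (equivalence relation on each hom-set, compatible with composition) respects the SMC structure if it is compatible with $\otimes$ and $\multimap$ on morphisms. -}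

module Defs where

open import Data.Empty.Polymorphic using (⊥)
open import Data.Fin.Base using (Fin; zero; suc)
open import Data.Fin.Permutation using (Permutation; _⟨$⟩ʳ_; remove)
open import Data.List.Base using (List; []; _∷_; _++_; foldl)
open import Data.Nat.Base using (zero; suc)
open import Data.Product.Base using (Σ-syntax; _×_; _,_)
open import Data.Vec.Base as Vec using (Vec; []; _∷_; lookup; removeAt; tabulate; toList)
open import Data.Vec.Properties using (tabulate-cong; removeAt-punchOut)
open import Level using (Level; _⊔_)
open import Relation.Binary.Bundles using (Setoid)
open import Relation.Binary.Structures using (IsEquivalence)
open import Relation.Binary.Construct.Closure.Equivalence using (EqClosure)
open import Relation.Binary.PropositionalEquality
  using (_≡_; refl; sym; trans; cong; cong₂; subst)

-- Quotients are taken by coarsening the equality of hom-setoids, so that a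
-- quotient of an SMC category keeps its objects and representing morphisms.

record RawSMC (o ℓ r : Level) : Set (Level.suc (o ⊔ ℓ ⊔ r)) where
  infix  4 _≈_
  infixr 9 _∘_
  infixr 10 _⊗₀_ _⊗₁_
  infixr 8 _⊸₀_ _⊸₁_
  field
    Ob   : Set o
    Hom  : Ob → Ob → Set ℓ
    _≈_  : ∀ {a b} → Hom a b → Hom a b → Set r

    _⊗₀_ : Ob → Ob → Ob
    unit : Ob
    _⊸₀_ : Ob → Ob → Ob

    id   : ∀ {a} → Hom a a
    _∘_  : ∀ {a b c} → Hom b c → Hom a b → Hom a c
    _⊗₁_ : ∀ {a b c d} → Hom a b → Hom c d → Hom (a ⊗₀ c) (b ⊗₀ d)
    _⊸₁_ : ∀ {a b c d} → Hom a b → Hom c d → Hom (b ⊸₀ c) (a ⊸₀ d)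

    α    : ∀ {a b c} → Hom (a ⊗₀ (b ⊗₀ c)) ((a ⊗₀ b) ⊗₀ c)
    α⁻¹  : ∀ {a b c} → Hom ((a ⊗₀ b) ⊗₀ c) (a ⊗₀ (b ⊗₀ c))
    λ′   : ∀ {a} → Hom (unit ⊗₀ a) a
    λ⁻¹  : ∀ {a} → Hom a (unit ⊗₀ a)
    ρ    : ∀ {a} → Hom (a ⊗₀ unit) a
    ρ⁻¹  : ∀ {a} → Hom a (a ⊗₀ unit)
    σ    : ∀ {a b} → Hom (a ⊗₀ b) (b ⊗₀ a)
    ε    : ∀ {a b} → Hom ((a ⊸₀ b) ⊗₀ a) b
    η    : ∀ {a b} → Hom a (b ⊸₀ (a ⊗₀ b))

record IsSMC {o ℓ r} (C : RawSMC o ℓ r) : Set (o ⊔ ℓ ⊔ r) where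
  open RawSMC C
  field
    equiv     : ∀ {a b} → IsEquivalence (_≈_ {a} {b})

    ∘-resp-≈  : ∀ {a b c} {g g′ : Hom b c} {f f′ : Hom a b} →
                g ≈ g′ → f ≈ f′ → g ∘ f ≈ g′ ∘ f′
    identityˡ : ∀ {a b} {f : Hom a b} → id ∘ f ≈ f
    identityʳ : ∀ {a b} {f : Hom a b} → f ∘ id ≈ f
    assoc     : ∀ {a b c d} {f : Hom a b} {g : Hom b c} {h : Hom c d} →
                (h ∘ g) ∘ f ≈ h ∘ (g ∘ f)

    ⊗-resp-≈  : ∀ {a b c d} {f f′ : Hom a b} {g g′ : Hom c d} →
                f ≈ f′ → g ≈ g′ → f ⊗₁ g ≈ f′ ⊗₁ g′
    ⊗-id      : ∀ {a b} → id {a} ⊗₁ id {b} ≈ id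
    ⊗-∘       : ∀ {a b c a′ b′ c′} {f : Hom a b} {g : Hom b c}
                {f′ : Hom a′ b′} {g′ : Hom b′ c′} →
                (g ∘ f) ⊗₁ (g′ ∘ f′) ≈ (g ⊗₁ g′) ∘ (f ⊗₁ f′)

    ⊸-resp-≈  : ∀ {a b c d} {f f′ : Hom a b} {g g′ : Hom c d} →
                f ≈ f′ → g ≈ g′ → f ⊸₁ g ≈ f′ ⊸₁ g′
    ⊸-id      : ∀ {a b} → id {a} ⊸₁ id {b} ≈ id
    ⊸-∘       : ∀ {a b c a′ b′ c′} {f : Hom a b} {g : Hom b c}
                {f′ : Hom a′ b′} {g′ : Hom b′ c′} →
                (g ∘ f) ⊸₁ (g′ ∘ f′) ≈ (f ⊸₁ g′) ∘ (g ⊸₁ f′)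

    α-isoˡ    : ∀ {a b c} → α⁻¹ ∘ α {a} {b} {c} ≈ id
    α-isoʳ    : ∀ {a b c} → α {a} {b} {c} ∘ α⁻¹ ≈ id
    λ-isoˡ    : ∀ {a} → λ⁻¹ ∘ λ′ {a} ≈ id
    λ-isoʳ    : ∀ {a} → λ′ {a} ∘ λ⁻¹ ≈ id
    ρ-isoˡ    : ∀ {a} → ρ⁻¹ ∘ ρ {a} ≈ id
    ρ-isoʳ    : ∀ {a} → ρ {a} ∘ ρ⁻¹ ≈ id
    σ-iso     : ∀ {a b} → σ {b} {a} ∘ σ {a} {b} ≈ id

    α-natural : ∀ {a b c a′ b′ c′} {f : Hom a a′} {g : Hom b b′} {h : Hom c c′} →
                α ∘ (f ⊗₁ (g ⊗₁ h)) ≈ ((f ⊗₁ g) ⊗₁ h) ∘ α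
    λ-natural : ∀ {a b} {f : Hom a b} → λ′ ∘ (id ⊗₁ f) ≈ f ∘ λ′
    ρ-natural : ∀ {a b} {f : Hom a b} → ρ ∘ (f ⊗₁ id) ≈ f ∘ ρ
    σ-natural : ∀ {a b c d} {f : Hom a b} {g : Hom c d} →
                σ ∘ (f ⊗₁ g) ≈ (g ⊗₁ f) ∘ σ

    pentagon  : ∀ {a b c d} →
                α ∘ α {a} {b} {c ⊗₀ d} ≈ (α ⊗₁ id) ∘ (α ∘ (id ⊗₁ α))
    triangle  : ∀ {a b} → (ρ ⊗₁ id) ∘ α {a} {unit} {b} ≈ id ⊗₁ λ′
    hexagon   : ∀ {a b c} →
                α ∘ (σ ∘ α {a} {b} {c}) ≈ (σ ⊗₁ id) ∘ (α ∘ (id ⊗₁ σ))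

    ε-natural : ∀ {a b c} {g : Hom b c} → ε {a} ∘ ((id ⊸₁ g) ⊗₁ id) ≈ g ∘ ε
    ε-extra   : ∀ {a b c} {f : Hom a b} →
                ε ∘ ((f ⊸₁ id {c}) ⊗₁ id) ≈ ε ∘ (id ⊗₁ f)
    η-natural : ∀ {a b c} {f : Hom a b} → η {b} {c} ∘ f ≈ (id ⊸₁ (f ⊗₁ id)) ∘ η
    η-extra   : ∀ {a b c} {f : Hom b c} →
                (f ⊸₁ id) ∘ η {a} ≈ (id ⊸₁ (id ⊗₁ f)) ∘ η
    zig       : ∀ {a b} → ε ∘ (η {a} {b} ⊗₁ id) ≈ id
    zag       : ∀ {a b} → (id ⊸₁ ε) ∘ η {b ⊸₀ a} {b} ≈ id

record SMC (o ℓ r : Level) : Set (Level.suc (o ⊔ ℓ ⊔ r)) where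
  constructor smc
  field
    raw   : RawSMC o ℓ r
    isSMC : IsSMC raw
  open RawSMC raw public
  open IsSMC isSMC public

-- Equality of morphisms whose domains and codomains are equal, but not
-- necessarily definitionally so.  Objects carry propositional equality, so
-- by K this restricts to _≈_ on each hom-setoid.

module Heterogeneous {o ℓ r} (C : RawSMC o ℓ r) where
  open RawSMC C

  infix 4 _≋_
  data _≋_ {a b} (f : Hom a b) : ∀ {c d} → Hom c d → Set (ℓ ⊔ r) where
    ≈⇒≋ : ∀ {g : Hom a b} → f ≈ g → f ≋ g

module HeterogeneousProperties {o ℓ r} (C : SMC o ℓ r) where
  open SMC C
  open Heterogeneous raw public
  private module E {a b} = IsEquivalence (equiv {a} {b})

  ≋-refl : ∀ {a b} {f : Hom a b} → f ≋ f
  ≋-refl = ≈⇒≋ E.refl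

  ≋-sym : ∀ {a b c d} {f : Hom a b} {g : Hom c d} → f ≋ g → g ≋ f
  ≋-sym (≈⇒≋ p) = ≈⇒≋ (E.sym p)

  ≋-trans : ∀ {a b c d a′ b′} {f : Hom a b} {g : Hom c d} {h : Hom a′ b′} →
            f ≋ g → g ≋ h → f ≋ h
  ≋-trans (≈⇒≋ p) (≈⇒≋ q) = ≈⇒≋ (E.trans p q)

  ≋⇒≈ : ∀ {a b} {f g : Hom a b} → f ≋ g → f ≈ g
  ≋⇒≈ (≈⇒≋ p) = p

  ∘-resp-≋ : ∀ {a b c a′ b′ c′} {g : Hom b c} {g′ : Hom b′ c′}
             {f : Hom a b} {f′ : Hom a′ b′} → g ≋ g′ → f ≋ f′ → g ∘ f ≋ g′ ∘ f′
  ∘-resp-≋ (≈⇒≋ p) (≈⇒≋ q) = ≈⇒≋ (∘-resp-≈ p q)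

  ⊗-resp-≋ : ∀ {a b c d a′ b′ c′ d′} {f : Hom a b} {f′ : Hom a′ b′}
             {g : Hom c d} {g′ : Hom c′ d′} → f ≋ f′ → g ≋ g′ → f ⊗₁ g ≋ f′ ⊗₁ g′
  ⊗-resp-≋ (≈⇒≋ p) (≈⇒≋ q) = ≈⇒≋ (⊗-resp-≈ p q)

  ⊸-resp-≋ : ∀ {a b c d a′ b′ c′ d′} {f : Hom a b} {f′ : Hom a′ b′}
             {g : Hom c d} {g′ : Hom c′ d′} → f ≋ f′ → g ≋ g′ → f ⊸₁ g ≋ f′ ⊸₁ g′
  ⊸-resp-≋ (≈⇒≋ p) (≈⇒≋ q) = ≈⇒≋ (⊸-resp-≈ p q)

  coe : ∀ {a b c d} → a ≡ c → b ≡ d → Hom a b → Hom c d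
  coe refl refl f = f

  coe-≋ : ∀ {a b c d} (p : a ≡ c) (q : b ≡ d) {f : Hom a b} → coe p q f ≋ f
  coe-≋ refl refl = ≋-refl

record StrictFunctor {o ℓ r o′ ℓ′ r′} (C : SMC o ℓ r) (D : SMC o′ ℓ′ r′) :
                     Set (o ⊔ ℓ ⊔ r ⊔ o′ ⊔ ℓ′ ⊔ r′) where
  private
    module C = SMC C
    module D = SMC D
  open Heterogeneous D.raw
  field
    F₀     : C.Ob → D.Ob
    F₁     : ∀ {a b} → C.Hom a b → D.Hom (F₀ a) (F₀ b)
    F-resp : ∀ {a b} {f g : C.Hom a b} → f C.≈ g → F₁ f D.≈ F₁ g
    F-id   : ∀ {a} → F₁ (C.id {a}) D.≈ D.id
    F-∘    : ∀ {a b c} {g : C.Hom b c} {f : C.Hom a b} →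
             F₁ (g C.∘ f) D.≈ F₁ g D.∘ F₁ f

    F₀-⊗   : ∀ a b → F₀ (a C.⊗₀ b) ≡ F₀ a D.⊗₀ F₀ b
    F₀-I   : F₀ C.unit ≡ D.unit
    F₀-⊸   : ∀ a b → F₀ (a C.⊸₀ b) ≡ F₀ a D.⊸₀ F₀ b

    F₁-⊗   : ∀ {a b c d} {f : C.Hom a b} {g : C.Hom c d} →
             F₁ (f C.⊗₁ g) ≋ F₁ f D.⊗₁ F₁ g
    F₁-⊸   : ∀ {a b c d} {f : C.Hom a b} {g : C.Hom c d} →
             F₁ (f C.⊸₁ g) ≋ F₁ f D.⊸₁ F₁ g

    F-α    : ∀ {a b c} → F₁ (C.α {a} {b} {c}) ≋ D.α {F₀ a} {F₀ b} {F₀ c}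
    F-α⁻¹  : ∀ {a b c} → F₁ (C.α⁻¹ {a} {b} {c}) ≋ D.α⁻¹ {F₀ a} {F₀ b} {F₀ c}
    F-λ    : ∀ {a} → F₁ (C.λ′ {a}) ≋ D.λ′ {F₀ a}
    F-λ⁻¹  : ∀ {a} → F₁ (C.λ⁻¹ {a}) ≋ D.λ⁻¹ {F₀ a}
    F-ρ    : ∀ {a} → F₁ (C.ρ {a}) ≋ D.ρ {F₀ a}
    F-ρ⁻¹  : ∀ {a} → F₁ (C.ρ⁻¹ {a}) ≋ D.ρ⁻¹ {F₀ a}
    F-σ    : ∀ {a b} → F₁ (C.σ {a} {b}) ≋ D.σ {F₀ a} {F₀ b}
    F-ε    : ∀ {a b} → F₁ (C.ε {a} {b}) ≋ D.ε {F₀ a} {F₀ b}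
    F-η    : ∀ {a b} → F₁ (C.η {a} {b}) ≋ D.η {F₀ a} {F₀ b}

  F-resp-≋ : ∀ {a b c d} {f : C.Hom a b} {g : C.Hom c d} →
             Heterogeneous._≋_ C.raw f g → F₁ f ≋ F₁ g
  F-resp-≋ (Heterogeneous.≈⇒≋ p) = ≈⇒≋ (F-resp p)

module _ {o ℓ r o′ ℓ′ r′} (C : SMC o ℓ r) (D : SMC o′ ℓ′ r′) where
  private module C = SMC C
  open HeterogeneousProperties D
  open StrictFunctor

  StrictFunctors : Setoid (o ⊔ ℓ ⊔ r ⊔ o′ ⊔ ℓ′ ⊔ r′) (o ⊔ ℓ ⊔ o′ ⊔ ℓ′ ⊔ r′)
  StrictFunctors = record
    { Carrier = StrictFunctor C D
    ; _≈_ = λ F G → (∀ a → F₀ F a ≡ F₀ G a) ×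
                    (∀ {a b} (f : C.Hom a b) → F₁ F f ≋ F₁ G f)
    ; isEquivalence = record
      { refl  = (λ _ → refl) , (λ _ → ≋-refl)
      ; sym   = λ (p , q) → (λ a → sym (p a)) , (λ f → ≋-sym (q f))
      ; trans = λ (p , q) (p′ , q′) →
                  (λ a → trans (p a) (p′ a)) , (λ f → ≋-trans (q f) (q′ f))
      }
    }

infixr 9 _∘F_
_∘F_ : ∀ {o ℓ r o′ ℓ′ r′ o″ ℓ″ r″}
       {C : SMC o ℓ r} {D : SMC o′ ℓ′ r′} {E : SMC o″ ℓ″ r″} →
       StrictFunctor D E → StrictFunctor C D → StrictFunctor C E
_∘F_ {C = C} {D} {E} G F = record
  { F₀     = λ a → G.F₀ (F.F₀ a)
  ; F₁     = λ f → G.F₁ (F.F₁ f)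
  ; F-resp = λ p → G.F-resp (F.F-resp p)
  ; F-id   = E.trans (G.F-resp F.F-id) G.F-id
  ; F-∘    = E.trans (G.F-resp F.F-∘) G.F-∘
  ; F₀-⊗   = λ a b → trans (cong G.F₀ (F.F₀-⊗ a b)) (G.F₀-⊗ _ _)
  ; F₀-I   = trans (cong G.F₀ F.F₀-I) G.F₀-I
  ; F₀-⊸   = λ a b → trans (cong G.F₀ (F.F₀-⊸ a b)) (G.F₀-⊸ _ _)
  ; F₁-⊗   = ≋-trans (G.F-resp-≋ F.F₁-⊗) G.F₁-⊗
  ; F₁-⊸   = ≋-trans (G.F-resp-≋ F.F₁-⊸) G.F₁-⊸
  ; F-α    = ≋-trans (G.F-resp-≋ F.F-α) G.F-α
  ; F-α⁻¹  = ≋-trans (G.F-resp-≋ F.F-α⁻¹) G.F-α⁻¹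
  ; F-λ    = ≋-trans (G.F-resp-≋ F.F-λ) G.F-λ
  ; F-λ⁻¹  = ≋-trans (G.F-resp-≋ F.F-λ⁻¹) G.F-λ⁻¹
  ; F-ρ    = ≋-trans (G.F-resp-≋ F.F-ρ) G.F-ρ
  ; F-ρ⁻¹  = ≋-trans (G.F-resp-≋ F.F-ρ⁻¹) G.F-ρ⁻¹
  ; F-σ    = ≋-trans (G.F-resp-≋ F.F-σ) G.F-σ
  ; F-ε    = ≋-trans (G.F-resp-≋ F.F-ε) G.F-ε
  ; F-η    = ≋-trans (G.F-resp-≋ F.F-η) G.F-η
  }
  where
  module F = StrictFunctor F
  module G = StrictFunctor G
  module E {a b} = IsEquivalence (SMC.equiv E {a} {b})
  open HeterogeneousProperties E

infixr 10 _⊗_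
infixr 8 _⊸_
data Ty {x} (X : Set x) : Set x where
  var : X → Ty X
  I   : Ty X
  _⊗_ : Ty X → Ty X → Ty X
  _⊸_ : Ty X → Ty X → Ty X

record Signature (x s : Level) : Set (Level.suc (x ⊔ s)) where
  field
    X     : Set x
    Op    : Set s
    src   : Op → Ty X
    tgt   : Op → Ty X

  _⟶_ : Ty X → Ty X → Set (x ⊔ s)
  a ⟶ b = Σ[ f ∈ Op ] (src f ≡ a × tgt f ≡ b)

infixr 9 _∘ₜ_
infixr 10 _⊗ₜ_
infixr 8 _⊸ₜ_
data Term {x g} {X : Set x} (G : Ty X → Ty X → Set g) : Ty X → Ty X → Set (x ⊔ g) where
  gen  : ∀ {a b} → G a b → Term G a b
  αₜ   : ∀ {a b c} → Term G (a ⊗ (b ⊗ c)) ((a ⊗ b) ⊗ c)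
  α⁻¹ₜ : ∀ {a b c} → Term G ((a ⊗ b) ⊗ c) (a ⊗ (b ⊗ c))
  λₜ   : ∀ {a} → Term G (I ⊗ a) a
  λ⁻¹ₜ : ∀ {a} → Term G a (I ⊗ a)
  ρₜ   : ∀ {a} → Term G (a ⊗ I) a
  ρ⁻¹ₜ : ∀ {a} → Term G a (a ⊗ I)
  σₜ   : ∀ {a b} → Term G (a ⊗ b) (b ⊗ a)
  εₜ   : ∀ {a b} → Term G ((a ⊸ b) ⊗ a) b
  ηₜ   : ∀ {a b} → Term G a (b ⊸ (a ⊗ b))
  idₜ  : ∀ {a} → Term G a a
  _∘ₜ_ : ∀ {a b c} → Term G b c → Term G a b → Term G a c
  _⊗ₜ_ : ∀ {a b c d} → Term G a b → Term G c d → Term G (a ⊗ c) (b ⊗ d)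
  _⊸ₜ_ : ∀ {a b c d} → Term G a b → Term G c d → Term G (b ⊸ c) (a ⊸ d)

DerivedTerm : ∀ {x s} (S : Signature x s) → let open Signature S in Ty X → Ty X → Set (x ⊔ s)
DerivedTerm S = Term (Signature._⟶_ S)

record Theory (x s e : Level) : Set (Level.suc (x ⊔ s ⊔ e)) where
  field
    sig : Signature x s
  open Signature sig public
  field
    Eqn : ∀ {a b} → DerivedTerm sig a b → DerivedTerm sig a b → Set e

module _ {o ℓ r} (D : SMC o ℓ r) where
  open SMC D

  extOb : ∀ {x} {X : Set x} → (X → Ob) → Ty X → Ob
  extOb F (var v) = F v
  extOb F I       = unit
  extOb F (a ⊗ b) = extOb F a ⊗₀ extOb F b
  extOb F (a ⊸ b) = extOb F a ⊸₀ extOb F b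

  extHom : ∀ {x g} {X : Set x} {G : Ty X → Ty X → Set g} (F : X → Ob) →
           (∀ {a b} → G a b → Hom (extOb F a) (extOb F b)) →
           ∀ {a b} → Term G a b → Hom (extOb F a) (extOb F b)
  extHom F h (gen f)  = h f
  extHom F h αₜ       = α
  extHom F h α⁻¹ₜ     = α⁻¹
  extHom F h λₜ       = λ′
  extHom F h λ⁻¹ₜ     = λ⁻¹
  extHom F h ρₜ       = ρ
  extHom F h ρ⁻¹ₜ     = ρ⁻¹
  extHom F h σₜ       = σ
  extHom F h εₜ       = ε
  extHom F h ηₜ       = η
  extHom F h idₜ      = id
  extHom F h (g ∘ₜ f) = extHom F h g ∘ extHom F h f
  extHom F h (f ⊗ₜ g) = extHom F h f ⊗₁ extHom F h g
  extHom F h (f ⊸ₜ g) = extHom F h f ⊸₁ extHom F h g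

record Interpretation {x s e o ℓ r} (T : Theory x s e) (D : SMC o ℓ r) :
                      Set (x ⊔ s ⊔ e ⊔ o ⊔ ℓ ⊔ r) where
  open Theory T
  open SMC D using (Ob; Hom; _≈_)
  field
    obj : X → Ob
    op  : ∀ {a b} → a ⟶ b → Hom (extOb D obj a) (extOb D obj b)
    eqn : ∀ {a b} {u v : DerivedTerm sig a b} → Eqn u v →
          extHom D obj op u ≈ extHom D obj op v

module _ {x s e o ℓ r} (T : Theory x s e) (D : SMC o ℓ r) where
  open Theory T
  open HeterogeneousProperties D
  open Interpretation

  Interpretations : Setoid (x ⊔ s ⊔ e ⊔ o ⊔ ℓ ⊔ r) (x ⊔ s ⊔ o ⊔ ℓ ⊔ r)
  Interpretations = record
    { Carrier = Interpretation T D
    ; _≈_ = λ F G → (∀ v → obj F v ≡ obj G v) ×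
                    (∀ {a b} (f : a ⟶ b) → op F f ≋ op G f)
    ; isEquivalence = record
      { refl  = (λ _ → refl) , (λ _ → ≋-refl)
      ; sym   = λ (p , q) → (λ a → sym (p a)) , (λ f → ≋-sym (q f))
      ; trans = λ (p , q) (p′ , q′) →
                  (λ a → trans (p a) (p′ a)) , (λ f → ≋-trans (q f) (q′ f))
      }
    }

module _ {o ℓ r o′ ℓ′ r′} {D : SMC o ℓ r} {D′ : SMC o′ ℓ′ r′} (H : StrictFunctor D D′) where
  private
    module D = SMC D
    module D′ = SMC D′
  open StrictFunctor H
  open HeterogeneousProperties D′

  extOb-∘ : ∀ {x} {X : Set x} (F : X → D.Ob) (a : Ty X) →
            F₀ (extOb D F a) ≡ extOb D′ (λ v → F₀ (F v)) a
  extOb-∘ F (var v) = refl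
  extOb-∘ F I       = F₀-I
  extOb-∘ F (a ⊗ b) = trans (F₀-⊗ _ _) (cong₂ D′._⊗₀_ (extOb-∘ F a) (extOb-∘ F b))
  extOb-∘ F (a ⊸ b) = trans (F₀-⊸ _ _) (cong₂ D′._⊸₀_ (extOb-∘ F a) (extOb-∘ F b))

  module _ {x g} {X : Set x} {G : Ty X → Ty X → Set g} (F : X → D.Ob)
           (h : ∀ {a b} → G a b → D.Hom (extOb D F a) (extOb D F b)) where

    pushOp : ∀ {a b} → G a b →
             D′.Hom (extOb D′ (λ v → F₀ (F v)) a) (extOb D′ (λ v → F₀ (F v)) b)
    pushOp {a} {b} f = coe (extOb-∘ F a) (extOb-∘ F b) (F₁ (h f))

    private
      ext = extOb-∘ F

      cong₁-≋ : {t u : D′.Ob → D′.Ob} (f : ∀ a → D′.Hom (t a) (u a)) →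
                ∀ {a a′} → a ≡ a′ → f a ≋ f a′
      cong₁-≋ f refl = ≋-refl

      cong₂-≋ : {t u : D′.Ob → D′.Ob → D′.Ob} (f : ∀ a b → D′.Hom (t a b) (u a b)) →
                ∀ {a a′ b b′} → a ≡ a′ → b ≡ b′ → f a b ≋ f a′ b′
      cong₂-≋ f refl refl = ≋-refl

      cong₃-≋ : {t u : D′.Ob → D′.Ob → D′.Ob → D′.Ob}
                (f : ∀ a b c → D′.Hom (t a b c) (u a b c)) →
                ∀ {a a′ b b′ c c′} → a ≡ a′ → b ≡ b′ → c ≡ c′ → f a b c ≋ f a′ b′ c′
      cong₃-≋ f refl refl refl = ≋-refl

    extHom-∘ : ∀ {a b} (u : Term G a b) →
               F₁ (extHom D F h u) ≋ extHom D′ (λ v → F₀ (F v)) pushOp u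
    extHom-∘ (gen {a} {b} f)    = ≋-sym (coe-≋ (ext a) (ext b))
    extHom-∘ (αₜ {a} {b} {c})   = ≋-trans F-α (cong₃-≋ (λ a b c → D′.α {a} {b} {c}) (ext a) (ext b) (ext c))
    extHom-∘ (α⁻¹ₜ {a} {b} {c}) = ≋-trans F-α⁻¹ (cong₃-≋ (λ a b c → D′.α⁻¹ {a} {b} {c}) (ext a) (ext b) (ext c))
    extHom-∘ (λₜ {a})           = ≋-trans F-λ (cong₁-≋ (λ a → D′.λ′ {a}) (ext a))
    extHom-∘ (λ⁻¹ₜ {a})         = ≋-trans F-λ⁻¹ (cong₁-≋ (λ a → D′.λ⁻¹ {a}) (ext a))
    extHom-∘ (ρₜ {a})           = ≋-trans F-ρ (cong₁-≋ (λ a → D′.ρ {a}) (ext a))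
    extHom-∘ (ρ⁻¹ₜ {a})         = ≋-trans F-ρ⁻¹ (cong₁-≋ (λ a → D′.ρ⁻¹ {a}) (ext a))
    extHom-∘ (σₜ {a} {b})       = ≋-trans F-σ (cong₂-≋ (λ a b → D′.σ {a} {b}) (ext a) (ext b))
    extHom-∘ (εₜ {a} {b})       = ≋-trans F-ε (cong₂-≋ (λ a b → D′.ε {a} {b}) (ext a) (ext b))
    extHom-∘ (ηₜ {a} {b})       = ≋-trans F-η (cong₂-≋ (λ a b → D′.η {a} {b}) (ext a) (ext b))
    extHom-∘ (idₜ {a})          = ≋-trans (≈⇒≋ F-id) (cong₁-≋ (λ a → D′.id {a}) (ext a))
    extHom-∘ (g ∘ₜ f)           = ≋-trans (≈⇒≋ F-∘) (∘-resp-≋ (extHom-∘ g) (extHom-∘ f))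
    extHom-∘ (f ⊗ₜ g)           = ≋-trans F₁-⊗ (⊗-resp-≋ (extHom-∘ f) (extHom-∘ g))
    extHom-∘ (f ⊸ₜ g)           = ≋-trans F₁-⊸ (⊸-resp-≋ (extHom-∘ f) (extHom-∘ g))

infixr 9 _∘I_
_∘I_ : ∀ {x s e o ℓ r o′ ℓ′ r′} {T : Theory x s e} {D : SMC o ℓ r} {D′ : SMC o′ ℓ′ r′} →
       StrictFunctor D D′ → Interpretation T D → Interpretation T D′
_∘I_ {D′ = D′} H F = record
  { obj = λ v → F₀ (obj v)
  ; op  = λ {a} {b} → pushOp H obj (λ {a} {b} → op {a} {b}) {a} {b}
  ; eqn = λ {_} {_} {u} {v} p →
      ≋⇒≈ (≋-trans (≋-sym (extHom-∘ H obj op u))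
          (≋-trans (≈⇒≋ (F-resp (eqn p))) (extHom-∘ H obj op v)))
  }
  where
  open StrictFunctor H
  open Interpretation F
  open HeterogeneousProperties D′

-- The free SMC category on a set X: terms without generators, modulo the
-- congruence generated by the SMC axioms

module Free {x} (X : Set x) where

  infix 4 _⇒_ _≈_
  _⇒_ : Ty X → Ty X → Set x
  _⇒_ = Term {X = X} (λ _ _ → ⊥ {x})

  data _≈_ : ∀ {a b} → a ⇒ b → a ⇒ b → Set x where
    ≈-refl    : ∀ {a b} {f : a ⇒ b} → f ≈ f
    ≈-sym     : ∀ {a b} {f g : a ⇒ b} → f ≈ g → g ≈ f
    ≈-trans   : ∀ {a b} {f g h : a ⇒ b} → f ≈ g → g ≈ h → f ≈ h
    ∘-resp-≈  : ∀ {a b c} {g g′ : b ⇒ c} {f f′ : a ⇒ b} →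
                g ≈ g′ → f ≈ f′ → g ∘ₜ f ≈ g′ ∘ₜ f′
    ⊗-resp-≈  : ∀ {a b c d} {f f′ : a ⇒ b} {g g′ : c ⇒ d} →
                f ≈ f′ → g ≈ g′ → f ⊗ₜ g ≈ f′ ⊗ₜ g′
    ⊸-resp-≈  : ∀ {a b c d} {f f′ : a ⇒ b} {g g′ : c ⇒ d} →
                f ≈ f′ → g ≈ g′ → f ⊸ₜ g ≈ f′ ⊸ₜ g′

    identityˡ : ∀ {a b} {f : a ⇒ b} → idₜ ∘ₜ f ≈ f
    identityʳ : ∀ {a b} {f : a ⇒ b} → f ∘ₜ idₜ ≈ f
    assoc     : ∀ {a b c d} {f : a ⇒ b} {g : b ⇒ c} {h : c ⇒ d} →
                (h ∘ₜ g) ∘ₜ f ≈ h ∘ₜ (g ∘ₜ f)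
    ⊗-id      : ∀ {a b} → idₜ {a = a} ⊗ₜ idₜ {a = b} ≈ idₜ
    ⊗-∘       : ∀ {a b c a′ b′ c′} {f : a ⇒ b} {g : b ⇒ c} {f′ : a′ ⇒ b′} {g′ : b′ ⇒ c′} →
                (g ∘ₜ f) ⊗ₜ (g′ ∘ₜ f′) ≈ (g ⊗ₜ g′) ∘ₜ (f ⊗ₜ f′)
    ⊸-id      : ∀ {a b} → idₜ {a = a} ⊸ₜ idₜ {a = b} ≈ idₜ
    ⊸-∘       : ∀ {a b c a′ b′ c′} {f : a ⇒ b} {g : b ⇒ c} {f′ : a′ ⇒ b′} {g′ : b′ ⇒ c′} →
                (g ∘ₜ f) ⊸ₜ (g′ ∘ₜ f′) ≈ (f ⊸ₜ g′) ∘ₜ (g ⊸ₜ f′)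
    α-isoˡ    : ∀ {a b c} → α⁻¹ₜ ∘ₜ αₜ {a = a} {b} {c} ≈ idₜ
    α-isoʳ    : ∀ {a b c} → αₜ {a = a} {b} {c} ∘ₜ α⁻¹ₜ ≈ idₜ
    λ-isoˡ    : ∀ {a} → λ⁻¹ₜ ∘ₜ λₜ {a = a} ≈ idₜ
    λ-isoʳ    : ∀ {a} → λₜ {a = a} ∘ₜ λ⁻¹ₜ ≈ idₜ
    ρ-isoˡ    : ∀ {a} → ρ⁻¹ₜ ∘ₜ ρₜ {a = a} ≈ idₜ
    ρ-isoʳ    : ∀ {a} → ρₜ {a = a} ∘ₜ ρ⁻¹ₜ ≈ idₜ
    σ-iso     : ∀ {a b} → σₜ {a = b} {a} ∘ₜ σₜ {a = a} {b} ≈ idₜ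
    α-natural : ∀ {a b c a′ b′ c′} {f : a ⇒ a′} {g : b ⇒ b′} {h : c ⇒ c′} →
                αₜ ∘ₜ (f ⊗ₜ (g ⊗ₜ h)) ≈ ((f ⊗ₜ g) ⊗ₜ h) ∘ₜ αₜ
    λ-natural : ∀ {a b} {f : a ⇒ b} → λₜ ∘ₜ (idₜ ⊗ₜ f) ≈ f ∘ₜ λₜ
    ρ-natural : ∀ {a b} {f : a ⇒ b} → ρₜ ∘ₜ (f ⊗ₜ idₜ) ≈ f ∘ₜ ρₜ
    σ-natural : ∀ {a b c d} {f : a ⇒ b} {g : c ⇒ d} →
                σₜ ∘ₜ (f ⊗ₜ g) ≈ (g ⊗ₜ f) ∘ₜ σₜ
    pentagon  : ∀ {a b c d} →
                αₜ ∘ₜ αₜ {a = a} {b} {c ⊗ d} ≈ (αₜ ⊗ₜ idₜ) ∘ₜ (αₜ ∘ₜ (idₜ ⊗ₜ αₜ))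
    triangle  : ∀ {a b} → (ρₜ ⊗ₜ idₜ) ∘ₜ αₜ {a = a} {I} {b} ≈ idₜ ⊗ₜ λₜ
    hexagon   : ∀ {a b c} →
                αₜ ∘ₜ (σₜ ∘ₜ αₜ {a = a} {b} {c}) ≈ (σₜ ⊗ₜ idₜ) ∘ₜ (αₜ ∘ₜ (idₜ ⊗ₜ σₜ))
    ε-natural : ∀ {a b c} {g : b ⇒ c} → εₜ {a = a} ∘ₜ ((idₜ ⊸ₜ g) ⊗ₜ idₜ) ≈ g ∘ₜ εₜ
    ε-extra   : ∀ {a b c} {f : a ⇒ b} →
                εₜ ∘ₜ ((f ⊸ₜ idₜ {a = c}) ⊗ₜ idₜ) ≈ εₜ ∘ₜ (idₜ ⊗ₜ f)
    η-natural : ∀ {a b c} {f : a ⇒ b} → ηₜ {a = b} {c} ∘ₜ f ≈ (idₜ ⊸ₜ (f ⊗ₜ idₜ)) ∘ₜ ηₜ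
    η-extra   : ∀ {a b c} {f : b ⇒ c} →
                (f ⊸ₜ idₜ) ∘ₜ ηₜ {a = a} ≈ (idₜ ⊸ₜ (idₜ ⊗ₜ f)) ∘ₜ ηₜ
    zig       : ∀ {a b} → εₜ ∘ₜ (ηₜ {a = a} {b} ⊗ₜ idₜ) ≈ idₜ
    zag       : ∀ {a b} → (idₜ ⊸ₜ εₜ) ∘ₜ ηₜ {a = b ⊸ a} {b} ≈ idₜ

freeSMC : ∀ {x} (X : Set x) → SMC x x x
freeSMC X = smc raw isSMC
  where
  open Free X
  raw = record
    { Ob = Ty X ; Hom = _⇒_ ; _≈_ = _≈_
    ; _⊗₀_ = _⊗_ ; unit = I ; _⊸₀_ = _⊸_
    ; id = idₜ ; _∘_ = _∘ₜ_ ; _⊗₁_ = _⊗ₜ_ ; _⊸₁_ = _⊸ₜ_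
    ; α = αₜ ; α⁻¹ = α⁻¹ₜ ; λ′ = λₜ ; λ⁻¹ = λ⁻¹ₜ ; ρ = ρₜ ; ρ⁻¹ = ρ⁻¹ₜ
    ; σ = σₜ ; ε = εₜ ; η = ηₜ
    }
  isSMC : IsSMC raw
  isSMC = record
    { equiv = record { refl = ≈-refl ; sym = ≈-sym ; trans = ≈-trans }
    ; ∘-resp-≈ = ∘-resp-≈ ; identityˡ = identityˡ ; identityʳ = identityʳ ; assoc = assoc
    ; ⊗-resp-≈ = ⊗-resp-≈ ; ⊗-id = ⊗-id ; ⊗-∘ = ⊗-∘
    ; ⊸-resp-≈ = ⊸-resp-≈ ; ⊸-id = ⊸-id ; ⊸-∘ = ⊸-∘
    ; α-isoˡ = α-isoˡ ; α-isoʳ = α-isoʳ ; λ-isoˡ = λ-isoˡ ; λ-isoʳ = λ-isoʳ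
    ; ρ-isoˡ = ρ-isoˡ ; ρ-isoʳ = ρ-isoʳ ; σ-iso = σ-iso
    ; α-natural = α-natural ; λ-natural = λ-natural
    ; ρ-natural = ρ-natural ; σ-natural = σ-natural
    ; pentagon = pentagon ; triangle = triangle ; hexagon = hexagon
    ; ε-natural = ε-natural ; ε-extra = ε-extra
    ; η-natural = η-natural ; η-extra = η-extra
    ; zig = zig ; zag = zag
    }

module CXΣ {x s} (S : Signature x s) where
  open Signature S
  open SMC (freeSMC X)

  ⌜_⌝ : Op → Ty X
  ⌜ f ⌝ = src f ⊸ tgt f

  tyAcc : Ty X → List Op → Ty X
  tyAcc = foldl (λ a g → a ⊗ ⌜ g ⌝)

  ty : List Op → Ty X
  ty []      = I
  ty (f ∷ Γ) = tyAcc ⌜ f ⌝ Γ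

  -- The canonical isomorphism tyAcc a Γ ≅ a ⊗ ty Γ and its inverse.  For
  -- a = ⌜ f ⌝ they split off, resp. adjoin, the first factor of ty (f ∷ Γ),
  -- which is bracketed to the left.
  split : ∀ a Γ → Hom (tyAcc a Γ) (a ⊗ ty Γ)
  join  : ∀ a Γ → Hom (a ⊗ ty Γ) (tyAcc a Γ)
  split a []      = ρ⁻¹
  split a (g ∷ Γ) = (id ⊗₁ join ⌜ g ⌝ Γ) ∘ (α⁻¹ ∘ split (a ⊗ ⌜ g ⌝) Γ)
  join a []       = ρ
  join a (g ∷ Γ)  = join (a ⊗ ⌜ g ⌝) Γ ∘ (α ∘ (id ⊗₁ split ⌜ g ⌝ Γ))

  ty-++ : ∀ Γ Δ → Hom (ty (Γ ++ Δ)) (ty Γ ⊗ ty Δ)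
  ty-++ []      Δ = λ⁻¹
  ty-++ (f ∷ Γ) Δ = (join ⌜ f ⌝ Γ ⊗₁ id) ∘ (α ∘ ((id ⊗₁ ty-++ Γ Δ) ∘ split ⌜ f ⌝ (Γ ++ Δ)))

  -- Moves the i-th factor to the front, keeping the others in order.
  extract : ∀ {n} (Γ : Vec Op (suc n)) (i : Fin (suc n)) →
            Hom (ty (toList Γ)) (⌜ lookup Γ i ⌝ ⊗ ty (toList (removeAt Γ i)))
  extract (f ∷ Γ)         zero    = split ⌜ f ⌝ (toList Γ)
  extract (f ∷ Γ@(_ ∷ _)) (suc i) =
    (id ⊗₁ join ⌜ f ⌝ (toList (removeAt Γ i))) ∘
    (α⁻¹ ∘ ((σ ⊗₁ id) ∘ (α ∘ ((id ⊗₁ extract Γ i) ∘ split ⌜ f ⌝ (toList Γ)))))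

  permute : ∀ {n} → Permutation n n → Vec Op n → Vec Op n
  permute π Γ = tabulate (λ i → lookup Γ (π ⟨$⟩ʳ i))

  permute-tail : ∀ {n} (π : Permutation (suc n) (suc n)) (Γ : Vec Op (suc n)) →
                 permute (remove zero π) (removeAt Γ (π ⟨$⟩ʳ zero)) ≡
                 Vec.tail (permute π Γ)
  permute-tail π Γ = tabulate-cong (λ _ → removeAt-punchOut Γ _)

  -- The canonical isomorphism permuting the tensor factors along π: bring the
  -- factor which is to come first to the front, then permute the others.
  perm : ∀ {n} (π : Permutation n n) (Γ : Vec Op n) →
         Hom (ty (toList Γ)) (ty (toList (permute π Γ)))
  perm {zero}  π []        = id
  perm {suc n} π Γ@(_ ∷ _) =
    join ⌜ lookup Γ j ⌝ (toList (Vec.tail (permute π Γ))) ∘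
    ((id ⊗₁ rest) ∘ extract Γ j)
    where
    j = π ⟨$⟩ʳ zero
    rest : Hom (ty (toList (removeAt Γ j))) (ty (toList (Vec.tail (permute π Γ))))
    rest = subst (λ Δ → Hom (ty (toList (removeAt Γ j))) (ty (toList Δ)))
                 (permute-tail π Γ)
                 (perm (remove zero π) (removeAt Γ j))

  interchange : ∀ {a b c d} → Hom ((a ⊗ b) ⊗ (c ⊗ d)) ((a ⊗ c) ⊗ (b ⊗ d))
  interchange = α ∘ ((id ⊗₁ (α⁻¹ ∘ ((σ ⊗₁ id) ∘ α))) ∘ α⁻¹)

  record Mor (U V : Ty X) : Set (x ⊔ s) where
    constructor _,_
    field
      ctx  : List Op
      body : Hom (ty ctx ⊗ U) V

  -- Since the homs of the free SMC category are setoids, a pair (Γ , φ) must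
  -- also be identified with (Γ , ψ) whenever φ ≈ ψ.
  data _↝_ {U V} : Mor U V → Mor U V → Set (x ⊔ s) where
    bodies    : ∀ {Γ} {φ ψ : Hom (ty Γ ⊗ U) V} → φ ≈ ψ → (Γ , φ) ↝ (Γ , ψ)
    permuting : ∀ {n} (Γ : Vec Op n) (π : Permutation n n)
                (φ : Hom (ty (toList (permute π Γ)) ⊗ U) V) →
                (toList (permute π Γ) , φ) ↝ (toList Γ , φ ∘ (perm π Γ ⊗₁ id))

  infix 4 _∼_
  _∼_ : ∀ {U V} → Mor U V → Mor U V → Set (x ⊔ s)
  _∼_ = EqClosure _↝_

  inc : ∀ {U V} → Hom U V → Mor U V
  inc φ = [] , φ ∘ λ′

  infixr 9 _∘ₘ_
  infixr 10 _⊗ₘ_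
  infixr 8 _⊸ₘ_

  idₘ : ∀ {U} → Mor U U
  idₘ = [] , λ′

  _∘ₘ_ : ∀ {U V W} → Mor V W → Mor U V → Mor U W
  (Δ , ψ) ∘ₘ (Γ , φ) = (Δ ++ Γ) , ψ ∘ ((id ⊗₁ φ) ∘ (α⁻¹ ∘ (ty-++ Δ Γ ⊗₁ id)))

  _⊗ₘ_ : ∀ {U V U′ V′} → Mor U V → Mor U′ V′ → Mor (U ⊗ U′) (V ⊗ V′)
  (Γ , φ) ⊗ₘ (Γ′ , φ′) = (Γ ++ Γ′) , (φ ⊗₁ φ′) ∘ (interchange ∘ (ty-++ Γ Γ′ ⊗₁ id))

  curryₘ : ∀ {U V W} → Mor (U ⊗ V) W → Mor U (V ⊸ W)
  curryₘ (Γ , φ) = Γ , (id ⊸₁ (φ ∘ α⁻¹)) ∘ η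

  -- The action of the internal hom on morphisms which the closed structure
  -- induces: f ⊸ g is the transpose of g ∘ ε ∘ (id ⊗ f).
  _⊸ₘ_ : ∀ {U V U′ V′} → Mor U V → Mor U′ V′ → Mor (V ⊸ U′) (U ⊸ V′)
  f ⊸ₘ g = curryₘ (g ∘ₘ (inc ε ∘ₘ (idₘ ⊗ₘ f)))

  CXΣ : RawSMC x (x ⊔ s) (x ⊔ s)
  CXΣ = record
    { Ob = Ty X ; Hom = Mor ; _≈_ = _∼_
    ; _⊗₀_ = _⊗_ ; unit = I ; _⊸₀_ = _⊸_
    ; id = idₘ ; _∘_ = _∘ₘ_ ; _⊗₁_ = _⊗ₘ_ ; _⊸₁_ = _⊸ₘ_
    ; α = inc α ; α⁻¹ = inc α⁻¹ ; λ′ = inc λ′ ; λ⁻¹ = inc λ⁻¹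
    ; ρ = inc ρ ; ρ⁻¹ = inc ρ⁻¹ ; σ = inc σ ; ε = inc ε ; η = inc η
    }

  opₘ : ∀ {a b} → a ⟶ b → Mor a b
  opₘ (f , refl , refl) = (f ∷ []) , ε

  -- This is extHom for the interpretation of the signature given by var and
  -- opₘ.  Since extOb var a is only propositionally equal to a, extHom itself
  -- would require transports.
  denote : ∀ {a b} → DerivedTerm S a b → Mor a b
  denote (gen f)  = opₘ f
  denote αₜ       = inc α
  denote α⁻¹ₜ     = inc α⁻¹
  denote λₜ       = inc λ′
  denote λ⁻¹ₜ     = inc λ⁻¹
  denote ρₜ       = inc ρ
  denote ρ⁻¹ₜ     = inc ρ⁻¹
  denote σₜ       = inc σ
  denote εₜ       = inc ε
  denote ηₜ       = inc η
  denote idₜ      = idₘ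
  denote (g ∘ₜ f) = denote g ∘ₘ denote f
  denote (f ⊗ₜ g) = denote f ⊗ₘ denote g
  denote (f ⊸ₜ g) = denote f ⊸ₘ denote g

module _ {o ℓ r p} (C : RawSMC o ℓ r)
         (R : ∀ {a b} → RawSMC.Hom C a b → RawSMC.Hom C a b → Set p) where
  open RawSMC C

  infix 4 _≈ᴿ_
  data _≈ᴿ_ : ∀ {a b} → Hom a b → Hom a b → Set (o ⊔ ℓ ⊔ r ⊔ p) where
    incl    : ∀ {a b} {f g : Hom a b} → R f g → f ≈ᴿ g
    base    : ∀ {a b} {f g : Hom a b} → f ≈ g → f ≈ᴿ g
    symm    : ∀ {a b} {f g : Hom a b} → f ≈ᴿ g → g ≈ᴿ f
    transit : ∀ {a b} {f g h : Hom a b} → f ≈ᴿ g → g ≈ᴿ h → f ≈ᴿ h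
    ∘-cong  : ∀ {a b c} {g g′ : Hom b c} {f f′ : Hom a b} →
              g ≈ᴿ g′ → f ≈ᴿ f′ → g ∘ f ≈ᴿ g′ ∘ f′
    ⊗-cong  : ∀ {a b c d} {f f′ : Hom a b} {g g′ : Hom c d} →
              f ≈ᴿ f′ → g ≈ᴿ g′ → f ⊗₁ g ≈ᴿ f′ ⊗₁ g′
    ⊸-cong  : ∀ {a b c d} {f f′ : Hom a b} {g g′ : Hom c d} →
              f ≈ᴿ f′ → g ≈ᴿ g′ → f ⊸₁ g ≈ᴿ f′ ⊸₁ g′

  quotient : RawSMC o ℓ (o ⊔ ℓ ⊔ r ⊔ p)
  quotient = record
    { Ob = Ob ; Hom = Hom ; _≈_ = _≈ᴿ_
    ; _⊗₀_ = _⊗₀_ ; unit = unit ; _⊸₀_ = _⊸₀_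
    ; id = id ; _∘_ = _∘_ ; _⊗₁_ = _⊗₁_ ; _⊸₁_ = _⊸₁_
    ; α = α ; α⁻¹ = α⁻¹ ; λ′ = λ′ ; λ⁻¹ = λ⁻¹ ; ρ = ρ ; ρ⁻¹ = ρ⁻¹
    ; σ = σ ; ε = ε ; η = η
    }

module _ {x s e} (T : Theory x s e) where
  open Theory T
  open CXΣ sig

  data Equations : ∀ {a b} → Mor a b → Mor a b → Set (x ⊔ s ⊔ e) where
    equation : ∀ {a b} {u v : DerivedTerm sig a b} → Eqn u v →
               Equations (denote u) (denote v)

  CT : RawSMC x (x ⊔ s) (x ⊔ s ⊔ e)
  CT = quotient CXΣ Equations

{-# OPTIONS --safe #-}

-- A morphism (Γ , φ) is φ evaluated at the point names Γ : I → ty Γ, so it is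
-- denoted by the derived term read (Γ , φ) built from φ and the names of the
-- operations in Γ.  An interpretation in 𝒟 therefore extends to 𝒞_𝕋 by
-- interpreting read (Γ , φ), and this is the only choice for a strict functor.
--
-- The SMC axioms for 𝒞_𝕋 reduce to equations between morphisms with the same
-- context: f ⊗ g factors as (f ⊗ id) ∘ (id ⊗ g), naturality is needed in one
-- variable only because σ carries it to the others, and the interchange law
-- holds for all morphisms as soon as it holds for morphisms of 𝒞_X and for
-- names of operations.  Only the last case uses the permutation of contexts,
-- and only for contexts of length two.
module Submission where

open import Data.Fin.Base using (zero; suc)
open import Data.Fin.Permutation using (Permutation; _⟨$⟩ʳ_; remove)
  renaming (swap to swapᵖ; id to idᵖ)
open import Data.List.Base using (List; []; _∷_; _++_)
open import Data.List.Properties using (++-assoc; ++-identityʳ)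
open import Data.Nat.Base using (zero; suc)
open import Data.Product.Base using (Σ-syntax; _×_; _,_)
open import Data.Vec.Base using (Vec; []; _∷_; lookup; removeAt; toList)
open import Function.Base using (_$_)
open import Function.Bundles using (Inverse)
open import Level using (_⊔_)
open import Relation.Binary.Bundles using (Setoid)
open import Relation.Binary.Construct.Closure.Equivalence using (return)
open import Relation.Binary.Construct.Closure.ReflexiveTransitive
  using (_◅_) renaming (ε to [])
open import Relation.Binary.Construct.Closure.Symmetric using (fwd; bwd)
open import Relation.Binary.PropositionalEquality
  using (_≡_; refl; sym; trans; cong; cong₂; subst)
import Relation.Binary.Reasoning.Setoid as SetoidReasoning
open import Relation.Binary.Structures using (IsEquivalence)
open import Defs

-- Coherence is invoked only for maps without symmetry. A symmetry with a unit argument becomes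
-- structural by `σ-unitˡ` or `σ-unitʳ`; the others are handled by naturality and the hexagon.
--
-- Evaluation in an SMC category has to respect every permutation of a context, yet no coherence
-- theorem for symmetries is needed: evaluation sees `perm` only applied to a tensor of points, and
-- by naturality a symmetry applied to points leaves a symmetry of `unit ⊗₀ unit`, which is the
-- identity.
--
-- Evaluation passes through terms because `extHom` comes with its behaviour under change of
-- interpretation and under strict functors; the corresponding facts about functors out of the
-- classifying category are instances at `read f`. Two facts link both sides: `eval-denote` makes
-- the equations of the theory hold, and `denote-read` gives uniqueness.
--
-- Contexts such as `Γ ++ []` and `Γ`, and objects such as `F₀ (a ⊗ b)` and `F₀ a ⊗₀ F₀ b`, agree
-- only propositionally. The former are bridged by `relabel`, the latter by comparing morphisms with
-- `_≋_`.

record IsCategory {o ℓ r} (C : RawSMC o ℓ r) : Set (o ⊔ ℓ ⊔ r) where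
  open RawSMC C
  field
    equiv     : ∀ {a b} → IsEquivalence (_≈_ {a} {b})
    ∘-resp-≈  : ∀ {a b c} {g g′ : Hom b c} {f f′ : Hom a b} →
                g ≈ g′ → f ≈ f′ → g ∘ f ≈ g′ ∘ f′
    identityˡ : ∀ {a b} {f : Hom a b} → id ∘ f ≈ f
    identityʳ : ∀ {a b} {f : Hom a b} → f ∘ id ≈ f
    assoc     : ∀ {a b c d} {f : Hom a b} {g : Hom b c} {h : Hom c d} →
                (h ∘ g) ∘ f ≈ h ∘ (g ∘ f)

-- Based on the category laws alone, so that the same rewriting rules serve SMC categories and
-- quotients whose monoidal laws are still to be proved.
module CategoryReasoning {o ℓ r} {C : RawSMC o ℓ r} (isCategory : IsCategory C) where
  open RawSMC C
  open IsCategory isCategory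

  module Eq {a b} = IsEquivalence (equiv {a} {b})

  homSetoid : (a b : Ob) → Setoid ℓ r
  homSetoid a b = record { Carrier = Hom a b ; _≈_ = _≈_ ; isEquivalence = equiv }

  module HomReasoning {a b} = SetoidReasoning (homSetoid a b)
  open HomReasoning public

  private variable
    a b c d e : Ob
    f f′ g g′ h h′ k l x : Hom a b

  ∘ʳ : f ≈ f′ → g ∘ f ≈ g ∘ f′
  ∘ʳ p = ∘-resp-≈ Eq.refl p

  ∘ˡ : g ≈ g′ → g ∘ f ≈ g′ ∘ f
  ∘ˡ p = ∘-resp-≈ p Eq.refl

  pullˡ : g ∘ f ≈ k → g ∘ (f ∘ x) ≈ k ∘ x
  pullˡ p = Eq.trans (Eq.sym assoc) (∘ˡ p)

  pushˡ : k ≈ g ∘ f → k ∘ x ≈ g ∘ (f ∘ x)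
  pushˡ p = Eq.trans (∘ˡ p) assoc

  pullʳ : f ∘ x ≈ k → (g ∘ f) ∘ x ≈ g ∘ k
  pullʳ p = Eq.trans assoc (∘ʳ p)

  extendʳ : g ∘ f ≈ g′ ∘ f′ → g ∘ (f ∘ x) ≈ g′ ∘ (f′ ∘ x)
  extendʳ p = Eq.trans (pullˡ p) assoc

  cancelˡ : g ∘ f ≈ id → g ∘ (f ∘ x) ≈ x
  cancelˡ p = Eq.trans (pullˡ p) identityˡ

  cancelʳ : g ∘ f ≈ id → (x ∘ g) ∘ f ≈ x
  cancelʳ p = Eq.trans (pullʳ p) identityʳ

  elimˡ : g ≈ id → g ∘ f ≈ f
  elimˡ p = Eq.trans (∘ˡ p) identityˡ

  elimʳ : f ≈ id → g ∘ f ≈ g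
  elimʳ p = Eq.trans (∘ʳ p) identityʳ

  id-comm : id ∘ f ≈ f ∘ id
  id-comm = Eq.trans identityˡ (Eq.sym identityʳ)

  monoˡ : h ∘ k ≈ id → k ∘ f ≈ k ∘ g → f ≈ g
  monoˡ p q = Eq.trans (Eq.sym (cancelˡ p)) (Eq.trans (∘ʳ q) (cancelˡ p))

  epiʳ : k ∘ h ≈ id → f ∘ k ≈ g ∘ k → f ≈ g
  epiʳ p q = Eq.trans (Eq.sym (cancelʳ p)) (Eq.trans (∘ˡ q) (cancelʳ p))

-- Monoidal categories: Kelly's unit laws and coherence.

module SMCProperties {o ℓ r} (C : SMC o ℓ r) where
  open SMC C

  isCategory : IsCategory raw
  isCategory = record
    { equiv = equiv ; ∘-resp-≈ = ∘-resp-≈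
    ; identityˡ = identityˡ ; identityʳ = identityʳ ; assoc = assoc }

  open CategoryReasoning isCategory public

  private variable
    a b c d e a′ b′ c′ d′ : Ob
    f f′ g g′ h h′ k l x : Hom a b

  ⊗ʳ : f ≈ f′ → g ⊗₁ f ≈ g ⊗₁ f′
  ⊗ʳ p = ⊗-resp-≈ Eq.refl p

  ⊗ˡ : g ≈ g′ → g ⊗₁ f ≈ g′ ⊗₁ f
  ⊗ˡ p = ⊗-resp-≈ p Eq.refl

  merge : (g ⊗₁ g′) ∘ (f ⊗₁ f′) ≈ (g ∘ f) ⊗₁ (g′ ∘ f′)
  merge = Eq.sym ⊗-∘

  merge₁ : (g ⊗₁ id {a}) ∘ (f ⊗₁ id) ≈ (g ∘ f) ⊗₁ id
  merge₁ = Eq.trans merge (⊗ʳ identityˡ)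

  merge₂ : (id {a} ⊗₁ g) ∘ (id ⊗₁ f) ≈ id ⊗₁ (g ∘ f)
  merge₂ = Eq.trans merge (⊗ˡ identityˡ)

  ⊗-serialize₁₂ : f ⊗₁ g ≈ (f ⊗₁ id) ∘ (id ⊗₁ g)
  ⊗-serialize₁₂ = Eq.sym (Eq.trans merge (⊗-resp-≈ identityʳ identityˡ))

  ⊗-serialize₂₁ : f ⊗₁ g ≈ (id ⊗₁ g) ∘ (f ⊗₁ id)
  ⊗-serialize₂₁ = Eq.sym (Eq.trans merge (⊗-resp-≈ identityˡ identityʳ))

  ⊗-interchange : (f ⊗₁ id) ∘ (id ⊗₁ g) ≈ (id ⊗₁ g) ∘ (f ⊗₁ id)
  ⊗-interchange = Eq.trans (Eq.sym ⊗-serialize₁₂) ⊗-serialize₂₁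

  ⊗-iso : g ∘ f ≈ id → g′ ∘ f′ ≈ id → (g ⊗₁ g′) ∘ (f ⊗₁ f′) ≈ id
  ⊗-iso p q = Eq.trans merge (Eq.trans (⊗-resp-≈ p q) ⊗-id)

  α⁻¹-natural : α⁻¹ ∘ ((f ⊗₁ g) ⊗₁ h) ≈ (f ⊗₁ (g ⊗₁ h)) ∘ α⁻¹
  α⁻¹-natural = monoˡ α-isoˡ (begin
    α ∘ (α⁻¹ ∘ _)        ≈⟨ cancelˡ α-isoʳ ⟩
    _                    ≈⟨ cancelʳ α-isoʳ ⟨
    (_ ∘ α) ∘ α⁻¹        ≈⟨ ∘ˡ α-natural ⟨
    (α ∘ _) ∘ α⁻¹        ≈⟨ assoc ⟩
    α ∘ (_ ∘ α⁻¹)        ∎)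

  λ⁻¹-natural : λ⁻¹ ∘ f ≈ (id ⊗₁ f) ∘ λ⁻¹
  λ⁻¹-natural = monoˡ λ-isoˡ (begin
    λ′ ∘ (λ⁻¹ ∘ _)            ≈⟨ cancelˡ λ-isoʳ ⟩
    _                         ≈⟨ cancelʳ λ-isoʳ ⟨
    (_ ∘ λ′) ∘ λ⁻¹            ≈⟨ ∘ˡ λ-natural ⟨
    (λ′ ∘ (id ⊗₁ _)) ∘ λ⁻¹    ≈⟨ assoc ⟩
    λ′ ∘ ((id ⊗₁ _) ∘ λ⁻¹)    ∎)

  ρ⁻¹-natural : ρ⁻¹ ∘ f ≈ (f ⊗₁ id) ∘ ρ⁻¹
  ρ⁻¹-natural = monoˡ ρ-isoˡ (begin
    ρ ∘ (ρ⁻¹ ∘ _)            ≈⟨ cancelˡ ρ-isoʳ ⟩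
    _                        ≈⟨ cancelʳ ρ-isoʳ ⟨
    (_ ∘ ρ) ∘ ρ⁻¹            ≈⟨ ∘ˡ ρ-natural ⟨
    (ρ ∘ (_ ⊗₁ id)) ∘ ρ⁻¹    ≈⟨ assoc ⟩
    ρ ∘ ((_ ⊗₁ id) ∘ ρ⁻¹)    ∎)

  -- Naturality of the invertible `λ′` conjugates `id ⊗₁ f` back to `f`. The arguments of Kelly
  -- below use the extra unit factor to make room for the pentagon.
  ⊗-faithfulˡ : id {unit} ⊗₁ f ≈ id ⊗₁ g → f ≈ g
  ⊗-faithfulˡ p = epiʳ λ-isoʳ (Eq.trans (Eq.sym λ-natural) (Eq.trans (∘ʳ p) λ-natural))

  ⊗-faithfulʳ : f ⊗₁ id {unit} ≈ g ⊗₁ id → f ≈ g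
  ⊗-faithfulʳ p = epiʳ ρ-isoʳ (Eq.trans (Eq.sym ρ-natural) (Eq.trans (∘ʳ p) ρ-natural))

  -- Kelly's derivation: tensored with a further unit on the left, the claim follows from the
  -- pentagon at `unit`, `unit`, `a`, `b`, two of whose edges the triangle turns into unitors.
  λ-α : (λ′ {a} ⊗₁ id {b}) ∘ α ≈ λ′
  λ-α = ⊗-faithfulˡ (monoˡ α-isoˡ (begin
    α ∘ (id ⊗₁ ((λ′ ⊗₁ id) ∘ α))                    ≈⟨ ∘ʳ merge₂ ⟨
    α ∘ ((id ⊗₁ (λ′ ⊗₁ id)) ∘ (id ⊗₁ α))            ≈⟨ extendʳ α-natural ⟩
    ((id ⊗₁ λ′) ⊗₁ id) ∘ (α ∘ (id ⊗₁ α))            ≈⟨ (∘ˡ (⊗ˡ triangle)) ⟨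
    (((ρ ⊗₁ id) ∘ α) ⊗₁ id) ∘ (α ∘ (id ⊗₁ α))       ≈⟨ pushˡ (Eq.sym merge₁) ⟩
    ((ρ ⊗₁ id) ⊗₁ id) ∘ ((α ⊗₁ id) ∘ (α ∘ (id ⊗₁ α))) ≈⟨ ∘ʳ pentagon ⟨
    ((ρ ⊗₁ id) ⊗₁ id) ∘ (α ∘ α)                     ≈⟨ extendʳ (Eq.sym α-natural) ⟩
    α ∘ ((ρ ⊗₁ (id ⊗₁ id)) ∘ α)                     ≈⟨ ∘ʳ $ (∘ˡ (⊗ʳ ⊗-id)) ⟩
    α ∘ ((ρ ⊗₁ id) ∘ α)                             ≈⟨ ∘ʳ triangle ⟩
    α ∘ (id ⊗₁ λ′)                                  ∎))

  λ-unit : λ′ {unit ⊗₀ a} ≈ id ⊗₁ λ′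
  λ-unit = monoˡ λ-isoˡ (Eq.sym λ-natural)

  λ≈ρ : λ′ {unit} ≈ ρ
  λ≈ρ = ⊗-faithfulʳ (epiʳ α-isoʳ (begin
    (λ′ ⊗₁ id) ∘ α  ≈⟨ λ-α ⟩
    λ′              ≈⟨ λ-unit ⟩
    id ⊗₁ λ′        ≈⟨ triangle ⟨
    (ρ ⊗₁ id) ∘ α   ∎))

  -- The mirror image of `λ-α`, from the pentagon at `a`, `b`, `unit`, `unit`.
  ρ-α : ρ ∘ α {a} {b} ≈ id ⊗₁ ρ
  ρ-α = ⊗-faithfulʳ (epiʳ α-isoʳ (begin
    ((ρ ∘ α) ⊗₁ id) ∘ α                      ≈⟨ pushˡ (Eq.sym merge₁) ⟩
    (ρ ⊗₁ id) ∘ ((α ⊗₁ id) ∘ α)              ≈⟨ ∘ʳ $ epiʳ (⊗-iso identityˡ α-isoʳ) (begin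
        ((α ⊗₁ id) ∘ α) ∘ (id ⊗₁ α)          ≈⟨ assoc ⟩
        (α ⊗₁ id) ∘ (α ∘ (id ⊗₁ α))          ≈⟨ pentagon ⟨
        α ∘ α                                ≈⟨ cancelʳ (⊗-iso identityˡ α-isoˡ) ⟨
        ((α ∘ α) ∘ (id ⊗₁ α⁻¹)) ∘ (id ⊗₁ α)  ∎) ⟩
    (ρ ⊗₁ id) ∘ ((α ∘ α) ∘ (id ⊗₁ α⁻¹))      ≈⟨ ∘ʳ assoc ⟩
    (ρ ⊗₁ id) ∘ (α ∘ (α ∘ (id ⊗₁ α⁻¹)))      ≈⟨ pullˡ triangle ⟩
    (id ⊗₁ λ′) ∘ (α ∘ (id ⊗₁ α⁻¹))
      ≈⟨ extendʳ (Eq.trans (∘ˡ (⊗ˡ (Eq.sym ⊗-id))) (Eq.sym α-natural)) ⟩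
    α ∘ ((id ⊗₁ (id ⊗₁ λ′)) ∘ (id ⊗₁ α⁻¹))   ≈⟨ ∘ʳ merge₂ ⟩
    α ∘ (id ⊗₁ ((id ⊗₁ λ′) ∘ α⁻¹))
      ≈⟨ ∘ʳ $ ⊗ʳ $ epiʳ α-isoʳ (Eq.trans (cancelʳ α-isoˡ) (Eq.sym triangle)) ⟩
    α ∘ (id ⊗₁ (ρ ⊗₁ id))                    ≈⟨ α-natural ⟩
    ((id ⊗₁ ρ) ⊗₁ id) ∘ α                    ∎))

  -- Mac Lane's coherence theorem: both sides of an equation between
  -- structural maps normalise, acting on the left of a fixed object.
  open HeterogeneousProperties C

  infixr 10 _⊠_
  data Expr : Set o where
    ⌞_⌟ : Ob → Expr
    𝟙   : Expr
    _⊠_ : Expr → Expr → Expr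

  infixr 9 _∘ˢ_
  infixr 10 _⊠ˢ_
  data Structural : Expr → Expr → Set o where
    idˢ  : ∀ {A} → Structural A A
    _∘ˢ_ : ∀ {A B C} → Structural B C → Structural A B → Structural A C
    _⊠ˢ_ : ∀ {A B A′ B′} → Structural A B → Structural A′ B′ → Structural (A ⊠ A′) (B ⊠ B′)
    αˢ   : ∀ {A B C} → Structural (A ⊠ (B ⊠ C)) ((A ⊠ B) ⊠ C)
    α⁻ˢ  : ∀ {A B C} → Structural ((A ⊠ B) ⊠ C) (A ⊠ (B ⊠ C))
    λˢ   : ∀ {A} → Structural (𝟙 ⊠ A) A
    λ⁻ˢ  : ∀ {A} → Structural A (𝟙 ⊠ A)
    ρˢ   : ∀ {A} → Structural (A ⊠ 𝟙) A
    ρ⁻ˢ  : ∀ {A} → Structural A (A ⊠ 𝟙)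

  ⟦_⟧ : Expr → Ob
  ⟦ ⌞ a ⌟ ⟧ = a
  ⟦ 𝟙 ⟧     = unit
  ⟦ A ⊠ B ⟧ = ⟦ A ⟧ ⊗₀ ⟦ B ⟧

  ⟦_⟧₁ : ∀ {A B} → Structural A B → Hom ⟦ A ⟧ ⟦ B ⟧
  ⟦ idˢ ⟧₁    = id
  ⟦ s ∘ˢ t ⟧₁ = ⟦ s ⟧₁ ∘ ⟦ t ⟧₁
  ⟦ s ⊠ˢ t ⟧₁ = ⟦ s ⟧₁ ⊗₁ ⟦ t ⟧₁
  ⟦ αˢ ⟧₁     = α
  ⟦ α⁻ˢ ⟧₁    = α⁻¹
  ⟦ λˢ ⟧₁     = λ′
  ⟦ λ⁻ˢ ⟧₁    = λ⁻¹
  ⟦ ρˢ ⟧₁     = ρ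
  ⟦ ρ⁻ˢ ⟧₁    = ρ⁻¹

  -- Bracketings become functions on objects, composed instead of tensored, so that both sides of an
  -- associator or a unitor have the same normal form by computation.
  act : Expr → Ob → Ob
  act ⌞ a ⌟   n = a ⊗₀ n
  act 𝟙       n = n
  act (A ⊠ B) n = act A (act B n)

  normalise : ∀ A n → Hom (⟦ A ⟧ ⊗₀ n) (act A n)
  normalise ⌞ a ⌟   n = id
  normalise 𝟙       n = λ′
  normalise (A ⊠ B) n = normalise A (act B n) ∘ ((id ⊗₁ normalise B n) ∘ α⁻¹)

  normalise⁻¹ : ∀ A n → Hom (act A n) (⟦ A ⟧ ⊗₀ n)
  normalise⁻¹ ⌞ a ⌟   n = id
  normalise⁻¹ 𝟙       n = λ⁻¹
  normalise⁻¹ (A ⊠ B) n = α ∘ ((id ⊗₁ normalise⁻¹ B n) ∘ normalise⁻¹ A (act B n))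

  normalise-iso : ∀ A n → normalise⁻¹ A n ∘ normalise A n ≈ id
  normalise-iso ⌞ a ⌟   n = identityˡ
  normalise-iso 𝟙       n = λ-isoˡ
  normalise-iso (A ⊠ B) n = begin
    (α ∘ ((id ⊗₁ v) ∘ u)) ∘ (u′ ∘ ((id ⊗₁ v′) ∘ α⁻¹))
      ≈⟨ pullʳ (pullʳ (cancelˡ (normalise-iso A (act B n)))) ⟩
    α ∘ ((id ⊗₁ v) ∘ ((id ⊗₁ v′) ∘ α⁻¹))
      ≈⟨ ∘ʳ $ cancelˡ (⊗-iso identityˡ (normalise-iso B n)) ⟩
    α ∘ α⁻¹                                             ≈⟨ α-isoʳ ⟩
    id                                                  ∎
    where
    u = normalise⁻¹ A (act B n)
    v = normalise⁻¹ B n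
    u′ = normalise A (act B n)
    v′ = normalise B n

  normalise-cong : ∀ A {m n} → m ≡ n → normalise A m ≋ normalise A n
  normalise-cong A refl = ≋-refl

  ≋-cod : ∀ {f : Hom a b} {g : Hom c d} → f ≋ g → b ≡ d
  ≋-cod (≈⇒≋ _) = refl

  -- For a variable `t` the codomains `act B n` and `act A n` are equal only by the induction
  -- itself, hence `_≋_`. In the case of `_⊠ˢ_` the equality hidden in the inner recursive call,
  -- extracted by `≋-cod`, realigns the outer one. Inverses are reduced to the maps they invert.
  normalise-natural : ∀ {A B} (t : Structural A B) n →
                      normalise B n ∘ (⟦ t ⟧₁ ⊗₁ id) ≋ normalise A n
  normalise-natural idˢ n = ≈⇒≋ (elimʳ ⊗-id)
  normalise-natural (_∘ˢ_ {A} {B} {C} s t) n =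
    ≋-trans (≈⇒≋ (Eq.trans (∘ʳ $ Eq.sym merge₁) (Eq.sym assoc)))
    (≋-trans (∘-resp-≋ (normalise-natural s n) ≋-refl) (normalise-natural t n))
  normalise-natural (_⊠ˢ_ {A} {B} {A′} {B′} s t) n =
    ≋-trans (≈⇒≋ (begin
      (u ∘ ((id ⊗₁ v) ∘ α⁻¹)) ∘ ((⟦ s ⟧₁ ⊗₁ ⟦ t ⟧₁) ⊗₁ id)    ≈⟨ pullʳ (pullʳ α⁻¹-natural) ⟩
      u ∘ ((id ⊗₁ v) ∘ ((⟦ s ⟧₁ ⊗₁ (⟦ t ⟧₁ ⊗₁ id)) ∘ α⁻¹))
        ≈⟨ ∘ʳ $ pullˡ (Eq.trans merge (Eq.trans (⊗ˡ identityˡ) ⊗-serialize₁₂)) ⟩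
      u ∘ (((⟦ s ⟧₁ ⊗₁ id) ∘ (id ⊗₁ (v ∘ (⟦ t ⟧₁ ⊗₁ id)))) ∘ α⁻¹)  ≈⟨ ∘ʳ assoc ⟩
      u ∘ ((⟦ s ⟧₁ ⊗₁ id) ∘ ((id ⊗₁ (v ∘ (⟦ t ⟧₁ ⊗₁ id))) ∘ α⁻¹))  ≈⟨ assoc ⟨
      (u ∘ (⟦ s ⟧₁ ⊗₁ id)) ∘ ((id ⊗₁ (v ∘ (⟦ t ⟧₁ ⊗₁ id))) ∘ α⁻¹)  ∎))
    (∘-resp-≋ (≋-trans (normalise-natural s (act B′ n)) (normalise-cong A (≋-cod rec)))
              (∘-resp-≋ (⊗-resp-≋ ≋-refl rec) ≋-refl))
    where
    u = normalise B (act B′ n)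
    v = normalise B′ n
    rec = normalise-natural t n
  normalise-natural (αˢ {A} {B} {C}) n = ≈⇒≋ (begin
    ((u ∘ ((id ⊗₁ v) ∘ α⁻¹)) ∘ ((id ⊗₁ w) ∘ α⁻¹)) ∘ (α ⊗₁ id)
      ≈⟨ pullʳ assoc ⟩
    (u ∘ ((id ⊗₁ v) ∘ α⁻¹)) ∘ ((id ⊗₁ w) ∘ (α⁻¹ ∘ (α ⊗₁ id)))
      ≈⟨ pullʳ (pullʳ (extendʳ (Eq.trans (∘ʳ $ (⊗ˡ (Eq.sym ⊗-id))) α⁻¹-natural))) ⟩
    u ∘ ((id ⊗₁ v) ∘ ((id ⊗₁ (id ⊗₁ w)) ∘ (α⁻¹ ∘ (α⁻¹ ∘ (α ⊗₁ id)))))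
      ≈⟨ ∘ʳ $ ∘ʳ $ ∘ʳ αα ⟩
    u ∘ ((id ⊗₁ v) ∘ ((id ⊗₁ (id ⊗₁ w)) ∘ ((id ⊗₁ α⁻¹) ∘ α⁻¹)))
      ≈⟨ ∘ʳ $ ∘ʳ $ pullˡ merge₂ ⟩
    u ∘ ((id ⊗₁ v) ∘ ((id ⊗₁ ((id ⊗₁ w) ∘ α⁻¹)) ∘ α⁻¹))
      ≈⟨ ∘ʳ $ pullˡ merge₂ ⟩
    u ∘ ((id ⊗₁ (v ∘ ((id ⊗₁ w) ∘ α⁻¹))) ∘ α⁻¹) ∎)
    where
    u = normalise A (act B (act C n))
    v = normalise B (act C n)
    w = normalise C n
    αα : ∀ {a b c d} → α⁻¹ ∘ (α⁻¹ ∘ (α ⊗₁ id)) ≈ (id ⊗₁ α⁻¹) ∘ α⁻¹ {a} {b ⊗₀ c} {d}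
    αα = epiʳ α-isoʳ (epiʳ (⊗-iso identityˡ α-isoʳ) (begin
      ((α⁻¹ ∘ (α⁻¹ ∘ (α ⊗₁ id))) ∘ α) ∘ (id ⊗₁ α)
        ≈⟨ Eq.trans (pullʳ Eq.refl) (pullʳ (pullʳ Eq.refl)) ⟩
      α⁻¹ ∘ (α⁻¹ ∘ ((α ⊗₁ id) ∘ (α ∘ (id ⊗₁ α))))   ≈⟨ ∘ʳ $ ∘ʳ pentagon ⟨
      α⁻¹ ∘ (α⁻¹ ∘ (α ∘ α))                         ≈⟨ ∘ʳ $ cancelˡ α-isoˡ ⟩
      α⁻¹ ∘ α                                       ≈⟨ α-isoˡ ⟩
      id                                            ≈⟨ ⊗-iso identityˡ α-isoˡ ⟨
      (id ⊗₁ α⁻¹) ∘ (id ⊗₁ α)                       ≈⟨ ∘ˡ (cancelʳ α-isoˡ) ⟨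
      (((id ⊗₁ α⁻¹) ∘ α⁻¹) ∘ α) ∘ (id ⊗₁ α)         ∎))
  normalise-natural (α⁻ˢ {A} {B} {C}) n = ≈⇒≋ (epiʳ {h = α⁻¹ ⊗₁ id} (⊗-iso α-isoʳ identityˡ)
    (Eq.trans (cancelʳ (⊗-iso α-isoˡ identityˡ))
              (Eq.sym (≋⇒≈ (normalise-natural (αˢ {A} {B} {C}) n)))))
  normalise-natural (λˢ {A}) n = ≈⇒≋ (begin
    u ∘ (λ′ ⊗₁ id)               ≈⟨ ∘ʳ $ Eq.trans (Eq.sym (cancelʳ α-isoʳ)) (∘ˡ λ-α) ⟩
    u ∘ (λ′ ∘ α⁻¹)               ≈⟨ extendʳ (Eq.sym λ-natural) ⟩
    λ′ ∘ ((id ⊗₁ u) ∘ α⁻¹)       ∎)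
    where u = normalise A n
  normalise-natural (λ⁻ˢ {A}) n = ≈⇒≋ (epiʳ {h = λ⁻¹ ⊗₁ id} (⊗-iso λ-isoʳ identityˡ)
    (Eq.trans (cancelʳ (⊗-iso λ-isoˡ identityˡ))
              (Eq.sym (≋⇒≈ (normalise-natural (λˢ {A}) n)))))
  normalise-natural (ρˢ {A}) n = ≈⇒≋ (∘ʳ $ epiʳ α-isoʳ
    (Eq.trans triangle (Eq.sym (cancelʳ α-isoˡ))))
  normalise-natural (ρ⁻ˢ {A}) n = ≈⇒≋ (epiʳ {h = ρ⁻¹ ⊗₁ id} (⊗-iso ρ-isoʳ identityˡ)
    (Eq.trans (cancelʳ (⊗-iso ρ-isoˡ identityˡ))
              (Eq.sym (≋⇒≈ (normalise-natural (ρˢ {A}) n)))))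

  -- Tensored with `unit` and followed by the invertible `normalise B unit`, both maps become
  -- `normalise A unit`. Symmetries are excluded from `Structural`: with them the statement would
  -- fail, as σ on `a ⊗₀ a` need not be the identity.
  coherence : ∀ {A B} (s t : Structural A B) → ⟦ s ⟧₁ ≈ ⟦ t ⟧₁
  coherence {A} {B} s t = ⊗-faithfulʳ (monoˡ (normalise-iso B unit)
    (≋⇒≈ (≋-trans (normalise-natural s unit) (≋-sym (normalise-natural t unit)))))

-- Symmetries, transposition, and identities between bodies of morphisms with a context.

module SymmetricProperties {o ℓ r} (C : SMC o ℓ r) where
  open SMC C
  open SMCProperties C

  private variable
    a b c d e a′ b′ c′ d′ u v w : Ob
    f f′ g g′ h h′ k l x q φ ψ : Hom a b

  -- From the hexagon whose middle object is the unit.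
  σ-unitˡ : σ {unit} {c} ≈ ρ⁻¹ ∘ λ′
  σ-unitˡ {c} = ⊗-faithfulˡ (monoˡ α-isoˡ (monoˡ (⊗-iso σ-iso identityˡ) (begin
    (σ ⊗₁ id) ∘ (α ∘ (id ⊗₁ σ))            ≈⟨ hexagon ⟨
    α ∘ (σ ∘ α)                            ≈⟨ ∘ʳ (∘ˡ σ-ρ) ⟩
    α ∘ (((id ⊗₁ ρ⁻¹) ∘ (σ ∘ (ρ ⊗₁ id))) ∘ α)
                                           ≈⟨ ∘ʳ (Eq.trans assoc (∘ʳ assoc)) ⟩
    α ∘ ((id ⊗₁ ρ⁻¹) ∘ (σ ∘ ((ρ ⊗₁ id) ∘ α)))
                                           ≈⟨ pullˡ (coherence {⌞ c ⌟ ⊠ 𝟙} (αˢ ∘ˢ (idˢ ⊠ˢ ρ⁻ˢ)) ρ⁻ˢ) ⟩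
    ρ⁻¹ ∘ (σ ∘ ((ρ ⊗₁ id) ∘ α))            ≈⟨ extendʳ ρ⁻¹-natural ⟩
    (σ ⊗₁ id) ∘ (ρ⁻¹ ∘ ((ρ ⊗₁ id) ∘ α))
      ≈⟨ ∘ʳ (coherence {𝟙 ⊠ (𝟙 ⊠ ⌞ c ⌟)} (ρ⁻ˢ ∘ˢ ((ρˢ ⊠ˢ idˢ) ∘ˢ αˢ)) (αˢ ∘ˢ (idˢ ⊠ˢ (ρ⁻ˢ ∘ˢ λˢ)))) ⟩
    (σ ⊗₁ id) ∘ (α ∘ (id ⊗₁ (ρ⁻¹ ∘ λ′)))   ∎)))
    where
    σ-ρ : σ {unit ⊗₀ unit} {c} ≈ (id ⊗₁ ρ⁻¹) ∘ (σ ∘ (ρ ⊗₁ id))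
    σ-ρ = Eq.sym (Eq.trans (∘ʳ σ-natural) (cancelˡ (⊗-iso identityˡ ρ-isoˡ)))

  σ-unitʳ : σ {c} {unit} ≈ λ⁻¹ ∘ ρ
  σ-unitʳ = monoˡ σ-iso (Eq.trans σ-iso (Eq.sym (begin
    σ ∘ (λ⁻¹ ∘ ρ)            ≈⟨ ∘ˡ σ-unitˡ ⟩
    (ρ⁻¹ ∘ λ′) ∘ (λ⁻¹ ∘ ρ)   ≈⟨ pullʳ (cancelˡ λ-isoʳ) ⟩
    ρ⁻¹ ∘ ρ                  ≈⟨ ρ-isoˡ ⟩
    id                       ∎)))

  σ-unit : σ {unit} {unit} ≈ id
  σ-unit = Eq.trans σ-unitˡ (Eq.trans (∘ʳ λ≈ρ) ρ-isoˡ)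

  swap : Hom (a ⊗₀ (b ⊗₀ c)) (b ⊗₀ (a ⊗₀ c))
  swap = α⁻¹ ∘ ((σ ⊗₁ id) ∘ α)

  swap-natural : swap ∘ (f ⊗₁ (g ⊗₁ h)) ≈ (g ⊗₁ (f ⊗₁ h)) ∘ swap
  swap-natural {f = f} {g = g} {h = h} = begin
    (α⁻¹ ∘ ((σ ⊗₁ id) ∘ α)) ∘ (f ⊗₁ (g ⊗₁ h))    ≈⟨ pullʳ (pullʳ α-natural) ⟩
    α⁻¹ ∘ ((σ ⊗₁ id) ∘ (((f ⊗₁ g) ⊗₁ h) ∘ α))
      ≈⟨ ∘ʳ (extendʳ (Eq.trans merge (Eq.trans (⊗-resp-≈ σ-natural id-comm) ⊗-∘))) ⟩
    α⁻¹ ∘ (((g ⊗₁ f) ⊗₁ h) ∘ ((σ ⊗₁ id) ∘ α))    ≈⟨ extendʳ α⁻¹-natural ⟩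
    (g ⊗₁ (f ⊗₁ h)) ∘ (α⁻¹ ∘ ((σ ⊗₁ id) ∘ α))    ∎

  swap-unit : swap {unit} {b} {c} ≈ α⁻¹ ∘ (((ρ⁻¹ ∘ λ′) ⊗₁ id) ∘ α)
  swap-unit = ∘ʳ (∘ˡ (⊗ˡ σ-unitˡ))

  -- In `freeSMC X` this unfolds to `interchange`, the map in the definition of `_⊗ₘ_`. Evaluation
  -- needs it in an arbitrary SMC category.
  exchange : Hom ((a ⊗₀ b) ⊗₀ (c ⊗₀ d)) ((a ⊗₀ c) ⊗₀ (b ⊗₀ d))
  exchange = α ∘ ((id ⊗₁ swap) ∘ α⁻¹)

  exchange-natural : exchange ∘ ((f ⊗₁ f′) ⊗₁ (g ⊗₁ g′)) ≈ ((f ⊗₁ g) ⊗₁ (f′ ⊗₁ g′)) ∘ exchange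
  exchange-natural {f = f} {f′ = f′} {g = g} {g′ = g′} = begin
    (α ∘ ((id ⊗₁ swap) ∘ α⁻¹)) ∘ ((f ⊗₁ f′) ⊗₁ (g ⊗₁ g′))    ≈⟨ pullʳ (pullʳ α⁻¹-natural) ⟩
    α ∘ ((id ⊗₁ swap) ∘ ((f ⊗₁ (f′ ⊗₁ (g ⊗₁ g′))) ∘ α⁻¹))
      ≈⟨ ∘ʳ (extendʳ (Eq.trans merge (Eq.trans (⊗-resp-≈ id-comm swap-natural) ⊗-∘))) ⟩
    α ∘ ((f ⊗₁ (g ⊗₁ (f′ ⊗₁ g′))) ∘ ((id ⊗₁ swap) ∘ α⁻¹))    ≈⟨ extendʳ α-natural ⟩
    ((f ⊗₁ g) ⊗₁ (f′ ⊗₁ g′)) ∘ (α ∘ ((id ⊗₁ swap) ∘ α⁻¹))    ∎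

  -- The left side is the body of `inc g ∘ₘ (Γ , f)`, where `ty-++ [] Γ` is `λ⁻¹`. The other
  -- identities named `-body` arise in the same way from operations on morphisms with a context.
  post-body : {f : Hom (a ⊗₀ b) c} {g : Hom c d} →
              (g ∘ λ′) ∘ ((id ⊗₁ f) ∘ (α⁻¹ ∘ (λ⁻¹ {a} ⊗₁ id {b}))) ≈ g ∘ f
  post-body {a = a} {b = b} {f = f} {g = g} = begin
    (g ∘ λ′) ∘ ((id ⊗₁ f) ∘ (α⁻¹ ∘ (λ⁻¹ ⊗₁ id)))   ≈⟨ pullʳ (extendʳ λ-natural) ⟩
    g ∘ (f ∘ (λ′ ∘ (α⁻¹ ∘ (λ⁻¹ ⊗₁ id))))
      ≈⟨ ∘ʳ (elimʳ (coherence {⌞ a ⌟ ⊠ ⌞ b ⌟} (λˢ ∘ˢ (α⁻ˢ ∘ˢ (λ⁻ˢ ⊠ˢ idˢ))) idˢ)) ⟩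
    g ∘ f  ∎

  pre-body : {f : Hom (a ⊗₀ c) d} {g : Hom b c} →
             f ∘ ((id ⊗₁ (g ∘ λ′)) ∘ (α⁻¹ ∘ (ρ⁻¹ {a} ⊗₁ id {b}))) ≈ f ∘ (id ⊗₁ g)
  pre-body {a = a} {b = b} {f = f} {g = g} = ∘ʳ (begin
    (id ⊗₁ (g ∘ λ′)) ∘ (α⁻¹ ∘ (ρ⁻¹ ⊗₁ id))           ≈⟨ pushˡ (Eq.sym merge₂) ⟩
    (id ⊗₁ g) ∘ ((id ⊗₁ λ′) ∘ (α⁻¹ ∘ (ρ⁻¹ ⊗₁ id)))
      ≈⟨ elimʳ (coherence {⌞ a ⌟ ⊠ ⌞ b ⌟} ((idˢ ⊠ˢ λˢ) ∘ˢ (α⁻ˢ ∘ˢ (ρ⁻ˢ ⊠ˢ idˢ))) idˢ) ⟩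
    id ⊗₁ g ∎)

  -- Comes from `(Γ , φ) ⊗ₘ idₘ` once `ty-++ Γ []` has become `ρ⁻¹`. The symmetry inside `exchange`
  -- then moves only the unit, the type of the empty context, so that `swap-unit` leaves a
  -- structural map.
  whisk-body : {φ : Hom (a ⊗₀ u) v} →
               (φ ⊗₁ λ′ {w}) ∘ (exchange ∘ (ρ⁻¹ ⊗₁ id)) ≈ (φ ⊗₁ id) ∘ α
  whisk-body {a = a} {u = u} {w = w} {φ = φ} = begin
    (φ ⊗₁ λ′) ∘ (exchange ∘ (ρ⁻¹ ⊗₁ id))                ≈⟨ pushˡ ⊗-serialize₁₂ ⟩
    (φ ⊗₁ id) ∘ ((id ⊗₁ λ′) ∘ (exchange ∘ (ρ⁻¹ ⊗₁ id)))
      ≈⟨ ∘ʳ (∘ʳ (∘ˡ (∘ʳ (∘ˡ (⊗ʳ swap-unit))))) ⟩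
    _ ≈⟨ ∘ʳ (coherence {⌞ a ⌟ ⊠ (⌞ u ⌟ ⊠ ⌞ w ⌟)}
           ((idˢ ⊠ˢ λˢ) ∘ˢ ((αˢ ∘ˢ ((idˢ ⊠ˢ (α⁻ˢ ∘ˢ (((ρ⁻ˢ ∘ˢ λˢ) ⊠ˢ idˢ) ∘ˢ αˢ))) ∘ˢ α⁻ˢ))
             ∘ˢ (ρ⁻ˢ ⊠ˢ idˢ))) αˢ) ⟩
    (φ ⊗₁ id) ∘ α ∎

  whisk′-body : {φ : Hom (a ⊗₀ u) v} →
                (λ′ {w} ⊗₁ φ) ∘ (exchange ∘ (λ⁻¹ ⊗₁ id)) ≈ (id ⊗₁ φ) ∘ swap
  whisk′-body {a = a} {u = u} {w = w} {φ = φ} = begin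
    (λ′ ⊗₁ φ) ∘ (exchange ∘ (λ⁻¹ ⊗₁ id))                    ≈⟨ pushˡ ⊗-serialize₂₁ ⟩
    (id ⊗₁ φ) ∘ ((λ′ ⊗₁ id) ∘ (exchange ∘ (λ⁻¹ ⊗₁ id)))     ≈⟨ ∘ʳ (∘ʳ (pullʳ assoc)) ⟩
    (id ⊗₁ φ) ∘ ((λ′ ⊗₁ id) ∘ (α ∘ ((id ⊗₁ swap) ∘ (α⁻¹ ∘ (λ⁻¹ ⊗₁ id)))))
                                                            ≈⟨ ∘ʳ (pullˡ λ-α) ⟩
    (id ⊗₁ φ) ∘ (λ′ ∘ ((id ⊗₁ swap) ∘ (α⁻¹ ∘ (λ⁻¹ ⊗₁ id)))) ≈⟨ ∘ʳ (extendʳ λ-natural) ⟩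
    (id ⊗₁ φ) ∘ (swap ∘ (λ′ ∘ (α⁻¹ ∘ (λ⁻¹ ⊗₁ id))))
      ≈⟨ ∘ʳ (elimʳ (coherence {⌞ a ⌟ ⊠ (⌞ w ⌟ ⊠ ⌞ u ⌟)} (λˢ ∘ˢ (α⁻ˢ ∘ˢ (λ⁻ˢ ⊠ˢ idˢ))) idˢ)) ⟩
    (id ⊗₁ φ) ∘ swap  ∎

  -- To be used with `x` equal to `ty-++ Γ Δ ⊗₁ id`. Both sides concatenate the contexts in the same
  -- order, so no relabelling is involved.
  split-body : {φ : Hom (a ⊗₀ u) v} {ψ : Hom (b ⊗₀ c) d} {x : Hom e ((a ⊗₀ b) ⊗₀ (u ⊗₀ c))} →
               (φ ⊗₁ ψ) ∘ (exchange ∘ x) ≈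
               ((φ ⊗₁ id) ∘ α) ∘ ((id ⊗₁ ((id ⊗₁ ψ) ∘ swap)) ∘ (α⁻¹ ∘ x))
  split-body {φ = φ} {ψ = ψ} {x = x} = begin
    (φ ⊗₁ ψ) ∘ (exchange ∘ x)                                         ≈⟨ pushˡ ⊗-serialize₁₂ ⟩
    (φ ⊗₁ id) ∘ ((id ⊗₁ ψ) ∘ (exchange ∘ x))                          ≈⟨ ∘ʳ (∘ʳ (pullʳ assoc)) ⟩
    (φ ⊗₁ id) ∘ ((id ⊗₁ ψ) ∘ (α ∘ ((id ⊗₁ swap) ∘ (α⁻¹ ∘ x))))
      ≈⟨ ∘ʳ (extendʳ (Eq.trans (∘ˡ (⊗ˡ (Eq.sym ⊗-id))) (Eq.sym α-natural))) ⟩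
    (φ ⊗₁ id) ∘ (α ∘ ((id ⊗₁ (id ⊗₁ ψ)) ∘ ((id ⊗₁ swap) ∘ (α⁻¹ ∘ x))))  ≈⟨ ∘ʳ (∘ʳ (pullˡ merge₂)) ⟩
    (φ ⊗₁ id) ∘ (α ∘ ((id ⊗₁ ((id ⊗₁ ψ) ∘ swap)) ∘ (α⁻¹ ∘ x)))          ≈⟨ assoc ⟨
    ((φ ⊗₁ id) ∘ α) ∘ ((id ⊗₁ ((id ⊗₁ ψ) ∘ swap)) ∘ (α⁻¹ ∘ x))          ∎

  whisk-∘-body : {φ : Hom (a ⊗₀ u) v} {ψ : Hom (b ⊗₀ v) w} {q : Hom c (b ⊗₀ a)} →
    ((ψ ∘ ((id ⊗₁ φ) ∘ (α⁻¹ ∘ (q ⊗₁ id)))) ⊗₁ id {d}) ∘ α ≈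
    ((ψ ⊗₁ id) ∘ α) ∘ ((id ⊗₁ ((φ ⊗₁ id) ∘ α)) ∘ (α⁻¹ ∘ (q ⊗₁ id)))
  whisk-∘-body {a = a} {u = u} {b = b} {d = d} {φ = φ} {ψ = ψ} {q = q} = begin
    ((ψ ∘ ((id ⊗₁ φ) ∘ (α⁻¹ ∘ (q ⊗₁ id)))) ⊗₁ id) ∘ α
      ≈⟨ pushˡ (Eq.sym merge₁) ⟩
    (ψ ⊗₁ id) ∘ ((((id ⊗₁ φ) ∘ (α⁻¹ ∘ (q ⊗₁ id))) ⊗₁ id) ∘ α)
      ≈⟨ ∘ʳ (pushˡ (Eq.sym merge₁)) ⟩
    (ψ ⊗₁ id) ∘ (((id ⊗₁ φ) ⊗₁ id) ∘ (((α⁻¹ ∘ (q ⊗₁ id)) ⊗₁ id) ∘ α))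
      ≈⟨ ∘ʳ (∘ʳ (pushˡ (Eq.sym merge₁))) ⟩
    (ψ ⊗₁ id) ∘ (((id ⊗₁ φ) ⊗₁ id) ∘ ((α⁻¹ ⊗₁ id) ∘ (((q ⊗₁ id) ⊗₁ id) ∘ α)))
      ≈⟨ ∘ʳ (∘ʳ (∘ʳ (Eq.trans (Eq.sym α-natural) (∘ʳ (⊗ʳ ⊗-id))))) ⟩
    (ψ ⊗₁ id) ∘ (((id ⊗₁ φ) ⊗₁ id) ∘ ((α⁻¹ ⊗₁ id) ∘ (α ∘ (q ⊗₁ id))))
      ≈⟨ ∘ʳ (∘ʳ (pullˡ (coherence {(⌞ b ⌟ ⊠ ⌞ a ⌟) ⊠ (⌞ u ⌟ ⊠ ⌞ d ⌟)}
                          ((α⁻ˢ ⊠ˢ idˢ) ∘ˢ αˢ) (αˢ ∘ˢ ((idˢ ⊠ˢ αˢ) ∘ˢ α⁻ˢ))))) ⟩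
    (ψ ⊗₁ id) ∘ (((id ⊗₁ φ) ⊗₁ id) ∘ ((α ∘ ((id ⊗₁ α) ∘ α⁻¹)) ∘ (q ⊗₁ id)))
      ≈⟨ ∘ʳ (∘ʳ (Eq.trans assoc (∘ʳ assoc))) ⟩
    (ψ ⊗₁ id) ∘ (((id ⊗₁ φ) ⊗₁ id) ∘ (α ∘ ((id ⊗₁ α) ∘ (α⁻¹ ∘ (q ⊗₁ id)))))
      ≈⟨ ∘ʳ (extendʳ (Eq.sym α-natural)) ⟩
    (ψ ⊗₁ id) ∘ (α ∘ ((id ⊗₁ (φ ⊗₁ id)) ∘ ((id ⊗₁ α) ∘ (α⁻¹ ∘ (q ⊗₁ id)))))
      ≈⟨ ∘ʳ (∘ʳ (pullˡ merge₂)) ⟩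
    (ψ ⊗₁ id) ∘ (α ∘ ((id ⊗₁ ((φ ⊗₁ id) ∘ α)) ∘ (α⁻¹ ∘ (q ⊗₁ id))))
      ≈⟨ assoc ⟨
    ((ψ ⊗₁ id) ∘ α) ∘ ((id ⊗₁ ((φ ⊗₁ id) ∘ α)) ∘ (α⁻¹ ∘ (q ⊗₁ id))) ∎

  σ-body : {φ : Hom (a ⊗₀ u) v} →
           σ ∘ ((φ ⊗₁ id {w}) ∘ α) ≈ ((id ⊗₁ φ) ∘ swap) ∘ (id ⊗₁ σ)
  σ-body {φ = φ} = begin
    σ ∘ ((φ ⊗₁ id) ∘ α)                                      ≈⟨ extendʳ σ-natural ⟩
    (id ⊗₁ φ) ∘ (σ ∘ α)                                      ≈⟨ ∘ʳ (cancelˡ α-isoˡ) ⟨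
    (id ⊗₁ φ) ∘ (α⁻¹ ∘ (α ∘ (σ ∘ α)))                        ≈⟨ ∘ʳ (∘ʳ hexagon) ⟩
    (id ⊗₁ φ) ∘ (α⁻¹ ∘ ((σ ⊗₁ id) ∘ (α ∘ (id ⊗₁ σ))))        ≈⟨ ∘ʳ (∘ʳ assoc) ⟨
    (id ⊗₁ φ) ∘ (α⁻¹ ∘ (((σ ⊗₁ id) ∘ α) ∘ (id ⊗₁ σ)))        ≈⟨ ∘ʳ assoc ⟨
    (id ⊗₁ φ) ∘ (swap ∘ (id ⊗₁ σ))                           ≈⟨ assoc ⟨
    ((id ⊗₁ φ) ∘ swap) ∘ (id ⊗₁ σ)                           ∎

  α-body : {φ : Hom (a ⊗₀ u) v} →
           α ∘ ((φ ⊗₁ id {b ⊗₀ c}) ∘ α) ≈ ((((φ ⊗₁ id) ∘ α) ⊗₁ id) ∘ α) ∘ (id ⊗₁ α)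
  α-body {φ = φ} = begin
    α ∘ ((φ ⊗₁ id) ∘ α)
      ≈⟨ extendʳ (Eq.trans (∘ʳ (⊗ʳ (Eq.sym ⊗-id))) α-natural) ⟩
    ((φ ⊗₁ id) ⊗₁ id) ∘ (α ∘ α)                     ≈⟨ ∘ʳ pentagon ⟩
    ((φ ⊗₁ id) ⊗₁ id) ∘ ((α ⊗₁ id) ∘ (α ∘ (id ⊗₁ α)))  ≈⟨ pullˡ merge₁ ⟩
    (((φ ⊗₁ id) ∘ α) ⊗₁ id) ∘ (α ∘ (id ⊗₁ α))       ≈⟨ assoc ⟨
    ((((φ ⊗₁ id) ∘ α) ⊗₁ id) ∘ α) ∘ (id ⊗₁ α)       ∎

  ρ-body : {φ : Hom (a ⊗₀ u) v} → ρ ∘ ((φ ⊗₁ id) ∘ α) ≈ φ ∘ (id ⊗₁ ρ)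
  ρ-body = Eq.trans (extendʳ ρ-natural) (∘ʳ ρ-α)

  whisk-λ : ((f ∘ λ′) ⊗₁ id {d}) ∘ α ≈ (f ⊗₁ id) ∘ λ′
  whisk-λ = Eq.trans (pushˡ (Eq.sym merge₁)) (∘ʳ λ-α)

  whisk′-λ : {f : Hom a b} → (id {d} ⊗₁ (f ∘ λ′ {a})) ∘ swap ≈ (id ⊗₁ f) ∘ λ′
  whisk′-λ {a = a} {d = d} {f = f} = begin
    (id ⊗₁ (f ∘ λ′)) ∘ swap            ≈⟨ pushˡ (Eq.sym merge₂) ⟩
    (id ⊗₁ f) ∘ ((id ⊗₁ λ′) ∘ swap)    ≈⟨ ∘ʳ (∘ʳ swap-unit) ⟩
    (id ⊗₁ f) ∘ ((id ⊗₁ λ′) ∘ (α⁻¹ ∘ (((ρ⁻¹ ∘ λ′) ⊗₁ id) ∘ α)))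
      ≈⟨ ∘ʳ (coherence {𝟙 ⊠ (⌞ d ⌟ ⊠ ⌞ a ⌟)} ((idˢ ⊠ˢ λˢ) ∘ˢ (α⁻ˢ ∘ˢ (((ρ⁻ˢ ∘ˢ λˢ) ⊠ˢ idˢ) ∘ˢ αˢ))) λˢ) ⟩
    (id ⊗₁ f) ∘ λ′ ∎

  curry : Hom (a ⊗₀ (u ⊗₀ v)) w → Hom (a ⊗₀ u) (v ⊸₀ w)
  curry φ = (id ⊸₁ (φ ∘ α⁻¹)) ∘ η

  curry-resp : φ ≈ ψ → curry φ ≈ curry ψ
  curry-resp p = ∘ˡ (⊸-resp-≈ Eq.refl (∘ˡ p))

  ⊸-merge : (id {a} ⊸₁ g) ∘ (id ⊸₁ f) ≈ id ⊸₁ (g ∘ f)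
  ⊸-merge = Eq.trans (Eq.sym ⊸-∘) (⊸-resp-≈ identityˡ Eq.refl)

  ε-curry : ε ∘ (((id ⊸₁ f) ∘ η) ⊗₁ id) ≈ f
  ε-curry {f = f} = begin
    ε ∘ (((id ⊸₁ f) ∘ η) ⊗₁ id)           ≈⟨ ∘ʳ merge₁ ⟨
    ε ∘ (((id ⊸₁ f) ⊗₁ id) ∘ (η ⊗₁ id))   ≈⟨ extendʳ ε-natural ⟩
    f ∘ (ε ∘ (η ⊗₁ id))                   ≈⟨ elimʳ zig ⟩
    f                                     ∎

  curry-ε : (id ⊸₁ (ε ∘ (h ⊗₁ id))) ∘ η ≈ h
  curry-ε {h = h} = begin
    (id ⊸₁ (ε ∘ (h ⊗₁ id))) ∘ η           ≈⟨ pushˡ (Eq.sym ⊸-merge) ⟩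
    (id ⊸₁ ε) ∘ ((id ⊸₁ (h ⊗₁ id)) ∘ η)   ≈⟨ ∘ʳ η-natural ⟨
    (id ⊸₁ ε) ∘ (η ∘ h)                   ≈⟨ cancelˡ zag ⟩
    h                                     ∎

  curry-β : ε ∘ ((curry φ ⊗₁ id) ∘ α) ≈ φ
  curry-β = Eq.trans (pullˡ ε-curry) (cancelʳ α-isoˡ)

  curry-η : {h : Hom (a ⊗₀ b) (c ⊸₀ d)} → curry (ε ∘ ((h ⊗₁ id) ∘ α)) ≈ h
  curry-η = Eq.trans
    (∘ˡ (⊸-resp-≈ Eq.refl (Eq.trans assoc (∘ʳ (cancelʳ α-isoʳ))))) curry-ε

  curry-natural : {φ : Hom (a ⊗₀ (u ⊗₀ v)) w} {f : Hom b a} {g : Hom c u} →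
                      curry φ ∘ (f ⊗₁ g) ≈ curry (φ ∘ (f ⊗₁ (g ⊗₁ id)))
  curry-natural {φ = φ} {f = f} {g = g} = begin
    ((id ⊸₁ (φ ∘ α⁻¹)) ∘ η) ∘ (f ⊗₁ g)                      ≈⟨ pullʳ η-natural ⟩
    (id ⊸₁ (φ ∘ α⁻¹)) ∘ ((id ⊸₁ ((f ⊗₁ g) ⊗₁ id)) ∘ η)      ≈⟨ pullˡ ⊸-merge ⟩
    (id ⊸₁ ((φ ∘ α⁻¹) ∘ ((f ⊗₁ g) ⊗₁ id))) ∘ η
      ≈⟨ ∘ˡ (⊸-resp-≈ Eq.refl (Eq.trans (pullʳ α⁻¹-natural) (Eq.sym assoc))) ⟩
    (id ⊸₁ ((φ ∘ (f ⊗₁ (g ⊗₁ id))) ∘ α⁻¹)) ∘ η              ∎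

  -- For the tensor of two names: both domains are units, so the symmetry in `exchange` is
  -- `σ {b} {unit}`, which `σ-unitʳ` makes structural.
  exchange-unit : (ρ {a} ⊗₁ ρ {b}) ∘ exchange ≈ ρ ∘ (id ⊗₁ λ′)
  exchange-unit {a} {b} = begin
    (ρ ⊗₁ ρ) ∘ (α ∘ ((id ⊗₁ (α⁻¹ ∘ ((σ ⊗₁ id) ∘ α))) ∘ α⁻¹))
      ≈⟨ ∘ʳ (∘ʳ (∘ˡ (⊗ʳ (∘ʳ (∘ˡ (⊗ˡ σ-unitʳ)))))) ⟩
    (ρ ⊗₁ ρ) ∘ (α ∘ ((id ⊗₁ (α⁻¹ ∘ (((λ⁻¹ ∘ ρ) ⊗₁ id) ∘ α))) ∘ α⁻¹))
      ≈⟨ coherence {(⌞ a ⌟ ⊠ ⌞ b ⌟) ⊠ (𝟙 ⊠ 𝟙)}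
           ((ρˢ ⊠ˢ ρˢ) ∘ˢ (αˢ ∘ˢ ((idˢ ⊠ˢ (α⁻ˢ ∘ˢ (((λ⁻ˢ ∘ˢ ρˢ) ⊠ˢ idˢ) ∘ˢ αˢ))) ∘ˢ α⁻ˢ)))
           (ρˢ ∘ˢ (idˢ ⊠ˢ λˢ)) ⟩
    ρ ∘ (id ⊗₁ λ′) ∎

  ε-⊸ : {f : Hom a b} {g : Hom c d} → ε ∘ ((f ⊸₁ g) ⊗₁ id) ≈ g ∘ (ε ∘ (id ⊗₁ f))
  ε-⊸ {f = f} {g = g} = begin
    ε ∘ ((f ⊸₁ g) ⊗₁ id)
      ≈⟨ ∘ʳ (⊗ˡ (Eq.trans (⊸-resp-≈ (Eq.sym identityʳ) (Eq.sym identityʳ)) ⊸-∘)) ⟩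
    ε ∘ (((id ⊸₁ g) ∘ (f ⊸₁ id)) ⊗₁ id)           ≈⟨ ∘ʳ merge₁ ⟨
    ε ∘ (((id ⊸₁ g) ⊗₁ id) ∘ ((f ⊸₁ id) ⊗₁ id))   ≈⟨ extendʳ ε-natural ⟩
    g ∘ (ε ∘ ((f ⊸₁ id) ⊗₁ id))                   ≈⟨ ∘ʳ ε-extra ⟩
    g ∘ (ε ∘ (id ⊗₁ f))                           ∎

  -- Here k, m and n are the points of the context types at which the bodies of
  -- morphisms are evaluated.

  eval-∘ : {φ : Hom (a ⊗₀ u) v} {ψ : Hom (b ⊗₀ v) w} {q : Hom c (b ⊗₀ a)}
           {m : Hom unit b} {n : Hom unit a} {k : Hom unit c} →
           q ∘ k ≈ (m ⊗₁ n) ∘ λ⁻¹ →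
           (ψ ∘ ((id ⊗₁ φ) ∘ (α⁻¹ ∘ (q ⊗₁ id)))) ∘ ((k ⊗₁ id) ∘ λ⁻¹) ≈
           (ψ ∘ ((m ⊗₁ id) ∘ λ⁻¹)) ∘ (φ ∘ ((n ⊗₁ id) ∘ λ⁻¹))
  eval-∘ {u = u} {φ = φ} {ψ = ψ} {q = q} {m = m} {n = n} {k = k} hyp = begin
    (ψ ∘ ((id ⊗₁ φ) ∘ (α⁻¹ ∘ (q ⊗₁ id)))) ∘ ((k ⊗₁ id) ∘ λ⁻¹)
      ≈⟨ pullʳ (pullʳ (pullʳ (pullˡ merge₁))) ⟩
    ψ ∘ ((id ⊗₁ φ) ∘ (α⁻¹ ∘ (((q ∘ k) ⊗₁ id) ∘ λ⁻¹)))
      ≈⟨ ∘ʳ (∘ʳ (∘ʳ (pushˡ (Eq.trans (⊗ˡ hyp) (Eq.sym merge₁))))) ⟩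
    ψ ∘ ((id ⊗₁ φ) ∘ (α⁻¹ ∘ (((m ⊗₁ n) ⊗₁ id) ∘ ((λ⁻¹ ⊗₁ id) ∘ λ⁻¹))))
      ≈⟨ ∘ʳ (∘ʳ (extendʳ α⁻¹-natural)) ⟩
    ψ ∘ ((id ⊗₁ φ) ∘ ((m ⊗₁ (n ⊗₁ id)) ∘ (α⁻¹ ∘ ((λ⁻¹ ⊗₁ id) ∘ λ⁻¹))))
      ≈⟨ ∘ʳ (∘ʳ (∘ʳ (coherence {⌞ u ⌟} (α⁻ˢ ∘ˢ ((λ⁻ˢ ⊠ˢ idˢ) ∘ˢ λ⁻ˢ)) ((idˢ ⊠ˢ λ⁻ˢ) ∘ˢ λ⁻ˢ)))) ⟩
    ψ ∘ ((id ⊗₁ φ) ∘ ((m ⊗₁ (n ⊗₁ id)) ∘ ((id ⊗₁ λ⁻¹) ∘ λ⁻¹)))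
      ≈⟨ ∘ʳ (Eq.trans (∘ʳ (pullˡ merge)) (pullˡ merge)) ⟩
    ψ ∘ (((id ∘ (m ∘ id)) ⊗₁ (φ ∘ ((n ⊗₁ id) ∘ λ⁻¹))) ∘ λ⁻¹)
      ≈⟨ ∘ʳ (pushˡ (Eq.trans (⊗ˡ (Eq.trans identityˡ identityʳ)) ⊗-serialize₁₂)) ⟩
    ψ ∘ ((m ⊗₁ id) ∘ ((id ⊗₁ (φ ∘ ((n ⊗₁ id) ∘ λ⁻¹))) ∘ λ⁻¹))
      ≈⟨ ∘ʳ (∘ʳ λ⁻¹-natural) ⟨
    ψ ∘ ((m ⊗₁ id) ∘ (λ⁻¹ ∘ (φ ∘ ((n ⊗₁ id) ∘ λ⁻¹))))
      ≈⟨ Eq.trans assoc (∘ʳ assoc) ⟨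
    (ψ ∘ ((m ⊗₁ id) ∘ λ⁻¹)) ∘ (φ ∘ ((n ⊗₁ id) ∘ λ⁻¹)) ∎

  -- Naturality moves the points `n` and `m` out of `exchange`, whose symmetry then acts on a unit;
  -- what is left is structural.
  eval-⊗ : {φ : Hom (a ⊗₀ u) v} {ψ : Hom (b ⊗₀ w) d} {q : Hom c (a ⊗₀ b)}
           {m : Hom unit b} {n : Hom unit a} {k : Hom unit c} →
           q ∘ k ≈ (n ⊗₁ m) ∘ λ⁻¹ →
           ((φ ⊗₁ ψ) ∘ (exchange ∘ (q ⊗₁ id))) ∘ ((k ⊗₁ id) ∘ λ⁻¹) ≈
           (φ ∘ ((n ⊗₁ id) ∘ λ⁻¹)) ⊗₁ (ψ ∘ ((m ⊗₁ id) ∘ λ⁻¹))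
  eval-⊗ {u = u} {w = w} {φ = φ} {ψ = ψ} {q = q} {m = m} {n = n} {k = k} hyp = begin
    ((φ ⊗₁ ψ) ∘ (exchange ∘ (q ⊗₁ id))) ∘ ((k ⊗₁ id) ∘ λ⁻¹)
      ≈⟨ pullʳ (pullʳ (pullˡ merge₁)) ⟩
    (φ ⊗₁ ψ) ∘ (exchange ∘ (((q ∘ k) ⊗₁ id) ∘ λ⁻¹))
      ≈⟨ ∘ʳ (∘ʳ (pushˡ (Eq.trans (⊗ˡ hyp) (Eq.sym merge₁)))) ⟩
    (φ ⊗₁ ψ) ∘ (exchange ∘ (((n ⊗₁ m) ⊗₁ id) ∘ ((λ⁻¹ ⊗₁ id) ∘ λ⁻¹)))
      ≈⟨ ∘ʳ (extendʳ (Eq.trans (∘ʳ (⊗ʳ (Eq.sym ⊗-id))) exchange-natural)) ⟩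
    (φ ⊗₁ ψ) ∘ (((n ⊗₁ id) ⊗₁ (m ⊗₁ id)) ∘ (exchange ∘ ((λ⁻¹ ⊗₁ id) ∘ λ⁻¹)))
      ≈⟨ ∘ʳ (∘ʳ (∘ˡ (∘ʳ (∘ˡ (⊗ʳ swap-unit))))) ⟩
    _ ≈⟨ ∘ʳ (∘ʳ (coherence {⌞ u ⌟ ⊠ ⌞ w ⌟}
           ((αˢ ∘ˢ ((idˢ ⊠ˢ (α⁻ˢ ∘ˢ (((ρ⁻ˢ ∘ˢ λˢ) ⊠ˢ idˢ) ∘ˢ αˢ))) ∘ˢ α⁻ˢ)) ∘ˢ ((λ⁻ˢ ⊠ˢ idˢ) ∘ˢ λ⁻ˢ))
           (λ⁻ˢ ⊠ˢ λ⁻ˢ))) ⟩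
    (φ ⊗₁ ψ) ∘ (((n ⊗₁ id) ⊗₁ (m ⊗₁ id)) ∘ (λ⁻¹ ⊗₁ λ⁻¹))
      ≈⟨ Eq.trans (∘ʳ merge) merge ⟩
    (φ ∘ ((n ⊗₁ id) ∘ λ⁻¹)) ⊗₁ (ψ ∘ ((m ⊗₁ id) ∘ λ⁻¹)) ∎

  eval-curry : {φ : Hom (a ⊗₀ (u ⊗₀ v)) w} {n : Hom unit a} →
               curry φ ∘ ((n ⊗₁ id) ∘ λ⁻¹) ≈ (id ⊸₁ (φ ∘ ((n ⊗₁ id) ∘ λ⁻¹))) ∘ η
  eval-curry {u = u} {v = v} {φ = φ} {n = n} = begin
    curry φ ∘ ((n ⊗₁ id) ∘ λ⁻¹)
      ≈⟨ pullˡ (Eq.trans curry-natural (curry-resp (∘ʳ (⊗ʳ ⊗-id)))) ⟩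
    curry (φ ∘ (n ⊗₁ id)) ∘ λ⁻¹                         ≈⟨ pullʳ η-natural ⟩
    (id ⊸₁ ((φ ∘ (n ⊗₁ id)) ∘ α⁻¹)) ∘ ((id ⊸₁ (λ⁻¹ ⊗₁ id)) ∘ η)  ≈⟨ pullˡ ⊸-merge ⟩
    (id ⊸₁ (((φ ∘ (n ⊗₁ id)) ∘ α⁻¹) ∘ (λ⁻¹ ⊗₁ id))) ∘ η
      ≈⟨ ∘ˡ (⊸-resp-≈ Eq.refl (Eq.trans
           (pullʳ (coherence {⌞ u ⌟ ⊠ ⌞ v ⌟} (α⁻ˢ ∘ˢ (λ⁻ˢ ⊠ˢ idˢ)) λ⁻ˢ)) assoc)) ⟩
    (id ⊸₁ (φ ∘ ((n ⊗₁ id) ∘ λ⁻¹))) ∘ η ∎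

  -- The hypothesis has the shape of `ty-++-assoc`, with `k` the relabelling along associativity of
  -- concatenation. It is all that associativity of `_∘ₘ_` needs to know about contexts.
  assoc-body : ∀ {a b c e e′ d m u v w z}
    {χ : Hom (a ⊗₀ w) z} {ψ : Hom (b ⊗₀ v) w} {φ : Hom (c ⊗₀ u) v}
    {q : Hom d (a ⊗₀ e)} {p : Hom e (b ⊗₀ c)} {s : Hom m (e′ ⊗₀ c)} {t : Hom e′ (a ⊗₀ b)}
    {k : Hom m d} →
    α ∘ ((id ⊗₁ p) ∘ (q ∘ k)) ≈ (t ⊗₁ id) ∘ s →
    (χ ∘ ((id ⊗₁ (ψ ∘ ((id ⊗₁ φ) ∘ (α⁻¹ ∘ (p ⊗₁ id))))) ∘ (α⁻¹ ∘ (q ⊗₁ id)))) ∘ (k ⊗₁ id) ≈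
    (χ ∘ ((id ⊗₁ ψ) ∘ (α⁻¹ ∘ (t ⊗₁ id)))) ∘ ((id ⊗₁ φ) ∘ (α⁻¹ ∘ (s ⊗₁ id)))
  assoc-body {a} {b} {c} {u = u} {χ = χ} {ψ = ψ} {φ = φ} {q = q} {p = p} {s = s} {t = t}
    {k = k} hyp = begin
    (χ ∘ ((id ⊗₁ (ψ ∘ ((id ⊗₁ φ) ∘ (α⁻¹ ∘ (p ⊗₁ id))))) ∘ (α⁻¹ ∘ (q ⊗₁ id)))) ∘ (k ⊗₁ id)
      ≈⟨ pullʳ (pullʳ (pullʳ merge₁)) ⟩
    χ ∘ ((id ⊗₁ (ψ ∘ ((id ⊗₁ φ) ∘ (α⁻¹ ∘ (p ⊗₁ id))))) ∘ (α⁻¹ ∘ ((q ∘ k) ⊗₁ id)))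
      ≈⟨ ∘ʳ (pushˡ (Eq.sym merge₂)) ⟩
    χ ∘ ((id ⊗₁ ψ) ∘ ((id ⊗₁ ((id ⊗₁ φ) ∘ (α⁻¹ ∘ (p ⊗₁ id)))) ∘ (α⁻¹ ∘ ((q ∘ k) ⊗₁ id))))
      ≈⟨ ∘ʳ (∘ʳ (begin
        (id ⊗₁ ((id ⊗₁ φ) ∘ (α⁻¹ ∘ (p ⊗₁ id)))) ∘ (α⁻¹ ∘ ((q ∘ k) ⊗₁ id))
          ≈⟨ pushˡ (Eq.sym merge₂) ⟩
        (id ⊗₁ (id ⊗₁ φ)) ∘ ((id ⊗₁ (α⁻¹ ∘ (p ⊗₁ id))) ∘ (α⁻¹ ∘ ((q ∘ k) ⊗₁ id)))
          ≈⟨ ∘ʳ (pushˡ (Eq.sym merge₂)) ⟩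
        (id ⊗₁ (id ⊗₁ φ)) ∘ ((id ⊗₁ α⁻¹) ∘ ((id ⊗₁ (p ⊗₁ id)) ∘ (α⁻¹ ∘ ((q ∘ k) ⊗₁ id))))
          ≈⟨ ∘ʳ (∘ʳ (extendʳ (Eq.sym α⁻¹-natural))) ⟩
        (id ⊗₁ (id ⊗₁ φ)) ∘ ((id ⊗₁ α⁻¹) ∘ (α⁻¹ ∘ (((id ⊗₁ p) ⊗₁ id) ∘ ((q ∘ k) ⊗₁ id))))
          ≈⟨ ∘ʳ (∘ʳ (∘ʳ merge₁)) ⟩
        (id ⊗₁ (id ⊗₁ φ)) ∘ ((id ⊗₁ α⁻¹) ∘ (α⁻¹ ∘ (((id ⊗₁ p) ∘ (q ∘ k)) ⊗₁ id)))
          ≈⟨ ∘ʳ (Eq.sym assoc) ⟩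
        (id ⊗₁ (id ⊗₁ φ)) ∘ (((id ⊗₁ α⁻¹) ∘ α⁻¹) ∘ (((id ⊗₁ p) ∘ (q ∘ k)) ⊗₁ id))
          ≈⟨ ∘ʳ (∘ˡ (coherence {(⌞ a ⌟ ⊠ (⌞ b ⌟ ⊠ ⌞ c ⌟)) ⊠ ⌞ u ⌟}
                       ((idˢ ⊠ˢ α⁻ˢ) ∘ˢ α⁻ˢ) (α⁻ˢ ∘ˢ (α⁻ˢ ∘ˢ (αˢ ⊠ˢ idˢ))))) ⟩
        (id ⊗₁ (id ⊗₁ φ)) ∘ ((α⁻¹ ∘ (α⁻¹ ∘ (α ⊗₁ id))) ∘ (((id ⊗₁ p) ∘ (q ∘ k)) ⊗₁ id))
          ≈⟨ ∘ʳ (pullʳ (pullʳ (Eq.trans merge₁ (⊗ˡ hyp)))) ⟩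
        (id ⊗₁ (id ⊗₁ φ)) ∘ (α⁻¹ ∘ (α⁻¹ ∘ (((t ⊗₁ id) ∘ s) ⊗₁ id)))
          ≈⟨ extendʳ (Eq.sym α⁻¹-natural) ⟩
        α⁻¹ ∘ (((id ⊗₁ id) ⊗₁ φ) ∘ (α⁻¹ ∘ (((t ⊗₁ id) ∘ s) ⊗₁ id)))
          ≈⟨ ∘ʳ (∘-resp-≈ (⊗ˡ ⊗-id) (∘ʳ (Eq.sym merge₁))) ⟩
        α⁻¹ ∘ ((id ⊗₁ φ) ∘ (α⁻¹ ∘ (((t ⊗₁ id) ⊗₁ id) ∘ (s ⊗₁ id))))
          ≈⟨ ∘ʳ (∘ʳ (extendʳ (Eq.trans α⁻¹-natural (∘ˡ (⊗ʳ ⊗-id))))) ⟩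
        α⁻¹ ∘ ((id ⊗₁ φ) ∘ ((t ⊗₁ id) ∘ (α⁻¹ ∘ (s ⊗₁ id))))
          ≈⟨ ∘ʳ (extendʳ (Eq.sym ⊗-interchange)) ⟩
        α⁻¹ ∘ ((t ⊗₁ id) ∘ ((id ⊗₁ φ) ∘ (α⁻¹ ∘ (s ⊗₁ id))))  ∎)) ⟩
    χ ∘ ((id ⊗₁ ψ) ∘ (α⁻¹ ∘ ((t ⊗₁ id) ∘ ((id ⊗₁ φ) ∘ (α⁻¹ ∘ (s ⊗₁ id))))))
      ≈⟨ Eq.trans assoc (∘ʳ (Eq.trans assoc (∘ʳ assoc))) ⟨
    (χ ∘ ((id ⊗₁ ψ) ∘ (α⁻¹ ∘ (t ⊗₁ id)))) ∘ ((id ⊗₁ φ) ∘ (α⁻¹ ∘ (s ⊗₁ id))) ∎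

-- From separate functoriality of the tensor to an SMC category.

module _ {o ℓ r} (C : RawSMC o ℓ r) where
  open RawSMC C

  data Generated {p} (Basic : ∀ {a b} → Hom a b → Set p) :
                 ∀ {a b} → Hom a b → Set (o ⊔ ℓ ⊔ r ⊔ p) where
    basic : ∀ {a b} {f : Hom a b} → Basic f → Generated Basic f
    comp  : ∀ {a b c} {g : Hom b c} {f : Hom a b} →
            Generated Basic g → Generated Basic f → Generated Basic (g ∘ f)
    whisk : ∀ {a b c} {f : Hom a b} → Generated Basic f → Generated Basic (f ⊗₁ id {c})
    whisk′ : ∀ {a b c} {f : Hom a b} → Generated Basic f → Generated Basic (id {c} ⊗₁ f)
    resp  : ∀ {a b} {f g : Hom a b} → f ≈ g → Generated Basic f → Generated Basic g

  Commute : ∀ {a b c d} → Hom a b → Hom c d → Set r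
  Commute f g = (f ⊗₁ id) ∘ (id ⊗₁ g) ≈ (id ⊗₁ g) ∘ (f ⊗₁ id)

  Central : ∀ {a b} → Hom a b → Set (o ⊔ ℓ ⊔ r)
  Central g = ∀ {a b} (f : Hom a b) → Commute f g

  -- Modelled on the premonoidal categories of Power and Robinson, where the two whiskerings are
  -- functorial but need not commute; the fields `σ-central`, `basic-commute` and `generated` are
  -- what makes them commute. For the closed structure, `⊸-β` and `⊸-η` say that a map into a hom
  -- object is the transpose of its evaluation, from which, with `zig`, the other laws of `_⊸₁_`, ε
  -- and η are recovered.
  record IsPremonoidal {p} (Basic : ∀ {a b} → Hom a b → Set p) : Set (o ⊔ ℓ ⊔ r ⊔ p) where
    field
      isCategory : IsCategory C
      ⊗-resp-≈  : ∀ {a b c d} {f f′ : Hom a b} {g g′ : Hom c d} →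
                  f ≈ f′ → g ≈ g′ → f ⊗₁ g ≈ f′ ⊗₁ g′
      ⊸-resp-≈  : ∀ {a b c d} {f f′ : Hom a b} {g g′ : Hom c d} →
                  f ≈ f′ → g ≈ g′ → f ⊸₁ g ≈ f′ ⊸₁ g′
      ⊗-id      : ∀ {a b} → id {a} ⊗₁ id {b} ≈ id
      ⊗-split   : ∀ {a b c d} {f : Hom a b} {g : Hom c d} → f ⊗₁ g ≈ (f ⊗₁ id) ∘ (id ⊗₁ g)
      whisk-∘   : ∀ {a b c d} {g : Hom b c} {f : Hom a b} →
                  (g ∘ f) ⊗₁ id {d} ≈ (g ⊗₁ id) ∘ (f ⊗₁ id)

      α-isoˡ    : ∀ {a b c} → α⁻¹ ∘ α {a} {b} {c} ≈ id
      α-isoʳ    : ∀ {a b c} → α {a} {b} {c} ∘ α⁻¹ ≈ id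
      λ-isoˡ    : ∀ {a} → λ⁻¹ ∘ λ′ {a} ≈ id
      λ-isoʳ    : ∀ {a} → λ′ {a} ∘ λ⁻¹ ≈ id
      ρ-isoˡ    : ∀ {a} → ρ⁻¹ ∘ ρ {a} ≈ id
      ρ-isoʳ    : ∀ {a} → ρ {a} ∘ ρ⁻¹ ≈ id
      σ-iso     : ∀ {a b} → σ {b} {a} ∘ σ {a} {b} ≈ id
      pentagon  : ∀ {a b c d} →
                  α ∘ α {a} {b} {c ⊗₀ d} ≈ (α ⊗₁ id) ∘ (α ∘ (id ⊗₁ α))
      triangle  : ∀ {a b} → (ρ ⊗₁ id) ∘ α {a} {unit} {b} ≈ id ⊗₁ λ′
      hexagon   : ∀ {a b c} →
                  α ∘ (σ ∘ α {a} {b} {c}) ≈ (σ ⊗₁ id) ∘ (α ∘ (id ⊗₁ σ))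
      ρ-σ       : ∀ {a} → ρ {a} ∘ σ ≈ λ′
      zig       : ∀ {a b} → ε ∘ (η {a} {b} ⊗₁ id) ≈ id

      ρ-natural  : ∀ {a b} {f : Hom a b} → ρ ∘ (f ⊗₁ id) ≈ f ∘ ρ
      σ-naturalˡ : ∀ {a b c} {f : Hom a b} → σ ∘ (f ⊗₁ id {c}) ≈ (id ⊗₁ f) ∘ σ
      α-naturalˡ : ∀ {a b c d} {f : Hom a b} →
                   α ∘ (f ⊗₁ id {c ⊗₀ d}) ≈ ((f ⊗₁ id) ⊗₁ id) ∘ α

      σ-central     : ∀ {a b} → Central (σ {a} {b})
      basic-commute : ∀ {a b c d} {f : Hom a b} {g : Hom c d} →
                      Basic f → Basic g → Commute f g
      generated     : ∀ {a b} (f : Hom a b) → Generated Basic f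

      ⊸-β : ∀ {a b c d} {f : Hom a b} {g : Hom c d} →
            ε ∘ ((f ⊸₁ g) ⊗₁ id) ≈ g ∘ (ε ∘ (id ⊗₁ f))
      ⊸-η : ∀ {a b c} {h : Hom a (b ⊸₀ c)} → h ≈ (id ⊸₁ (ε ∘ (h ⊗₁ id))) ∘ η

module Premonoidal {o ℓ r p} {C : RawSMC o ℓ r} {Basic : ∀ {a b} → RawSMC.Hom C a b → Set p}
                   (isPremonoidal : IsPremonoidal C Basic) where
  open RawSMC C
  open IsPremonoidal isPremonoidal
  open IsCategory isCategory
  open CategoryReasoning isCategory

  private variable
    a b c d e : Ob
    f f′ g g′ h k : Hom a b

  ⊗ˡ : f ≈ f′ → f ⊗₁ g ≈ f′ ⊗₁ g
  ⊗ˡ p = ⊗-resp-≈ p Eq.refl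

  ⊗ʳ : g ≈ g′ → f ⊗₁ g ≈ f ⊗₁ g′
  ⊗ʳ p = ⊗-resp-≈ Eq.refl p

  merge₁ : (g ⊗₁ id {d}) ∘ (f ⊗₁ id) ≈ (g ∘ f) ⊗₁ id
  merge₁ = Eq.sym whisk-∘

  σ-naturalʳ : σ ∘ (id {c} ⊗₁ f) ≈ (f ⊗₁ id) ∘ σ
  σ-naturalʳ {f = f} = begin
    σ ∘ (id ⊗₁ f)               ≈⟨ ∘ʳ (cancelʳ σ-iso) ⟨
    σ ∘ (((id ⊗₁ f) ∘ σ) ∘ σ)   ≈⟨ ∘ʳ (∘ˡ σ-naturalˡ) ⟨
    σ ∘ ((σ ∘ (f ⊗₁ id)) ∘ σ)   ≈⟨ ∘ʳ assoc ⟩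
    σ ∘ (σ ∘ ((f ⊗₁ id) ∘ σ))   ≈⟨ cancelˡ σ-iso ⟩
    (f ⊗₁ id) ∘ σ               ∎

  -- Turns every law for `_⊗₁ id` into one for `id ⊗₁_`.
  σ-conj : id {c} ⊗₁ f ≈ σ ∘ ((f ⊗₁ id) ∘ σ)
  σ-conj = Eq.sym $ Eq.trans (∘ʳ (Eq.sym σ-naturalʳ)) (cancelˡ σ-iso)

  merge₂ : (id {d} ⊗₁ g) ∘ (id ⊗₁ f) ≈ id ⊗₁ (g ∘ f)
  merge₂ {g = g} {f = f} = begin
    (id ⊗₁ g) ∘ (id ⊗₁ f)              ≈⟨ ∘ʳ σ-conj ⟩
    (id ⊗₁ g) ∘ (σ ∘ ((f ⊗₁ id) ∘ σ))  ≈⟨ extendʳ (Eq.sym σ-naturalˡ) ⟩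
    σ ∘ ((g ⊗₁ id) ∘ ((f ⊗₁ id) ∘ σ))  ≈⟨ ∘ʳ (pullˡ merge₁) ⟩
    σ ∘ (((g ∘ f) ⊗₁ id) ∘ σ)          ≈⟨ σ-conj ⟨
    id ⊗₁ (g ∘ f)                      ∎

  -- Conjugation by σ brings `f` to the first position, where `α-naturalˡ` applies, and the hexagon
  -- returns it to the middle. On the way `id ⊗₁ σ` has to pass `f ⊗₁ id`, which is the purpose of
  -- `σ-central`: interchange in general is not yet known.
  α-naturalᵐ : α ∘ (id {c} ⊗₁ (f ⊗₁ id {d})) ≈ ((id ⊗₁ f) ⊗₁ id) ∘ α
  α-naturalᵐ {f = f} = begin
    α ∘ (id ⊗₁ (f ⊗₁ id))                              ≈⟨ ∘ʳ σ-conj ⟩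
    α ∘ (σ ∘ (((f ⊗₁ id) ⊗₁ id) ∘ σ))                  ≈⟨ ∘ʳ (∘ʳ (∘ʳ (cancelˡ α-isoʳ))) ⟨
    α ∘ (σ ∘ (((f ⊗₁ id) ⊗₁ id) ∘ (α ∘ (α⁻¹ ∘ σ))))    ≈⟨ ∘ʳ (∘ʳ (extendʳ (Eq.sym α-naturalˡ))) ⟩
    α ∘ (σ ∘ (α ∘ ((f ⊗₁ id) ∘ (α⁻¹ ∘ σ))))            ≈⟨ hexagon′ ⟩
    (σ ⊗₁ id) ∘ (α ∘ ((id ⊗₁ σ) ∘ ((f ⊗₁ id) ∘ (α⁻¹ ∘ σ))))
                                                       ≈⟨ ∘ʳ (∘ʳ (extendʳ (Eq.sym (σ-central f)))) ⟩
    (σ ⊗₁ id) ∘ (α ∘ ((f ⊗₁ id) ∘ ((id ⊗₁ σ) ∘ (α⁻¹ ∘ σ))))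
                                                       ≈⟨ ∘ʳ (extendʳ α-naturalˡ) ⟩
    (σ ⊗₁ id) ∘ (((f ⊗₁ id) ⊗₁ id) ∘ (α ∘ ((id ⊗₁ σ) ∘ (α⁻¹ ∘ σ))))
      ≈⟨ extendʳ (Eq.trans merge₁ (Eq.trans (⊗ˡ σ-naturalˡ) (Eq.sym merge₁))) ⟩
    ((id ⊗₁ f) ⊗₁ id) ∘ ((σ ⊗₁ id) ∘ (α ∘ ((id ⊗₁ σ) ∘ (α⁻¹ ∘ σ))))  ≈⟨ ∘ʳ hexagon′ ⟨
    ((id ⊗₁ f) ⊗₁ id) ∘ (α ∘ (σ ∘ (α ∘ (α⁻¹ ∘ σ))))    ≈⟨ ∘ʳ (∘ʳ (∘ʳ (cancelˡ α-isoʳ))) ⟩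
    ((id ⊗₁ f) ⊗₁ id) ∘ (α ∘ (σ ∘ σ))                  ≈⟨ ∘ʳ (elimʳ σ-iso) ⟩
    ((id ⊗₁ f) ⊗₁ id) ∘ α                              ∎
    where
    hexagon′ : ∀ {a b c d} {x : Hom a (b ⊗₀ (c ⊗₀ d))} →
               α ∘ (σ ∘ (α ∘ x)) ≈ (σ ⊗₁ id) ∘ (α ∘ ((id ⊗₁ σ) ∘ x))
    hexagon′ = Eq.trans (∘ʳ (Eq.sym assoc))
      (Eq.trans (pullˡ hexagon) (Eq.trans assoc (∘ʳ assoc)))

  σ-α : σ ∘ α {a} {b} {c} ≈ α⁻¹ ∘ ((σ ⊗₁ id) ∘ (α ∘ (id ⊗₁ σ)))
  σ-α = Eq.sym (Eq.trans (∘ʳ (Eq.sym hexagon)) (cancelˡ α-isoˡ))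

  α-naturalʳ : α {a} {b} ∘ (id ⊗₁ (id ⊗₁ f)) ≈ (id ⊗₁ f) ∘ α
  α-naturalʳ {f = f} = monoˡ σ-iso (begin
    σ ∘ (α ∘ (id ⊗₁ (id ⊗₁ f)))     ≈⟨ pullˡ σ-α ⟩
    (α⁻¹ ∘ ((σ ⊗₁ id) ∘ (α ∘ (id ⊗₁ σ)))) ∘ (id ⊗₁ (id ⊗₁ f))
      ≈⟨ pullʳ (pullʳ (pullʳ (Eq.trans merge₂ (Eq.trans (⊗ʳ σ-naturalʳ) (Eq.sym merge₂))))) ⟩
    α⁻¹ ∘ ((σ ⊗₁ id) ∘ (α ∘ ((id ⊗₁ (f ⊗₁ id)) ∘ (id ⊗₁ σ))))
      ≈⟨ ∘ʳ (∘ʳ (extendʳ α-naturalᵐ)) ⟩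
    α⁻¹ ∘ ((σ ⊗₁ id) ∘ (((id ⊗₁ f) ⊗₁ id) ∘ (α ∘ (id ⊗₁ σ))))
      ≈⟨ ∘ʳ (extendʳ (Eq.trans merge₁ (Eq.trans (⊗ˡ σ-naturalʳ) (Eq.sym merge₁)))) ⟩
    α⁻¹ ∘ (((f ⊗₁ id) ⊗₁ id) ∘ ((σ ⊗₁ id) ∘ (α ∘ (id ⊗₁ σ))))
      ≈⟨ ∘ʳ (∘ʳ hexagon) ⟨
    α⁻¹ ∘ (((f ⊗₁ id) ⊗₁ id) ∘ (α ∘ (σ ∘ α)))
      ≈⟨ ∘ʳ (extendʳ (Eq.sym α-naturalˡ)) ⟩
    α⁻¹ ∘ (α ∘ ((f ⊗₁ id) ∘ (σ ∘ α)))  ≈⟨ cancelˡ α-isoˡ ⟩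
    (f ⊗₁ id) ∘ (σ ∘ α)                ≈⟨ extendʳ (Eq.sym σ-naturalʳ) ⟩
    σ ∘ ((id ⊗₁ f) ∘ α)                ∎)

  commute-sym : Commute C f g → Commute C g f
  commute-sym {f = f} {g = g} p = monoˡ σ-iso (begin
    σ ∘ ((g ⊗₁ id) ∘ (id ⊗₁ f))   ≈⟨ extendʳ σ-naturalˡ ⟩
    (id ⊗₁ g) ∘ (σ ∘ (id ⊗₁ f))   ≈⟨ ∘ʳ σ-naturalʳ ⟩
    (id ⊗₁ g) ∘ ((f ⊗₁ id) ∘ σ)   ≈⟨ extendʳ (Eq.sym p) ⟩
    (f ⊗₁ id) ∘ ((id ⊗₁ g) ∘ σ)   ≈⟨ ∘ʳ σ-naturalˡ ⟨
    (f ⊗₁ id) ∘ (σ ∘ (g ⊗₁ id))   ≈⟨ extendʳ (Eq.sym σ-naturalʳ) ⟩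
    σ ∘ ((id ⊗₁ f) ∘ (g ⊗₁ id))   ∎)

  commute-∘ : Commute C h g → Commute C h f → Commute C h (g ∘ f)
  commute-∘ {h = h} {g = g} {f = f} p q = begin
    (h ⊗₁ id) ∘ (id ⊗₁ (g ∘ f))           ≈⟨ ∘ʳ merge₂ ⟨
    (h ⊗₁ id) ∘ ((id ⊗₁ g) ∘ (id ⊗₁ f))   ≈⟨ extendʳ p ⟩
    (id ⊗₁ g) ∘ ((h ⊗₁ id) ∘ (id ⊗₁ f))   ≈⟨ ∘ʳ q ⟩
    (id ⊗₁ g) ∘ ((id ⊗₁ f) ∘ (h ⊗₁ id))   ≈⟨ pullˡ merge₂ ⟩
    (id ⊗₁ (g ∘ f)) ∘ (h ⊗₁ id)           ∎

  commute-resp : f ≈ g → Commute C h f → Commute C h g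
  commute-resp p q =
    Eq.trans (∘ʳ (⊗ʳ (Eq.sym p))) (Eq.trans q (∘ˡ (⊗ʳ p)))

  commute-whisk : Commute C f g → Commute C f (g ⊗₁ id {d})
  commute-whisk {f = f} {g = g} p = monoˡ α-isoˡ (begin
    α ∘ ((f ⊗₁ id) ∘ (id ⊗₁ (g ⊗₁ id)))            ≈⟨ extendʳ α-naturalˡ ⟩
    ((f ⊗₁ id) ⊗₁ id) ∘ (α ∘ (id ⊗₁ (g ⊗₁ id)))    ≈⟨ ∘ʳ α-naturalᵐ ⟩
    ((f ⊗₁ id) ⊗₁ id) ∘ (((id ⊗₁ g) ⊗₁ id) ∘ α)
      ≈⟨ extendʳ (Eq.trans merge₁ (Eq.trans (⊗ˡ p) whisk-∘)) ⟩
    ((id ⊗₁ g) ⊗₁ id) ∘ (((f ⊗₁ id) ⊗₁ id) ∘ α)    ≈⟨ ∘ʳ α-naturalˡ ⟨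
    ((id ⊗₁ g) ⊗₁ id) ∘ (α ∘ (f ⊗₁ id))            ≈⟨ extendʳ (Eq.sym α-naturalᵐ) ⟩
    α ∘ ((id ⊗₁ (g ⊗₁ id)) ∘ (f ⊗₁ id))            ∎)

  commute-generated : (∀ {c d} {g : Hom c d} → Basic g → Commute C f g) →
                      ∀ {c d} {g : Hom c d} → Generated C Basic g → Commute C f g
  commute-generated p (basic q)  = p q
  commute-generated p (comp u v) = commute-∘ (commute-generated p u) (commute-generated p v)
  commute-generated p (whisk u)  = commute-whisk (commute-generated p u)
  -- Instead of a second reassociation, this whiskering is the other one conjugated by symmetries,
  -- which commute with everything.
  commute-generated p (whisk′ u) =
    commute-resp (Eq.sym σ-conj)
      (commute-∘ (σ-central _) (commute-∘ (commute-whisk (commute-generated p u)) (σ-central _)))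
  commute-generated p (resp q u) = commute-resp q (commute-generated p u)

  -- Two inductions over `Generated`: the inner one extends commutation with a basic `g` from basic
  -- morphisms to `f`, the outer one extends it from basic morphisms to `g`. Between them
  -- `commute-sym` exchanges the roles.
  commute : Commute C f g
  commute {f = f} {g = g} = commute-generated
    (λ p → commute-sym (commute-generated (basic-commute p) (generated f))) (generated g)

  ⊗-∘ : (g ∘ f) ⊗₁ (g′ ∘ f′) ≈ (g ⊗₁ g′) ∘ (f ⊗₁ f′)
  ⊗-∘ {g = g} {f = f} {g′ = g′} {f′ = f′} = begin
    (g ∘ f) ⊗₁ (g′ ∘ f′)                                      ≈⟨ ⊗-split ⟩
    ((g ∘ f) ⊗₁ id) ∘ (id ⊗₁ (g′ ∘ f′))                       ≈⟨ ∘-resp-≈ whisk-∘ (Eq.sym merge₂) ⟩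
    ((g ⊗₁ id) ∘ (f ⊗₁ id)) ∘ ((id ⊗₁ g′) ∘ (id ⊗₁ f′))       ≈⟨ pullʳ (extendʳ commute) ⟩
    (g ⊗₁ id) ∘ ((id ⊗₁ g′) ∘ ((f ⊗₁ id) ∘ (id ⊗₁ f′)))       ≈⟨ assoc ⟨
    ((g ⊗₁ id) ∘ (id ⊗₁ g′)) ∘ ((f ⊗₁ id) ∘ (id ⊗₁ f′))       ≈⟨ ∘-resp-≈ ⊗-split ⊗-split ⟨
    (g ⊗₁ g′) ∘ (f ⊗₁ f′)                                     ∎

  σ-natural : σ ∘ (f ⊗₁ g) ≈ (g ⊗₁ f) ∘ σ
  σ-natural {f = f} {g = g} = begin
    σ ∘ (f ⊗₁ g)                    ≈⟨ ∘ʳ ⊗-split ⟩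
    σ ∘ ((f ⊗₁ id) ∘ (id ⊗₁ g))     ≈⟨ extendʳ σ-naturalˡ ⟩
    (id ⊗₁ f) ∘ (σ ∘ (id ⊗₁ g))     ≈⟨ ∘ʳ σ-naturalʳ ⟩
    (id ⊗₁ f) ∘ ((g ⊗₁ id) ∘ σ)     ≈⟨ pullˡ (Eq.trans (Eq.sym commute) (Eq.sym ⊗-split)) ⟩
    (g ⊗₁ f) ∘ σ                    ∎

  α-natural : α ∘ (f ⊗₁ (g ⊗₁ h)) ≈ ((f ⊗₁ g) ⊗₁ h) ∘ α
  α-natural {f = f} {g = g} {h = h} = begin
    α ∘ (f ⊗₁ (g ⊗₁ h))
      ≈⟨ ∘ʳ (Eq.trans ⊗-split (∘ʳ (Eq.trans (⊗ʳ ⊗-split) (Eq.sym merge₂)))) ⟩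
    α ∘ ((f ⊗₁ id) ∘ ((id ⊗₁ (g ⊗₁ id)) ∘ (id ⊗₁ (id ⊗₁ h))))   ≈⟨ extendʳ α-naturalˡ ⟩
    ((f ⊗₁ id) ⊗₁ id) ∘ (α ∘ ((id ⊗₁ (g ⊗₁ id)) ∘ (id ⊗₁ (id ⊗₁ h))))
      ≈⟨ ∘ʳ (extendʳ α-naturalᵐ) ⟩
    ((f ⊗₁ id) ⊗₁ id) ∘ (((id ⊗₁ g) ⊗₁ id) ∘ (α ∘ (id ⊗₁ (id ⊗₁ h))))
      ≈⟨ pullˡ (Eq.trans merge₁ (⊗ˡ (Eq.sym ⊗-split))) ⟩
    ((f ⊗₁ g) ⊗₁ id) ∘ (α ∘ (id ⊗₁ (id ⊗₁ h)))          ≈⟨ ∘ʳ α-naturalʳ ⟩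
    ((f ⊗₁ g) ⊗₁ id) ∘ ((id ⊗₁ h) ∘ α)                  ≈⟨ pullˡ (Eq.sym ⊗-split) ⟩
    ((f ⊗₁ g) ⊗₁ h) ∘ α                                 ∎

  λ-natural : λ′ ∘ (id ⊗₁ f) ≈ f ∘ λ′
  λ-natural {f = f} = begin
    λ′ ∘ (id ⊗₁ f)         ≈⟨ ∘ˡ ρ-σ ⟨
    (ρ ∘ σ) ∘ (id ⊗₁ f)    ≈⟨ pullʳ σ-naturalʳ ⟩
    ρ ∘ ((f ⊗₁ id) ∘ σ)    ≈⟨ extendʳ ρ-natural ⟩
    f ∘ (ρ ∘ σ)            ≈⟨ ∘ʳ ρ-σ ⟩
    f ∘ λ′                 ∎

  -- By `⊸-η` a map into a hom object is the transpose of its evaluation. The closed laws below are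
  -- checked after evaluation, where `⊸-β` computes.
  ε-injective : ε ∘ (h ⊗₁ id {b}) ≈ ε {b} {c} ∘ (k ⊗₁ id) → h ≈ k
  ε-injective p = Eq.trans ⊸-η (Eq.trans (∘ˡ (⊸-resp-≈ Eq.refl p)) (Eq.sym ⊸-η))

  ⊸-∘ : (g ∘ f) ⊸₁ (g′ ∘ f′) ≈ (f ⊸₁ g′) ∘ (g ⊸₁ f′)
  ⊸-∘ {g = g} {f = f} {g′ = g′} {f′ = f′} = ε-injective (begin
    ε ∘ (((g ∘ f) ⊸₁ (g′ ∘ f′)) ⊗₁ id)           ≈⟨ ⊸-β ⟩
    (g′ ∘ f′) ∘ (ε ∘ (id ⊗₁ (g ∘ f)))            ≈⟨ pullʳ (∘ʳ (∘ʳ (Eq.sym merge₂))) ⟩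
    g′ ∘ (f′ ∘ (ε ∘ ((id ⊗₁ g) ∘ (id ⊗₁ f))))    ≈⟨ ∘ʳ (∘ʳ (Eq.sym assoc)) ⟩
    g′ ∘ (f′ ∘ ((ε ∘ (id ⊗₁ g)) ∘ (id ⊗₁ f)))    ≈⟨ ∘ʳ (pullˡ (Eq.sym ⊸-β)) ⟩
    g′ ∘ ((ε ∘ ((g ⊸₁ f′) ⊗₁ id)) ∘ (id ⊗₁ f))   ≈⟨ ∘ʳ (pullʳ commute) ⟩
    g′ ∘ (ε ∘ ((id ⊗₁ f) ∘ ((g ⊸₁ f′) ⊗₁ id)))   ≈⟨ ∘ʳ assoc ⟨
    g′ ∘ ((ε ∘ (id ⊗₁ f)) ∘ ((g ⊸₁ f′) ⊗₁ id))   ≈⟨ pullˡ (Eq.sym ⊸-β) ⟩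
    (ε ∘ ((f ⊸₁ g′) ⊗₁ id)) ∘ ((g ⊸₁ f′) ⊗₁ id)  ≈⟨ pullʳ merge₁ ⟩
    ε ∘ (((f ⊸₁ g′) ∘ (g ⊸₁ f′)) ⊗₁ id)          ∎)

  ε-natural : ε {a} ∘ ((id ⊸₁ g) ⊗₁ id) ≈ g ∘ ε
  ε-natural = Eq.trans ⊸-β (∘ʳ (elimʳ ⊗-id))

  ε-extra : ε ∘ ((f ⊸₁ id {c}) ⊗₁ id) ≈ ε ∘ (id ⊗₁ f)
  ε-extra = Eq.trans ⊸-β identityˡ

  ε-transpose : ε ∘ (((f ⊸₁ g) ∘ η) ⊗₁ id) ≈ g ∘ (id ⊗₁ f)
  ε-transpose {f = f} {g = g} = begin
    ε ∘ (((f ⊸₁ g) ∘ η) ⊗₁ id)                ≈⟨ ∘ʳ whisk-∘ ⟩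
    ε ∘ (((f ⊸₁ g) ⊗₁ id) ∘ (η ⊗₁ id))        ≈⟨ pullˡ ⊸-β ⟩
    (g ∘ (ε ∘ (id ⊗₁ f))) ∘ (η ⊗₁ id)         ≈⟨ pullʳ (pullʳ (Eq.sym commute)) ⟩
    g ∘ (ε ∘ ((η ⊗₁ id) ∘ (id ⊗₁ f)))         ≈⟨ ∘ʳ (cancelˡ zig) ⟩
    g ∘ (id ⊗₁ f)                             ∎

  η-natural : η {b} {c} ∘ f ≈ (id ⊸₁ (f ⊗₁ id)) ∘ η
  η-natural {f = f} = ε-injective (begin
    ε ∘ ((η ∘ f) ⊗₁ id)               ≈⟨ ∘ʳ whisk-∘ ⟩
    ε ∘ ((η ⊗₁ id) ∘ (f ⊗₁ id))       ≈⟨ cancelˡ zig ⟩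
    f ⊗₁ id                           ≈⟨ elimʳ ⊗-id ⟨
    (f ⊗₁ id) ∘ (id ⊗₁ id)            ≈⟨ ε-transpose ⟨
    ε ∘ (((id ⊸₁ (f ⊗₁ id)) ∘ η) ⊗₁ id)  ∎)

  η-extra : (f ⊸₁ id) ∘ η {a} ≈ (id ⊸₁ (id ⊗₁ f)) ∘ η
  η-extra = ε-injective (Eq.trans ε-transpose
    (Eq.trans identityˡ (Eq.trans (Eq.sym (elimʳ ⊗-id)) (Eq.sym ε-transpose))))

  isSMC : IsSMC C
  isSMC = record
    { equiv = equiv ; ∘-resp-≈ = ∘-resp-≈
    ; identityˡ = identityˡ ; identityʳ = identityʳ ; assoc = assoc
    ; ⊗-resp-≈ = ⊗-resp-≈ ; ⊗-id = ⊗-id ; ⊗-∘ = ⊗-∘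
    ; ⊸-resp-≈ = ⊸-resp-≈
    ; ⊸-id = ε-injective (Eq.trans ε-natural (Eq.trans identityˡ (Eq.sym (elimʳ ⊗-id))))
    ; ⊸-∘ = ⊸-∘
    ; α-isoˡ = α-isoˡ ; α-isoʳ = α-isoʳ ; λ-isoˡ = λ-isoˡ ; λ-isoʳ = λ-isoʳ
    ; ρ-isoˡ = ρ-isoˡ ; ρ-isoʳ = ρ-isoʳ ; σ-iso = σ-iso
    ; α-natural = α-natural ; λ-natural = λ-natural
    ; ρ-natural = ρ-natural ; σ-natural = σ-natural
    ; pentagon = pentagon ; triangle = triangle ; hexagon = hexagon
    ; ε-natural = ε-natural ; ε-extra = ε-extra
    ; η-natural = η-natural ; η-extra = η-extra
    ; zig = zig
    ; zag = ε-injective (Eq.trans ε-transpose (elimʳ ⊗-id) ⟨≈⟩ Eq.sym (elimʳ ⊗-id))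
    }
    where
    infixr 5 _⟨≈⟩_
    _⟨≈⟩_ = Eq.trans

-- The SMC structure on quotients of 𝒞_{X,Σ}

module Contexts {x s} (S : Signature x s) where
  open Signature S
  open CXΣ S
  open SMC (freeSMC X)
  open SMCProperties (freeSMC X)
  open SymmetricProperties (freeSMC X)

  join-split : ∀ a Γ → join a Γ ∘ split a Γ ≈ id
  split-join : ∀ a Γ → split a Γ ∘ join a Γ ≈ id
  join-split a []      = ρ-isoʳ
  join-split a (g ∷ Γ) = begin
    (join _ Γ ∘ (α ∘ (id ⊗₁ split ⌜ g ⌝ Γ))) ∘ ((id ⊗₁ join ⌜ g ⌝ Γ) ∘ (α⁻¹ ∘ split _ Γ))
      ≈⟨ pullʳ (pullʳ (cancelˡ (⊗-iso identityˡ (split-join ⌜ g ⌝ Γ)))) ⟩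
    join _ Γ ∘ (α ∘ (α⁻¹ ∘ split _ Γ))   ≈⟨ ∘ʳ (cancelˡ α-isoʳ) ⟩
    join _ Γ ∘ split _ Γ                 ≈⟨ join-split _ Γ ⟩
    id                                   ∎
  split-join a []      = ρ-isoˡ
  split-join a (g ∷ Γ) = begin
    ((id ⊗₁ join ⌜ g ⌝ Γ) ∘ (α⁻¹ ∘ split _ Γ)) ∘ (join _ Γ ∘ (α ∘ (id ⊗₁ split ⌜ g ⌝ Γ)))
      ≈⟨ pullʳ (pullʳ (cancelˡ (split-join _ Γ))) ⟩
    (id ⊗₁ join ⌜ g ⌝ Γ) ∘ (α⁻¹ ∘ (α ∘ (id ⊗₁ split ⌜ g ⌝ Γ)))
      ≈⟨ ∘ʳ (cancelˡ α-isoˡ) ⟩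
    (id ⊗₁ join ⌜ g ⌝ Γ) ∘ (id ⊗₁ split ⌜ g ⌝ Γ)
      ≈⟨ ⊗-iso identityˡ (join-split ⌜ g ⌝ Γ) ⟩
    id  ∎

  relabel : ∀ {Γ Δ} → Γ ≡ Δ → Hom (ty Γ) (ty Δ)
  relabel refl = id

  -- On a nonempty list `++-identityʳ` and `++-assoc` reduce to the form `cong (f ∷_) p`, so this
  -- serves the inductive step for both.
  split-relabel : ∀ f {Γ Δ} (p : Γ ≡ Δ) →
                  split ⌜ f ⌝ Δ ∘ relabel (cong (f ∷_) p) ≈ (id ⊗₁ relabel p) ∘ split ⌜ f ⌝ Γ
  split-relabel f refl = Eq.trans identityʳ (Eq.sym (elimˡ ⊗-id))

  ty-++-[] : ∀ Γ → ty-++ Γ [] ≈ ρ⁻¹ ∘ relabel (++-identityʳ Γ)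
  ty-++-[] []      = Eq.trans (coherence {𝟙} λ⁻ˢ ρ⁻ˢ) (Eq.sym identityʳ)
  ty-++-[] (f ∷ Γ) = begin
    (join ⌜ f ⌝ Γ ⊗₁ id) ∘ (α ∘ ((id ⊗₁ ty-++ Γ []) ∘ split ⌜ f ⌝ (Γ ++ [])))
      ≈⟨ ∘ʳ (∘ʳ (pushˡ (Eq.trans (⊗ʳ (ty-++-[] Γ)) (Eq.sym merge₂)))) ⟩
    (join ⌜ f ⌝ Γ ⊗₁ id) ∘ (α ∘ ((id ⊗₁ ρ⁻¹) ∘ ((id ⊗₁ relabel p) ∘ split ⌜ f ⌝ (Γ ++ []))))
      ≈⟨ ∘ʳ (pullˡ (coherence {⌞ ⌜ f ⌝ ⌟ ⊠ ⌞ ty Γ ⌟} (αˢ ∘ˢ (idˢ ⊠ˢ ρ⁻ˢ)) ρ⁻ˢ)) ⟩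
    (join ⌜ f ⌝ Γ ⊗₁ id) ∘ (ρ⁻¹ ∘ ((id ⊗₁ relabel p) ∘ split ⌜ f ⌝ (Γ ++ [])))
      ≈⟨ extendʳ (Eq.sym ρ⁻¹-natural) ⟩
    ρ⁻¹ ∘ (join ⌜ f ⌝ Γ ∘ ((id ⊗₁ relabel p) ∘ split ⌜ f ⌝ (Γ ++ [])))
      ≈⟨ ∘ʳ (∘ʳ (split-relabel f p)) ⟨
    ρ⁻¹ ∘ (join ⌜ f ⌝ Γ ∘ (split ⌜ f ⌝ Γ ∘ relabel (cong (f ∷_) p)))
      ≈⟨ ∘ʳ (cancelˡ (join-split ⌜ f ⌝ Γ)) ⟩
    ρ⁻¹ ∘ relabel (cong (f ∷_) p) ∎
    where p = ++-identityʳ Γ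

  -- Each further operation in front costs one pentagon, at `⌜ f ⌝`, `ty Γ`, `ty Δ` and `ty Θ`.
  ty-++-assoc : ∀ Γ Δ Θ →
    α ∘ ((id ⊗₁ ty-++ Δ Θ) ∘ (ty-++ Γ (Δ ++ Θ) ∘ relabel (++-assoc Γ Δ Θ))) ≈
    (ty-++ Γ Δ ⊗₁ id) ∘ ty-++ (Γ ++ Δ) Θ
  ty-++-assoc []      Δ Θ = begin
    α ∘ ((id ⊗₁ ty-++ Δ Θ) ∘ (λ⁻¹ ∘ id))   ≈⟨ ∘ʳ (Eq.trans (∘ʳ identityʳ) (Eq.sym λ⁻¹-natural)) ⟩
    α ∘ (λ⁻¹ ∘ ty-++ Δ Θ)
      ≈⟨ pullˡ (coherence {⌞ ty Δ ⌟ ⊠ ⌞ ty Θ ⌟} (αˢ ∘ˢ λ⁻ˢ) (λ⁻ˢ ⊠ˢ idˢ)) ⟩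
    (λ⁻¹ ⊗₁ id) ∘ ty-++ Δ Θ                ∎
  ty-++-assoc (f ∷ Γ) Δ Θ = begin
    α ∘ ((id ⊗₁ ty-++ Δ Θ) ∘ (((j ⊗₁ id) ∘ (α ∘ ((id ⊗₁ q) ∘ split ⌜ f ⌝ (Γ ++ (Δ ++ Θ)))))
      ∘ relabel (cong (f ∷_) p)))
      ≈⟨ ∘ʳ (∘ʳ (pullʳ (pullʳ (pullʳ (split-relabel f p))))) ⟩
    α ∘ ((id ⊗₁ ty-++ Δ Θ) ∘ ((j ⊗₁ id) ∘ (α ∘ ((id ⊗₁ q) ∘ ((id ⊗₁ relabel p) ∘ m)))))
      ≈⟨ ∘ʳ (extendʳ (Eq.sym ⊗-interchange)) ⟩
    α ∘ ((j ⊗₁ id) ∘ ((id ⊗₁ ty-++ Δ Θ) ∘ (α ∘ ((id ⊗₁ q) ∘ ((id ⊗₁ relabel p) ∘ m)))))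
      ≈⟨ ∘ʳ (∘ʳ (extendʳ (Eq.trans (∘ˡ (⊗ˡ (Eq.sym ⊗-id))) (Eq.sym α-natural)))) ⟩
    α ∘ ((j ⊗₁ id) ∘ (α ∘ ((id ⊗₁ (id ⊗₁ ty-++ Δ Θ)) ∘ ((id ⊗₁ q) ∘ ((id ⊗₁ relabel p) ∘ m)))))
      ≈⟨ ∘ʳ (∘ʳ (∘ʳ (Eq.trans (∘ʳ (pullˡ merge₂)) (pullˡ merge₂)))) ⟩
    α ∘ ((j ⊗₁ id) ∘ (α ∘ ((id ⊗₁ ((id ⊗₁ ty-++ Δ Θ) ∘ (q ∘ relabel p))) ∘ m)))
      ≈⟨ extendʳ (Eq.trans (∘ʳ (⊗ʳ (Eq.sym ⊗-id))) α-natural) ⟩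
    ((j ⊗₁ id) ⊗₁ id) ∘ (α ∘ (α ∘ ((id ⊗₁ ((id ⊗₁ ty-++ Δ Θ) ∘ (q ∘ relabel p))) ∘ m)))
      ≈⟨ ∘ʳ (Eq.trans (pullˡ pentagon) (pullʳ (Eq.trans assoc (∘ʳ (pullˡ merge₂))))) ⟩
    ((j ⊗₁ id) ⊗₁ id) ∘ ((α ⊗₁ id) ∘ (α ∘ ((id ⊗₁ (α ∘ ((id ⊗₁ ty-++ Δ Θ) ∘ (q ∘ relabel p)))) ∘ m)))
      ≈⟨ ∘ʳ (∘ʳ (∘ʳ (pushˡ (Eq.trans (⊗ʳ (ty-++-assoc Γ Δ Θ)) (Eq.sym merge₂))))) ⟩
    ((j ⊗₁ id) ⊗₁ id) ∘ ((α ⊗₁ id) ∘ (α ∘ ((id ⊗₁ (ty-++ Γ Δ ⊗₁ id)) ∘ ((id ⊗₁ ty-++ (Γ ++ Δ) Θ) ∘ m))))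
      ≈⟨ ∘ʳ (∘ʳ (extendʳ α-natural)) ⟩
    ((j ⊗₁ id) ⊗₁ id) ∘ ((α ⊗₁ id) ∘ (((id ⊗₁ ty-++ Γ Δ) ⊗₁ id) ∘ (α ∘ ((id ⊗₁ ty-++ (Γ ++ Δ) Θ) ∘ m))))
      ≈⟨ Eq.trans (∘ʳ (pullˡ merge₁)) (pullˡ merge₁) ⟩
    (((j ⊗₁ id) ∘ (α ∘ (id ⊗₁ ty-++ Γ Δ))) ⊗₁ id) ∘ (α ∘ ((id ⊗₁ ty-++ (Γ ++ Δ) Θ) ∘ m))
      -- The inserted pair `split`, `join` at `Γ ++ Δ` completes both factors: `split` belongs to
      -- `ty-++ (f ∷ Γ) Δ` and `join` to `ty-++ (f ∷ Γ ++ Δ) Θ`.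
      ≈⟨ ∘ˡ (⊗ˡ (pullʳ (pullʳ (cancelʳ (split-join ⌜ f ⌝ (Γ ++ Δ)))))) ⟨
    ((((j ⊗₁ id) ∘ (α ∘ ((id ⊗₁ ty-++ Γ Δ) ∘ split ⌜ f ⌝ (Γ ++ Δ)))) ∘ join ⌜ f ⌝ (Γ ++ Δ)) ⊗₁ id)
      ∘ (α ∘ ((id ⊗₁ ty-++ (Γ ++ Δ) Θ) ∘ m))
      ≈⟨ pushˡ (Eq.sym merge₁) ⟩
    (ty-++ (f ∷ Γ) Δ ⊗₁ id) ∘ ty-++ (f ∷ Γ ++ Δ) Θ ∎
    where
    p = ++-assoc Γ Δ Θ
    j = join ⌜ f ⌝ Γ
    q = ty-++ Γ (Δ ++ Θ)
    m = split ⌜ f ⌝ ((Γ ++ Δ) ++ Θ)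

-- The congruence constructors of `_≈ᴿ_` replace a proof that `_∼_` itself is compatible with the
-- operations, which would involve permutations acting on blocks of a context. The laws hold for
-- every `R`, so it stays a parameter.
module Quotient {x s p} (S : Signature x s)
                (R : ∀ {a b} → CXΣ.Mor S a b → CXΣ.Mor S a b → Set p) where
  open Signature S
  open CXΣ S
  open Contexts S
  open SMC (freeSMC X)
  open SMCProperties (freeSMC X) hiding (isCategory)
  open SymmetricProperties (freeSMC X)
  private module Q = RawSMC (quotient CXΣ R)

  morSetoid : (U V : Ty X) → Setoid _ _
  morSetoid U V = record
    { Carrier = Mor U V ; _≈_ = Q._≈_
    ; isEquivalence = record
      { refl = base (return (bodies Eq.refl)) ; sym = symm ; trans = transit } }

  infixr 2 _≈Q⟨_⟩_ _≈Q⟨_⟨_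
  infix 3 _∎Q
  _≈Q⟨_⟩_ : ∀ {U V} (f : Mor U V) {g h : Mor U V} → f Q.≈ g → g Q.≈ h → f Q.≈ h
  _ ≈Q⟨ p ⟩ q = transit p q

  _≈Q⟨_⟨_ : ∀ {U V} (f : Mor U V) {g h : Mor U V} → g Q.≈ f → g Q.≈ h → f Q.≈ h
  _ ≈Q⟨ p ⟨ q = transit (symm p) q

  _∎Q : ∀ {U V} (f : Mor U V) → f Q.≈ f
  _ ∎Q = base (return (bodies Eq.refl))

  private variable
    U V W Z U′ V′ : Ty X
    Γ Δ Θ : List Op

  body-cong : {φ ψ : Hom (ty Γ ⊗ U) V} → φ ≈ ψ → (Γ , φ) Q.≈ (Γ , ψ)
  body-cong p = base (return (bodies p))

  reflQ : {f : Mor U V} → f Q.≈ f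
  reflQ = body-cong Eq.refl

  relabel-∼ : (p : Γ ≡ Δ) (φ : Hom (ty Δ ⊗ U) V) → (Δ , φ) Q.≈ (Γ , φ ∘ (relabel p ⊗₁ id))
  relabel-∼ refl φ = body-cong (Eq.sym (elimʳ ⊗-id))

  -- An empty context on the right does not disappear by computation; relabelling along
  -- `++-identityʳ` turns its `ty-++` into `ρ⁻¹`. On the left, `[] ++ Γ` computes to `Γ` and nothing
  -- of the kind is needed.
  drop-[] : ∀ Γ (φ : Hom ((ty Γ ⊗ I) ⊗ U) V) →
            ((Γ ++ []) , φ ∘ (ty-++ Γ [] ⊗₁ id)) Q.≈ (Γ , φ ∘ (ρ⁻¹ ⊗₁ id))
  drop-[] Γ φ = symm (transit (relabel-∼ (++-identityʳ Γ) _)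
    (body-cong (pullʳ (Eq.trans merge₁ (⊗ˡ (Eq.sym (ty-++-[] Γ)))))))

  -- This and the next three lemmas express operations with a pure morphism or an identity in the
  -- unchanged context `Γ`. Through them most laws become equations in the free SMC category.
  post : (g : Hom V W) (φ : Hom (ty Γ ⊗ U) V) → inc g ∘ₘ (Γ , φ) Q.≈ (Γ , g ∘ φ)
  post g φ = body-cong post-body

  pre : (φ : Hom (ty Γ ⊗ V) W) (g : Hom U V) → (Γ , φ) ∘ₘ inc g Q.≈ (Γ , φ ∘ (id ⊗₁ g))
  pre {Γ} φ g = transit
    (body-cong (Eq.trans (∘ʳ (Eq.sym assoc)) (Eq.sym assoc)))
    (transit (drop-[] Γ (φ ∘ ((id ⊗₁ (g ∘ λ′)) ∘ α⁻¹)))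
             (body-cong (Eq.trans (Eq.trans assoc (∘ʳ assoc)) pre-body)))

  whiskerˡ : (φ : Hom (ty Γ ⊗ U) V) → (Γ , φ) ⊗ₘ idₘ {W} Q.≈ (Γ , (φ ⊗₁ id) ∘ α)
  whiskerˡ {Γ} φ = transit
    (body-cong (Eq.sym assoc))
    (transit (drop-[] Γ ((φ ⊗₁ λ′) ∘ exchange)) (body-cong (Eq.trans assoc whisk-body)))

  whiskerʳ : (φ : Hom (ty Γ ⊗ U) V) → idₘ {W} ⊗ₘ (Γ , φ) Q.≈ (Γ , (id ⊗₁ φ) ∘ swap)
  whiskerʳ φ = body-cong whisk′-body

  inc-cong : {f g : Hom U V} → f ≈ g → inc f Q.≈ inc g
  inc-cong p = body-cong (∘ˡ p)

  inc-id : inc (id {U}) Q.≈ idₘ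
  inc-id = body-cong identityˡ

  inc-∘ : (g : Hom V W) (f : Hom U V) → inc g ∘ₘ inc f Q.≈ inc (g ∘ f)
  inc-∘ g f = transit (post g (f ∘ λ′)) (body-cong (Eq.sym assoc))

  inc-⊗ˡ : (f : Hom U V) → inc f ⊗ₘ idₘ {W} Q.≈ inc (f ⊗₁ id)
  inc-⊗ˡ f = transit (whiskerˡ (f ∘ λ′)) (body-cong whisk-λ)

  inc-⊗ʳ : (f : Hom U V) → idₘ {W} ⊗ₘ inc f Q.≈ inc (id ⊗₁ f)
  inc-⊗ʳ f = transit (whiskerʳ (f ∘ λ′)) (body-cong whisk′-λ)

  inc-iso : {g : Hom V U} {f : Hom U V} → g ∘ f ≈ id → inc g ∘ₘ inc f Q.≈ idₘ
  inc-iso {g = g} {f} p = transit (inc-∘ g f) (transit (inc-cong p) inc-id)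

  isCategory : IsCategory (quotient CXΣ R)
  isCategory = record
    { equiv = Setoid.isEquivalence (morSetoid _ _)
    ; ∘-resp-≈ = ∘-cong
    ; identityˡ = λ {_} {_} {f} → identityˡ′ f
    ; identityʳ = λ {_} {_} {f} → identityʳ′ f
    ; assoc = λ {_} {_} {_} {_} {f} {g} {h} → assoc′ f g h
    }
    where
    identityˡ′ : (f : Mor U V) → idₘ ∘ₘ f Q.≈ f
    identityˡ′ (Γ , φ) = transit (∘-cong (symm inc-id) reflQ)
                           (transit (post id φ) (body-cong identityˡ))
    identityʳ′ : (f : Mor U V) → f ∘ₘ idₘ Q.≈ f
    identityʳ′ (Γ , φ) = transit (∘-cong reflQ (symm inc-id))
                           (transit (pre φ id) (body-cong (elimʳ ⊗-id)))
    assoc′ : (f : Mor U V) (g : Mor V W) (h : Mor W Z) → (h ∘ₘ g) ∘ₘ f Q.≈ h ∘ₘ (g ∘ₘ f)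
    assoc′ (Γ , φ) (Δ , ψ) (Θ , χ) = symm (transit
      (relabel-∼ (++-assoc Θ Δ Γ) _)
      (body-cong (assoc-body (ty-++-assoc Θ Δ Γ))))

  -- The body `ρ` makes `name g` a morphism from `I` to `⌜ g ⌝`, the point whose evaluation by ε
  -- gives back the operation `g`.
  data Basic : ∀ {U V} → Mor U V → Set (x ⊔ s) where
    pure : (f : Hom U V) → Basic (inc f)
    name : (g : Op) → Basic ((g ∷ []) , ρ)

  -- Both composites have context `Γ`, since that of `inc g` is empty; what remains is interchange
  -- for bodies.
  inc-central : (g : Hom U′ V′) → Central (quotient CXΣ R) (inc g)
  inc-central g (Γ , φ) =
    ((Γ , φ) ⊗ₘ idₘ) ∘ₘ (idₘ ⊗ₘ inc g)              ≈Q⟨ ∘-cong (whiskerˡ φ) (inc-⊗ʳ g) ⟩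
    (Γ , (φ ⊗₁ id) ∘ α) ∘ₘ inc (id ⊗₁ g)            ≈Q⟨ pre _ _ ⟩
    (Γ , ((φ ⊗₁ id) ∘ α) ∘ (id ⊗₁ (id ⊗₁ g)))
      ≈Q⟨ body-cong (Eq.trans (pullʳ α-natural)
           (Eq.trans (∘ʳ (∘ˡ (⊗ˡ ⊗-id))) (extendʳ ⊗-interchange))) ⟩
    (Γ , (id ⊗₁ g) ∘ ((φ ⊗₁ id) ∘ α))               ≈Q⟨ post _ _ ⟨
    inc (id ⊗₁ g) ∘ₘ (Γ , (φ ⊗₁ id) ∘ α)            ≈Q⟨ ∘-cong (inc-⊗ʳ g) (whiskerˡ φ) ⟨
    (idₘ ⊗ₘ inc g) ∘ₘ ((Γ , φ) ⊗ₘ idₘ)              ∎Q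

  σ-naturalˡ : (f : Mor U V) → inc σ ∘ₘ (f ⊗ₘ idₘ {W}) Q.≈ (idₘ ⊗ₘ f) ∘ₘ inc σ
  σ-naturalˡ (Γ , φ) =
    inc σ ∘ₘ ((Γ , φ) ⊗ₘ idₘ)                ≈Q⟨ ∘-cong reflQ (whiskerˡ φ) ⟩
    inc σ ∘ₘ (Γ , (φ ⊗₁ id) ∘ α)             ≈Q⟨ post _ _ ⟩
    (Γ , σ ∘ ((φ ⊗₁ id) ∘ α))                ≈Q⟨ body-cong σ-body ⟩
    (Γ , ((id ⊗₁ φ) ∘ swap) ∘ (id ⊗₁ σ))     ≈Q⟨ pre _ _ ⟨
    (Γ , (id ⊗₁ φ) ∘ swap) ∘ₘ inc σ          ≈Q⟨ ∘-cong (whiskerʳ φ) reflQ ⟨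
    (idₘ ⊗ₘ (Γ , φ)) ∘ₘ inc σ                ∎Q

  α-naturalˡ : (f : Mor U V) →
    inc α ∘ₘ (f ⊗ₘ idₘ {W ⊗ Z}) Q.≈ ((f ⊗ₘ idₘ) ⊗ₘ idₘ) ∘ₘ inc α
  α-naturalˡ (Γ , φ) =
    inc α ∘ₘ ((Γ , φ) ⊗ₘ idₘ)                            ≈Q⟨ ∘-cong reflQ (whiskerˡ φ) ⟩
    inc α ∘ₘ (Γ , (φ ⊗₁ id) ∘ α)                         ≈Q⟨ post _ _ ⟩
    (Γ , α ∘ ((φ ⊗₁ id) ∘ α))                            ≈Q⟨ body-cong α-body ⟩
    (Γ , ((((φ ⊗₁ id) ∘ α) ⊗₁ id) ∘ α) ∘ (id ⊗₁ α))      ≈Q⟨ pre _ _ ⟨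
    (Γ , (((φ ⊗₁ id) ∘ α) ⊗₁ id) ∘ α) ∘ₘ inc α           ≈Q⟨ ∘-cong (whiskerˡ _) reflQ ⟨
    ((Γ , (φ ⊗₁ id) ∘ α) ⊗ₘ idₘ) ∘ₘ inc α
      ≈Q⟨ ∘-cong (⊗-cong (whiskerˡ φ) reflQ) reflQ ⟨
    (((Γ , φ) ⊗ₘ idₘ) ⊗ₘ idₘ) ∘ₘ inc α                   ∎Q

  ρ-naturalₘ : (f : Mor U V) → inc ρ ∘ₘ (f ⊗ₘ idₘ) Q.≈ f ∘ₘ inc ρ
  ρ-naturalₘ (Γ , φ) =
    inc ρ ∘ₘ ((Γ , φ) ⊗ₘ idₘ)        ≈Q⟨ ∘-cong reflQ (whiskerˡ φ) ⟩
    inc ρ ∘ₘ (Γ , (φ ⊗₁ id) ∘ α)     ≈Q⟨ post _ _ ⟩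
    (Γ , ρ ∘ ((φ ⊗₁ id) ∘ α))        ≈Q⟨ body-cong ρ-body ⟩
    (Γ , φ ∘ (id ⊗₁ ρ))              ≈Q⟨ pre _ _ ⟨
    (Γ , φ) ∘ₘ inc ρ                 ∎Q

  ⊗-split : (f : Mor U V) (g : Mor U′ V′) → f ⊗ₘ g Q.≈ (f ⊗ₘ idₘ) ∘ₘ (idₘ ⊗ₘ g)
  ⊗-split (Γ , φ) (Δ , ψ) = transit (body-cong split-body)
    (symm (∘-cong (whiskerˡ φ) (whiskerʳ ψ)))

  whisk-∘ : (g : Mor V W) (f : Mor U V) → (g ∘ₘ f) ⊗ₘ idₘ {Z} Q.≈ (g ⊗ₘ idₘ) ∘ₘ (f ⊗ₘ idₘ)
  whisk-∘ (Δ , ψ) (Γ , φ) = transit (whiskerˡ _)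
    (transit (body-cong whisk-∘-body) (symm (∘-cong (whiskerˡ ψ) (whiskerˡ φ))))

  curryₘ-β : (f : Mor (U ⊗ V) W) → inc ε ∘ₘ (curryₘ f ⊗ₘ idₘ) Q.≈ f
  curryₘ-β (Γ , φ) =
    inc ε ∘ₘ (curryₘ (Γ , φ) ⊗ₘ idₘ)            ≈Q⟨ ∘-cong reflQ (whiskerˡ _) ⟩
    inc ε ∘ₘ (Γ , (curry φ ⊗₁ id) ∘ α)      ≈Q⟨ post _ _ ⟩
    (Γ , ε ∘ ((curry φ ⊗₁ id) ∘ α))         ≈Q⟨ body-cong curry-β ⟩
    (Γ , φ)                                     ∎Q

  -- The definition of `_⊸ₘ_` appends the empty context of `idₘ` inside a transpose. By
  -- `curry-natural` the map `ty-++ Γ []` is pulled out of `curry` for `drop-[]`, and the resulting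
  -- `ρ⁻¹` is pushed back in.
  ⊸-curry : (φ : Hom (ty Γ ⊗ V) W) →
    idₘ {U} ⊸ₘ (Γ , φ) Q.≈ (Γ , curry (φ ∘ (id ⊗₁ ε)))
  ⊸-curry {Γ} {U = U} φ =
    ((Γ ++ []) , curry (φ ∘ ((id ⊗₁ χ) ∘ (α⁻¹ ∘ (ty-++ Γ [] ⊗₁ id)))))
      ≈Q⟨ body-cong (curry-resp (Eq.trans 
           (∘ʳ (Eq.trans (∘ʳ (∘ʳ (⊗ʳ (Eq.sym ⊗-id)))) (Eq.sym assoc))) (Eq.sym assoc))) ⟩
    ((Γ ++ []) , curry ((φ ∘ ((id ⊗₁ χ) ∘ α⁻¹)) ∘ (ty-++ Γ [] ⊗₁ (id ⊗₁ id))))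
      ≈Q⟨ body-cong curry-natural ⟨
    ((Γ ++ []) , curry (φ ∘ ((id ⊗₁ χ) ∘ α⁻¹)) ∘ (ty-++ Γ [] ⊗₁ id))
      ≈Q⟨ drop-[] Γ _ ⟩
    (Γ , curry (φ ∘ ((id ⊗₁ χ) ∘ α⁻¹)) ∘ (ρ⁻¹ ⊗₁ id))
      ≈Q⟨ body-cong curry-natural ⟩
    (Γ , curry ((φ ∘ ((id ⊗₁ χ) ∘ α⁻¹)) ∘ (ρ⁻¹ ⊗₁ (id ⊗₁ id))))
      ≈Q⟨ body-cong (curry-resp (Eq.trans (Eq.trans assoc (∘ʳ (Eq.trans assoc
           (∘-resp-≈ (⊗ʳ χ≈) (∘ʳ (⊗ʳ ⊗-id)))))) pre-body)) ⟩
    (Γ , curry (φ ∘ (id ⊗₁ ε))) ∎Q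
    where
    χ = Mor.body (inc ε ∘ₘ (idₘ {U ⊸ _} ⊗ₘ idₘ {U}))
    χ≈ : χ ≈ ε ∘ λ′
    χ≈ = Eq.trans post-body (∘ʳ (begin
      (λ′ ⊗₁ λ′) ∘ (exchange ∘ (λ⁻¹ ⊗₁ id))   ≈⟨ whisk′-body ⟩
      (id ⊗₁ λ′) ∘ swap                       ≈⟨ ∘ˡ (⊗ʳ identityˡ) ⟨
      (id ⊗₁ (id ∘ λ′)) ∘ swap                ≈⟨ whisk′-λ ⟩
      (id ⊗₁ id) ∘ λ′                         ≈⟨ elimˡ ⊗-id ⟩
      λ′                                      ∎))

  curryₘ-η : (f : Mor U (V ⊸ W)) → f Q.≈ (idₘ ⊸ₘ (inc ε ∘ₘ (f ⊗ₘ idₘ))) ∘ₘ inc η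
  curryₘ-η (Γ , φ) = symm (
    (idₘ ⊸ₘ (inc ε ∘ₘ ((Γ , φ) ⊗ₘ idₘ))) ∘ₘ inc η
      ≈Q⟨ ∘-cong (⊸-cong reflQ (transit (∘-cong reflQ (whiskerˡ φ)) (post _ _))) reflQ ⟩
    (idₘ ⊸ₘ (Γ , ε ∘ ((φ ⊗₁ id) ∘ α))) ∘ₘ inc η
      ≈Q⟨ ∘-cong (⊸-curry _) reflQ ⟩
    (Γ , curry ((ε ∘ ((φ ⊗₁ id) ∘ α)) ∘ (id ⊗₁ ε))) ∘ₘ inc η
      ≈Q⟨ pre _ _ ⟩
    (Γ , curry ((ε ∘ ((φ ⊗₁ id) ∘ α)) ∘ (id ⊗₁ ε)) ∘ (id ⊗₁ η))
      ≈Q⟨ body-cong (Eq.trans curry-natural (curry-resp (cancelʳ (⊗-iso identityˡ zig)))) ⟩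
    (Γ , curry (ε ∘ ((φ ⊗₁ id) ∘ α)))
      ≈Q⟨ body-cong curry-η ⟩
    (Γ , φ) ∎Q)

  ty-++-singleton : ∀ f Γ → ty-++ (f ∷ []) Γ ≈ split ⌜ f ⌝ Γ
  ty-++-singleton f Γ = begin
    (ρ ⊗₁ id) ∘ (α ∘ ((id ⊗₁ λ⁻¹) ∘ split ⌜ f ⌝ Γ))
      ≈⟨ Eq.trans (∘ʳ (Eq.sym assoc)) (Eq.sym assoc) ⟩
    ((ρ ⊗₁ id) ∘ (α ∘ (id ⊗₁ λ⁻¹))) ∘ split ⌜ f ⌝ Γ
      ≈⟨ elimˡ (coherence {⌞ ⌜ f ⌝ ⌟ ⊠ ⌞ ty Γ ⌟} ((ρˢ ⊠ˢ idˢ) ∘ˢ (αˢ ∘ˢ (idˢ ⊠ˢ λ⁻ˢ))) idˢ) ⟩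
    split ⌜ f ⌝ Γ ∎

  names : (Γ : List Op) → Mor I (ty Γ)
  names Γ = Γ , ρ

  -- Reduces contexts to single operations, so that `Basic` needs only single names. The term
  -- `namesₜ` is defined by the same recursion.
  names-∷ : ∀ f Γ → names (f ∷ Γ) Q.≈
    inc (join ⌜ f ⌝ Γ) ∘ₘ ((names (f ∷ []) ⊗ₘ names Γ) ∘ₘ inc λ⁻¹)
  names-∷ f Γ = symm (transit (∘-cong reflQ (pre _ _)) (transit (post _ _) (body-cong (begin
    j ∘ (((ρ ⊗₁ ρ) ∘ (exchange ∘ (ty-++ (f ∷ []) Γ ⊗₁ id))) ∘ (id ⊗₁ λ⁻¹))
      ≈⟨ ∘ʳ (Eq.trans (∘ˡ (Eq.trans (Eq.sym assoc) (∘-resp-≈ exchange-unit (⊗ˡ (ty-++-singleton f Γ)))))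
              (pullʳ ⊗-interchange)) ⟩
    j ∘ ((ρ ∘ (id ⊗₁ λ′)) ∘ ((id ⊗₁ λ⁻¹) ∘ (split ⌜ f ⌝ Γ ⊗₁ id)))
      ≈⟨ ∘ʳ (pullʳ (cancelˡ (⊗-iso identityˡ λ-isoʳ))) ⟩
    j ∘ (ρ ∘ (split ⌜ f ⌝ Γ ⊗₁ id))
      ≈⟨ ∘ʳ ρ-natural ⟩
    j ∘ (split ⌜ f ⌝ Γ ∘ ρ)
      ≈⟨ cancelˡ (join-split ⌜ f ⌝ Γ) ⟩
    ρ ∎))))
    where j = join ⌜ f ⌝ Γ

  factor : (φ : Hom (ty Γ ⊗ U) V) →
           (Γ , φ) Q.≈ inc φ ∘ₘ ((names Γ ⊗ₘ idₘ) ∘ₘ inc λ⁻¹)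
  factor {Γ} {U} φ = symm (
    inc φ ∘ₘ ((names Γ ⊗ₘ idₘ) ∘ₘ inc λ⁻¹)     ≈Q⟨ ∘-cong reflQ (∘-cong (whiskerˡ ρ) reflQ) ⟩
    inc φ ∘ₘ ((Γ , (ρ ⊗₁ id) ∘ α) ∘ₘ inc λ⁻¹)  ≈Q⟨ ∘-cong reflQ (pre _ _) ⟩
    inc φ ∘ₘ (Γ , ((ρ ⊗₁ id) ∘ α) ∘ (id ⊗₁ λ⁻¹))  ≈Q⟨ post _ _ ⟩
    (Γ , φ ∘ (((ρ ⊗₁ id) ∘ α) ∘ (id ⊗₁ λ⁻¹)))
      ≈Q⟨ body-cong (elimʳ (coherence {⌞ ty Γ ⌟ ⊠ ⌞ U ⌟}
            (((ρˢ ⊠ˢ idˢ) ∘ˢ αˢ) ∘ˢ (idˢ ⊠ˢ λ⁻ˢ)) idˢ)) ⟩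
    (Γ , φ) ∎Q)

  generated : (f : Mor U V) → Generated (quotient CXΣ R) Basic f
  generated (Γ , φ) = resp (symm (factor φ))
    (comp (basic (pure φ)) (comp (whisk (generated-names Γ)) (basic (pure λ⁻¹))))
    where
    generated-names : ∀ Γ → Generated (quotient CXΣ R) Basic (names Γ)
    generated-names []      = resp (body-cong (Eq.trans identityˡ λ≈ρ)) (basic (pure id))
    generated-names (f ∷ Γ) = resp (symm (names-∷ f Γ))
      (comp (basic (pure (join ⌜ f ⌝ Γ)))
        (comp (resp (symm (⊗-split _ _))
                 (comp (whisk (basic (name f))) (whisk′ (generated-names Γ))))
              (basic (pure λ⁻¹))))

  -- No other permutation is needed, since ≈ᴿ is a congruence for ⊗ and ∘.
  twist : Permutation 2 2
  twist = swapᵖ idᵖ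

  -- Disposes of the transport in `perm`: for `twist` both ends of `permute-tail` compute to the
  -- same one-element vector, and K makes the loop trivial.
  subst-loop : ∀ {a b} {A : Set a} (P : A → Set b) {y : A} (p : y ≡ y) (z : P y) →
               subst P p z ≡ z
  subst-loop P refl z = refl

  -- One genuine symmetry survives in `extract`. Coherence clears the unit isomorphisms on either
  -- side of it, and naturality of `ρ⁻¹` moves the last one across.
  perm-twist : ∀ f g → perm twist (f ∷ g ∷ []) ≈ σ
  perm-twist f g = begin
    perm twist (f ∷ g ∷ [])
      ≈⟨ ∘ʳ (∘ˡ (⊗ʳ (Eq.reflexive
           (subst-loop (λ Δ → Hom ⌜ f ⌝ (ty (toList Δ))) (permute-tail twist (f ∷ g ∷ [])) _)))) ⟩
    (ρ ∘ (α ∘ (id ⊗₁ ρ⁻¹))) ∘ ((id ⊗₁ (ρ ∘ ((id ⊗₁ id) ∘ ρ⁻¹))) ∘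
      ((id ⊗₁ ρ) ∘ (α⁻¹ ∘ ((σ ⊗₁ id) ∘ (α ∘ ((id ⊗₁ ρ⁻¹) ∘ ((id ⊗₁ ρ) ∘ (α⁻¹ ∘ ρ⁻¹))))))))
      ≈⟨ elimˡ (coherence {B ⊠ A} (ρˢ ∘ˢ (αˢ ∘ˢ (idˢ ⊠ˢ ρ⁻ˢ))) idˢ) ⟩
    (id ⊗₁ (ρ ∘ ((id ⊗₁ id) ∘ ρ⁻¹))) ∘
      ((id ⊗₁ ρ) ∘ (α⁻¹ ∘ ((σ ⊗₁ id) ∘ (α ∘ ((id ⊗₁ ρ⁻¹) ∘ ((id ⊗₁ ρ) ∘ (α⁻¹ ∘ ρ⁻¹)))))))
      ≈⟨ elimˡ (coherence {B ⊠ A} (idˢ ⊠ˢ (ρˢ ∘ˢ ((idˢ ⊠ˢ idˢ) ∘ˢ ρ⁻ˢ))) idˢ) ⟩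
    (id ⊗₁ ρ) ∘ (α⁻¹ ∘ ((σ ⊗₁ id) ∘ (α ∘ ((id ⊗₁ ρ⁻¹) ∘ ((id ⊗₁ ρ) ∘ (α⁻¹ ∘ ρ⁻¹))))))
      ≈⟨ ∘ʳ (∘ʳ (∘ʳ (coherence {A ⊠ B}
           (αˢ ∘ˢ ((idˢ ⊠ˢ ρ⁻ˢ) ∘ˢ ((idˢ ⊠ˢ ρˢ) ∘ˢ (α⁻ˢ ∘ˢ ρ⁻ˢ)))) ρ⁻ˢ))) ⟩
    (id ⊗₁ ρ) ∘ (α⁻¹ ∘ ((σ ⊗₁ id) ∘ ρ⁻¹))    ≈⟨ ∘ʳ (∘ʳ ρ⁻¹-natural) ⟨
    (id ⊗₁ ρ) ∘ (α⁻¹ ∘ (ρ⁻¹ ∘ σ))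
      ≈⟨ Eq.trans (Eq.trans (∘ʳ (Eq.sym assoc)) (Eq.sym assoc))
           (elimˡ (coherence {B ⊠ A} ((idˢ ⊠ˢ ρˢ) ∘ˢ (α⁻ˢ ∘ˢ ρ⁻ˢ)) idˢ)) ⟩
    σ ∎
    where
    A B : Expr
    A = ⌞ ⌜ f ⌝ ⌟
    B = ⌞ ⌜ g ⌝ ⌟

  names-⊗ : ∀ f g → names (f ∷ []) ⊗ₘ names (g ∷ []) Q.≈ ((f ∷ g ∷ []) , ρ ∘ (id ⊗₁ λ′))
  names-⊗ f g = body-cong (begin
    (ρ ⊗₁ ρ) ∘ (exchange ∘ (ty-++ (f ∷ []) (g ∷ []) ⊗₁ id))
      ≈⟨ ∘ʳ (elimʳ (Eq.trans (⊗ˡ (Eq.trans (ty-++-singleton f (g ∷ []))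
           (coherence {⌞ ⌜ f ⌝ ⌟ ⊠ ⌞ ⌜ g ⌝ ⌟} ((idˢ ⊠ˢ ρˢ) ∘ˢ (α⁻ˢ ∘ˢ ρ⁻ˢ)) idˢ))) ⊗-id)) ⟩
    (ρ ⊗₁ ρ) ∘ exchange  ≈⟨ exchange-unit ⟩
    ρ ∘ (id ⊗₁ λ′)       ∎)

  -- As `perm-twist` is σ, the relation `permuting` identifies `nf ⊗ₘ ng` with
  -- `inc σ ∘ₘ ((ng ⊗ₘ nf) ∘ₘ inc σ)`: the σ on the left undoes the twist, the one on the right acts
  -- on `I ⊗ I` and is the identity. Splitting `ng ⊗ₘ nf` and moving the symmetries inwards until
  -- they cancel gives the other order.
  names-commute : ∀ f g → Commute (quotient CXΣ R) (names (f ∷ [])) (names (g ∷ []))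
  names-commute f g =
    (nf ⊗ₘ idₘ) ∘ₘ (idₘ ⊗ₘ ng)              ≈Q⟨ ⊗-split nf ng ⟨
    nf ⊗ₘ ng                                ≈Q⟨ names-⊗ f g ⟩
    ((f ∷ g ∷ []) , ρ ∘ (id ⊗₁ λ′))
      ≈Q⟨ body-cong (begin
        (σ ∘ (ρ ∘ (id ⊗₁ λ′))) ∘ (perm twist (f ∷ g ∷ []) ⊗₁ id)
          ≈⟨ ∘ʳ (⊗ˡ (perm-twist f g)) ⟩
        (σ ∘ (ρ ∘ (id ⊗₁ λ′))) ∘ (σ ⊗₁ id)     ≈⟨ pullʳ (pullʳ (Eq.sym ⊗-interchange)) ⟩
        σ ∘ (ρ ∘ ((σ ⊗₁ id) ∘ (id ⊗₁ λ′)))     ≈⟨ ∘ʳ (extendʳ ρ-natural) ⟩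
        σ ∘ (σ ∘ (ρ ∘ (id ⊗₁ λ′)))             ≈⟨ cancelˡ σ-iso ⟩
        ρ ∘ (id ⊗₁ λ′)                         ∎) ⟨
    ((f ∷ g ∷ []) , (σ ∘ (ρ ∘ (id ⊗₁ λ′))) ∘ (perm twist (f ∷ g ∷ []) ⊗₁ id))
      ≈Q⟨ base (return (permuting (f ∷ g ∷ []) twist (σ ∘ (ρ ∘ (id ⊗₁ λ′))))) ⟨
    ((g ∷ f ∷ []) , σ ∘ (ρ ∘ (id ⊗₁ λ′)))
      ≈Q⟨ body-cong (∘ʳ (elimʳ (Eq.trans (⊗ʳ σ-unit) ⊗-id))) ⟨
    ((g ∷ f ∷ []) , σ ∘ ((ρ ∘ (id ⊗₁ λ′)) ∘ (id ⊗₁ σ)))  ≈Q⟨ post _ _ ⟨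
    inc σ ∘ₘ ((g ∷ f ∷ []) , (ρ ∘ (id ⊗₁ λ′)) ∘ (id ⊗₁ σ))  ≈Q⟨ ∘-cong reflQ (pre _ _) ⟨
    inc σ ∘ₘ (((g ∷ f ∷ []) , ρ ∘ (id ⊗₁ λ′)) ∘ₘ inc σ)
      ≈Q⟨ ∘-cong reflQ (∘-cong (names-⊗ g f) reflQ) ⟨
    inc σ ∘ₘ ((ng ⊗ₘ nf) ∘ₘ inc σ)
      ≈Q⟨ ∘-cong reflQ (transit (∘-cong (⊗-split ng nf) reflQ)
            (QC.assoc {f = inc σ} {idₘ ⊗ₘ nf} {ng ⊗ₘ idₘ})) ⟩
    inc σ ∘ₘ ((ng ⊗ₘ idₘ) ∘ₘ ((idₘ ⊗ₘ nf) ∘ₘ inc σ))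
      ≈Q⟨ QC.assoc {f = (idₘ ⊗ₘ nf) ∘ₘ inc σ} {ng ⊗ₘ idₘ} {inc σ} ⟨
    (inc σ ∘ₘ (ng ⊗ₘ idₘ)) ∘ₘ ((idₘ ⊗ₘ nf) ∘ₘ inc σ)
      ≈Q⟨ ∘-cong (σ-naturalˡ ng) (symm (σ-naturalˡ nf)) ⟩
    ((idₘ ⊗ₘ ng) ∘ₘ inc σ) ∘ₘ (inc σ ∘ₘ (nf ⊗ₘ idₘ))
      ≈Q⟨ QC.assoc {f = inc σ ∘ₘ (nf ⊗ₘ idₘ)} {inc σ} {idₘ ⊗ₘ ng} ⟩
    (idₘ ⊗ₘ ng) ∘ₘ (inc σ ∘ₘ (inc σ ∘ₘ (nf ⊗ₘ idₘ)))
      ≈Q⟨ ∘-cong reflQ (transit (symm (QC.assoc {f = nf ⊗ₘ idₘ} {inc σ} {inc σ}))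
            (transit (∘-cong (inc-iso σ-iso) reflQ) (QC.identityˡ {f = nf ⊗ₘ idₘ}))) ⟩
    (idₘ ⊗ₘ ng) ∘ₘ (nf ⊗ₘ idₘ)  ∎Q
    where
    module QC = IsCategory isCategory
    nf = names (f ∷ [])
    ng = names (g ∷ [])

  inc-≈² : {f : Hom U V} {g : Hom V W} {h : Hom U W} → g ∘ f ≈ h → inc g ∘ₘ inc f Q.≈ inc h
  inc-≈² p = transit (inc-∘ _ _) (inc-cong p)

  isPremonoidal : IsPremonoidal (quotient CXΣ R) Basic
  isPremonoidal = record
    { isCategory = isCategory
    ; ⊗-resp-≈ = ⊗-cong
    ; ⊸-resp-≈ = ⊸-cong
    ; ⊗-id = transit (∘-id⊗id) inc-id
    ; ⊗-split = λ {_} {_} {_} {_} {f} {g} → ⊗-split f g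
    ; whisk-∘ = λ {_} {_} {_} {_} {g} {f} → whisk-∘ g f
    ; α-isoˡ = inc-iso α-isoˡ
    ; α-isoʳ = inc-iso α-isoʳ
    ; λ-isoˡ = inc-iso λ-isoˡ
    ; λ-isoʳ = inc-iso λ-isoʳ
    ; ρ-isoˡ = inc-iso ρ-isoˡ
    ; ρ-isoʳ = inc-iso ρ-isoʳ
    ; σ-iso = inc-iso σ-iso
    ; pentagon = transit (inc-≈² pentagon) (symm (transit
        (∘-cong (inc-⊗ˡ α) (transit (∘-cong reflQ (inc-⊗ʳ α)) (inc-∘ _ _))) (inc-∘ _ _)))
    ; triangle = transit (∘-cong (inc-⊗ˡ ρ) reflQ)
        (transit (inc-≈² triangle) (symm (inc-⊗ʳ λ′)))
    ; hexagon = transit (∘-cong reflQ (inc-∘ _ _)) (transit (inc-≈² hexagon) (symm (transit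
        (∘-cong (inc-⊗ˡ σ) (transit (∘-cong reflQ (inc-⊗ʳ σ)) (inc-∘ _ _))) (inc-∘ _ _))))
    ; ρ-σ = inc-≈² (Eq.trans (∘ʳ σ-unitˡ) (cancelˡ ρ-isoʳ))
    ; zig = transit (∘-cong reflQ (inc-⊗ˡ η)) (inc-iso zig)
    ; ρ-natural = λ {_} {_} {f} → ρ-naturalₘ f
    ; σ-naturalˡ = λ {_} {_} {_} {f} → σ-naturalˡ f
    ; α-naturalˡ = λ {_} {_} {_} {_} {f} → α-naturalˡ f
    ; σ-central = inc-central σ
    ; basic-commute = basic-commute
    ; generated = generated
    ; ⊸-β = λ {_} {_} {_} {_} {f} {g} → curryₘ-β (g ∘ₘ (inc ε ∘ₘ (idₘ ⊗ₘ f)))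
    ; ⊸-η = λ {_} {_} {_} {h} → curryₘ-η h
    }
    where
    ∘-id⊗id : idₘ {U} ⊗ₘ idₘ {V} Q.≈ inc id
    ∘-id⊗id = transit (⊗-cong reflQ (symm inc-id)) (transit (inc-⊗ʳ id) (inc-cong ⊗-id))

    -- The mirror image of `inc-central`. It is proved directly because `commute-sym` presupposes
    -- the structure under construction.
    commute-pure : (f : Hom U V) (g : Mor U′ V′) → Commute (quotient CXΣ R) (inc f) g
    commute-pure f (Γ , φ) =
      (inc f ⊗ₘ idₘ) ∘ₘ (idₘ ⊗ₘ (Γ , φ))           ≈Q⟨ ∘-cong (inc-⊗ˡ f) (whiskerʳ φ) ⟩
      inc (f ⊗₁ id) ∘ₘ (Γ , (id ⊗₁ φ) ∘ swap)      ≈Q⟨ post _ _ ⟩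
      (Γ , (f ⊗₁ id) ∘ ((id ⊗₁ φ) ∘ swap))
        ≈Q⟨ body-cong (Eq.trans (extendʳ ⊗-interchange)
             (Eq.trans (∘ʳ (Eq.trans (∘ˡ (⊗ʳ (Eq.sym ⊗-id))) (Eq.sym swap-natural))) (Eq.sym assoc))) ⟩
      (Γ , ((id ⊗₁ φ) ∘ swap) ∘ (id ⊗₁ (f ⊗₁ id)))  ≈Q⟨ pre _ _ ⟨
      (Γ , (id ⊗₁ φ) ∘ swap) ∘ₘ inc (f ⊗₁ id)      ≈Q⟨ ∘-cong (whiskerʳ φ) (inc-⊗ˡ f) ⟨
      (idₘ ⊗ₘ (Γ , φ)) ∘ₘ (inc f ⊗ₘ idₘ)           ∎Q

    basic-commute : {f : Mor U V} {g : Mor U′ V′} → Basic f → Basic g →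
                    Commute (quotient CXΣ R) f g
    basic-commute p        (pure g) = inc-central g _
    basic-commute (pure f) (name g) = commute-pure f _
    basic-commute (name f) (name g) = names-commute f g

  quotient-isSMC : IsSMC (quotient CXΣ R)
  quotient-isSMC = Premonoidal.isSMC isPremonoidal

-- Morphisms with a context as derived terms.

module Reading {x s} (S : Signature x s) where
  open Signature S
  open CXΣ S

  embed : ∀ {a b} → Free._⇒_ X a b → DerivedTerm S a b
  embed αₜ       = αₜ
  embed α⁻¹ₜ     = α⁻¹ₜ
  embed λₜ       = λₜ
  embed λ⁻¹ₜ     = λ⁻¹ₜ
  embed ρₜ       = ρₜ
  embed ρ⁻¹ₜ     = ρ⁻¹ₜ
  embed σₜ       = σₜ
  embed εₜ       = εₜ
  embed ηₜ       = ηₜ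
  embed idₜ      = idₜ
  embed (g ∘ₜ f) = embed g ∘ₜ embed f
  embed (f ⊗ₜ g) = embed f ⊗ₜ embed g
  embed (f ⊸ₜ g) = embed f ⊸ₜ embed g

  nameₜ : ∀ g → DerivedTerm S I ⌜ g ⌝
  nameₜ g = (idₜ ⊸ₜ (gen (g , refl , refl) ∘ₜ λₜ)) ∘ₜ ηₜ

  namesₜ : ∀ Γ → DerivedTerm S I (ty Γ)
  namesₜ []      = idₜ
  namesₜ (f ∷ Γ) = embed (join ⌜ f ⌝ Γ) ∘ₜ ((nameₜ f ⊗ₜ namesₜ Γ) ∘ₜ λ⁻¹ₜ)

  -- The syntactic counterpart of `factor`. It depends on the representative; independence is shown
  -- only after evaluation.
  read : ∀ {U V} → Mor U V → DerivedTerm S U V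
  read (Γ , φ) = embed φ ∘ₜ ((namesₜ Γ ⊗ₜ idₜ) ∘ₜ λ⁻¹ₜ)

module DenoteRead {x s p} (S : Signature x s)
                  (R : ∀ {a b} → CXΣ.Mor S a b → CXΣ.Mor S a b → Set p) where
  open Signature S
  open CXΣ S
  open SMC (freeSMC X)
  open SMCProperties (freeSMC X)
  open SymmetricProperties (freeSMC X)
  open Reading S
  open Quotient S R hiding (isCategory)
  open Premonoidal isPremonoidal using (ε-injective; ε-transpose)
  private
    module Q = RawSMC (quotient CXΣ R)
    module P = IsPremonoidal isPremonoidal

  inc-⊗ : ∀ {a b c d} (f : Hom a b) (g : Hom c d) → inc f ⊗ₘ inc g Q.≈ inc (f ⊗₁ g)
  inc-⊗ f g = transit (⊗-split (inc f) (inc g)) (transit (∘-cong (inc-⊗ˡ f) (inc-⊗ʳ g))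
    (transit (inc-∘ _ _) (inc-cong (Eq.sym ⊗-serialize₁₂))))

  inc-⊸ : ∀ {a b c d} (f : Hom a b) (g : Hom c d) → inc f ⊸ₘ inc g Q.≈ inc (f ⊸₁ g)
  inc-⊸ f g = ε-injective {h = inc f ⊸ₘ inc g} {k = inc (f ⊸₁ g)} (
    inc ε ∘ₘ ((inc f ⊸ₘ inc g) ⊗ₘ idₘ)     ≈Q⟨ P.⊸-β {f = inc f} {g = inc g} ⟩
    inc g ∘ₘ (inc ε ∘ₘ (idₘ ⊗ₘ inc f))
      ≈Q⟨ ∘-cong reflQ (transit (∘-cong reflQ (inc-⊗ʳ f)) (inc-∘ _ _)) ⟩
    inc g ∘ₘ inc (ε ∘ (id ⊗₁ f))           ≈Q⟨ inc-∘ _ _ ⟩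
    inc (g ∘ (ε ∘ (id ⊗₁ f)))              ≈Q⟨ inc-cong ε-⊸ ⟨
    inc (ε ∘ ((f ⊸₁ g) ⊗₁ id))             ≈Q⟨ inc-∘ _ _ ⟨
    inc ε ∘ₘ inc ((f ⊸₁ g) ⊗₁ id)          ≈Q⟨ ∘-cong reflQ (inc-⊗ˡ _) ⟨
    inc ε ∘ₘ (inc (f ⊸₁ g) ⊗ₘ idₘ)         ∎Q)

  denote-embed : ∀ {a b} (φ : Hom a b) → denote (embed φ) Q.≈ inc φ
  denote-embed αₜ       = reflQ
  denote-embed α⁻¹ₜ     = reflQ
  denote-embed λₜ       = reflQ
  denote-embed λ⁻¹ₜ     = reflQ
  denote-embed ρₜ       = reflQ
  denote-embed ρ⁻¹ₜ     = reflQ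
  denote-embed σₜ       = reflQ
  denote-embed εₜ       = reflQ
  denote-embed ηₜ       = reflQ
  denote-embed idₜ      = symm inc-id
  denote-embed (g ∘ₜ f) = transit (∘-cong (denote-embed g) (denote-embed f)) (inc-∘ g f)
  denote-embed (f ⊗ₜ g) = transit (⊗-cong (denote-embed f) (denote-embed g)) (inc-⊗ f g)
  denote-embed (f ⊸ₜ g) = transit (⊸-cong (denote-embed f) (denote-embed g)) (inc-⊸ f g)

  -- After evaluation both sides become the operation preceded by `λ′`: on the left by
  -- `ε-transpose`, on the right by the triangle.
  denote-name : ∀ g → denote (nameₜ g) Q.≈ names (g ∷ [])
  denote-name g = ε-injective {h = denote (nameₜ g)} {k = names (g ∷ [])} (
    inc ε ∘ₘ (((idₘ ⊸ₘ (op ∘ₘ inc λ′)) ∘ₘ inc η) ⊗ₘ idₘ)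
      ≈Q⟨ ε-transpose {f = idₘ} {g = op ∘ₘ inc λ′} ⟩
    (op ∘ₘ inc λ′) ∘ₘ (idₘ ⊗ₘ idₘ)
      ≈Q⟨ transit (∘-cong reflQ P.⊗-id) (IsCategory.identityʳ P.isCategory {f = op ∘ₘ inc λ′}) ⟩
    op ∘ₘ inc λ′                               ≈Q⟨ pre _ _ ⟩
    ((g ∷ []) , ε ∘ (id ⊗₁ λ′))                ≈Q⟨ body-cong (∘ʳ triangle) ⟨
    ((g ∷ []) , ε ∘ ((ρ ⊗₁ id) ∘ α))           ≈Q⟨ post _ _ ⟨
    inc ε ∘ₘ ((g ∷ []) , (ρ ⊗₁ id) ∘ α)        ≈Q⟨ ∘-cong reflQ (whiskerˡ ρ) ⟨
    inc ε ∘ₘ (names (g ∷ []) ⊗ₘ idₘ)           ∎Q)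
    where
    op : Mor (src g) (tgt g)
    op = (g ∷ []) , ε

  denote-names : ∀ Γ → denote (namesₜ Γ) Q.≈ names Γ
  denote-names []      = body-cong λ≈ρ
  denote-names (f ∷ Γ) = transit
    (∘-cong (denote-embed (join ⌜ f ⌝ Γ)) (∘-cong (⊗-cong (denote-name f) (denote-names Γ)) reflQ))
    (symm (names-∷ f Γ))

  denote-read : ∀ {U V} (f : Mor U V) → denote (read f) Q.≈ f
  denote-read (Γ , φ) = transit
    (∘-cong (denote-embed φ) (∘-cong (⊗-cong (denote-names Γ) reflQ) reflQ))
    (symm (factor φ))

-- Evaluation of morphisms in an SMC category

module Evaluation {x s o ℓ r} (S : Signature x s) (D : SMC o ℓ r) (obj : Signature.X S → SMC.Ob D)
  (op : ∀ {a b} → Signature._⟶_ S a b → SMC.Hom D (extOb D obj a) (extOb D obj b)) where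
  open Signature S
  open CXΣ S hiding (interchange)
  open Contexts S
  open Reading S
  open SMC D
  open SMCProperties D
  open SymmetricProperties D
  private
    module Cₓ = Free X

  ⟪_⟫ : ∀ {a b} → DerivedTerm S a b → Hom (extOb D obj a) (extOb D obj b)
  ⟪ u ⟫ = extHom D obj op u

  ⟪embed⟫-resp : ∀ {a b} {φ ψ : a Cₓ.⇒ b} → φ Cₓ.≈ ψ → ⟪ embed φ ⟫ ≈ ⟪ embed ψ ⟫
  ⟪embed⟫-resp Cₓ.≈-refl        = Eq.refl
  ⟪embed⟫-resp (Cₓ.≈-sym p)     = Eq.sym (⟪embed⟫-resp p)
  ⟪embed⟫-resp (Cₓ.≈-trans p q) = Eq.trans (⟪embed⟫-resp p) (⟪embed⟫-resp q)
  ⟪embed⟫-resp (Cₓ.∘-resp-≈ p q) = ∘-resp-≈ (⟪embed⟫-resp p) (⟪embed⟫-resp q)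
  ⟪embed⟫-resp (Cₓ.⊗-resp-≈ p q) = ⊗-resp-≈ (⟪embed⟫-resp p) (⟪embed⟫-resp q)
  ⟪embed⟫-resp (Cₓ.⊸-resp-≈ p q) = ⊸-resp-≈ (⟪embed⟫-resp p) (⟪embed⟫-resp q)
  ⟪embed⟫-resp Cₓ.identityˡ = identityˡ
  ⟪embed⟫-resp Cₓ.identityʳ = identityʳ
  ⟪embed⟫-resp Cₓ.assoc     = assoc
  ⟪embed⟫-resp Cₓ.⊗-id      = ⊗-id
  ⟪embed⟫-resp Cₓ.⊗-∘       = ⊗-∘
  ⟪embed⟫-resp Cₓ.⊸-id      = ⊸-id
  ⟪embed⟫-resp Cₓ.⊸-∘       = ⊸-∘
  ⟪embed⟫-resp Cₓ.α-isoˡ    = α-isoˡ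
  ⟪embed⟫-resp Cₓ.α-isoʳ    = α-isoʳ
  ⟪embed⟫-resp Cₓ.λ-isoˡ    = λ-isoˡ
  ⟪embed⟫-resp Cₓ.λ-isoʳ    = λ-isoʳ
  ⟪embed⟫-resp Cₓ.ρ-isoˡ    = ρ-isoˡ
  ⟪embed⟫-resp Cₓ.ρ-isoʳ    = ρ-isoʳ
  ⟪embed⟫-resp Cₓ.σ-iso     = σ-iso
  ⟪embed⟫-resp Cₓ.α-natural = α-natural
  ⟪embed⟫-resp Cₓ.λ-natural = λ-natural
  ⟪embed⟫-resp Cₓ.ρ-natural = ρ-natural
  ⟪embed⟫-resp Cₓ.σ-natural = σ-natural
  ⟪embed⟫-resp Cₓ.pentagon  = pentagon
  ⟪embed⟫-resp Cₓ.triangle  = triangle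
  ⟪embed⟫-resp Cₓ.hexagon   = hexagon
  ⟪embed⟫-resp Cₓ.ε-natural = ε-natural
  ⟪embed⟫-resp Cₓ.ε-extra   = ε-extra
  ⟪embed⟫-resp Cₓ.η-natural = η-natural
  ⟪embed⟫-resp Cₓ.η-extra   = η-extra
  ⟪embed⟫-resp Cₓ.zig       = zig
  ⟪embed⟫-resp Cₓ.zag       = zag

  point : ∀ Γ → Hom unit (extOb D obj (ty Γ))
  point Γ = ⟪ namesₜ Γ ⟫

  split-point : ∀ f Γ → ⟪ embed (split ⌜ f ⌝ Γ) ⟫ ∘ point (f ∷ Γ) ≈ (⟪ nameₜ f ⟫ ⊗₁ point Γ) ∘ λ⁻¹
  split-point f Γ = cancelˡ (⟪embed⟫-resp (split-join ⌜ f ⌝ Γ))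

  ⊗-point : ∀ {a b c d} {f : Hom a b} {g : Hom unit c} {k : Hom c d} {n : Hom unit a} →
            (f ⊗₁ k) ∘ ((n ⊗₁ g) ∘ λ⁻¹) ≈ ((f ∘ n) ⊗₁ (k ∘ g)) ∘ λ⁻¹
  ⊗-point = pullˡ merge

  α-point : ∀ {a b c} {n : Hom unit a} {m : Hom unit b} {k : Hom unit c} →
            α ∘ ((n ⊗₁ ((m ⊗₁ k) ∘ λ⁻¹)) ∘ λ⁻¹) ≈ (((n ⊗₁ m) ∘ λ⁻¹) ⊗₁ k) ∘ λ⁻¹
  α-point {n = n} {m} {k} = begin
    α ∘ ((n ⊗₁ ((m ⊗₁ k) ∘ λ⁻¹)) ∘ λ⁻¹)
      ≈⟨ ∘ʳ (pushˡ (Eq.trans (⊗-resp-≈ (Eq.sym identityʳ) Eq.refl) ⊗-∘)) ⟩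
    α ∘ ((n ⊗₁ (m ⊗₁ k)) ∘ ((id ⊗₁ λ⁻¹) ∘ λ⁻¹))     ≈⟨ extendʳ α-natural ⟩
    ((n ⊗₁ m) ⊗₁ k) ∘ (α ∘ ((id ⊗₁ λ⁻¹) ∘ λ⁻¹))
      ≈⟨ ∘ʳ (coherence {𝟙} (αˢ ∘ˢ ((idˢ ⊠ˢ λ⁻ˢ) ∘ˢ λ⁻ˢ)) ((λ⁻ˢ ⊠ˢ idˢ) ∘ˢ λ⁻ˢ)) ⟩
    ((n ⊗₁ m) ⊗₁ k) ∘ ((λ⁻¹ ⊗₁ id) ∘ λ⁻¹)           ≈⟨ pullˡ (Eq.trans merge (⊗ʳ identityʳ)) ⟩
    (((n ⊗₁ m) ∘ λ⁻¹) ⊗₁ k) ∘ λ⁻¹                   ∎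

  α⁻¹-point : ∀ {a b c} {n : Hom unit a} {m : Hom unit b} {k : Hom unit c} →
              α⁻¹ ∘ ((((n ⊗₁ m) ∘ λ⁻¹) ⊗₁ k) ∘ λ⁻¹) ≈ (n ⊗₁ ((m ⊗₁ k) ∘ λ⁻¹)) ∘ λ⁻¹
  α⁻¹-point = Eq.trans (∘ʳ (Eq.sym α-point)) (cancelˡ α-isoˡ)

  -- By naturality the symmetry is left acting on `unit ⊗₀ unit`. Hence permutations of contexts can
  -- be followed through their effect on points.
  σ-point : ∀ {a b} {n : Hom unit a} {m : Hom unit b} →
            σ ∘ ((n ⊗₁ m) ∘ λ⁻¹) ≈ (m ⊗₁ n) ∘ λ⁻¹
  σ-point = Eq.trans (extendʳ σ-natural) (∘ʳ (elimˡ σ-unit))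

  -- Supplies the hypothesis of `eval-∘` and `eval-⊗`: the point of a concatenated context splits
  -- into the points of its parts.
  ty-++-point : ∀ Γ Δ → ⟪ embed (ty-++ Γ Δ) ⟫ ∘ point (Γ ++ Δ) ≈ (point Γ ⊗₁ point Δ) ∘ λ⁻¹
  ty-++-point []      Δ = λ⁻¹-natural
  ty-++-point (f ∷ Γ) Δ = begin
    ((j ⊗₁ id) ∘ (α ∘ ((id ⊗₁ ⟪ embed (ty-++ Γ Δ) ⟫) ∘ ⟪ embed (split ⌜ f ⌝ (Γ ++ Δ)) ⟫)))
      ∘ point (f ∷ Γ ++ Δ)
      ≈⟨ pullʳ (pullʳ (pullʳ (split-point f (Γ ++ Δ)))) ⟩
    (j ⊗₁ id) ∘ (α ∘ ((id ⊗₁ ⟪ embed (ty-++ Γ Δ) ⟫) ∘ ((n ⊗₁ point (Γ ++ Δ)) ∘ λ⁻¹)))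
      ≈⟨ ∘ʳ (∘ʳ (Eq.trans ⊗-point (∘ˡ (⊗-resp-≈ identityˡ (ty-++-point Γ Δ))))) ⟩
    (j ⊗₁ id) ∘ (α ∘ ((n ⊗₁ ((point Γ ⊗₁ point Δ) ∘ λ⁻¹)) ∘ λ⁻¹))
      ≈⟨ ∘ʳ α-point ⟩
    (j ⊗₁ id) ∘ ((((n ⊗₁ point Γ) ∘ λ⁻¹) ⊗₁ point Δ) ∘ λ⁻¹)
      ≈⟨ Eq.trans ⊗-point (∘ˡ (⊗ʳ identityˡ)) ⟩
    (point (f ∷ Γ) ⊗₁ point Δ) ∘ λ⁻¹ ∎
    where
    j = ⟪ embed (join ⌜ f ⌝ Γ) ⟫
    n = ⟪ nameₜ f ⟫

  extract-point : ∀ {n} (Γ : Vec Op (suc n)) i →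
    ⟪ embed (extract Γ i) ⟫ ∘ point (toList Γ) ≈
    (⟪ nameₜ (lookup Γ i) ⟫ ⊗₁ point (toList (removeAt Γ i))) ∘ λ⁻¹
  extract-point (f ∷ Γ)         zero    = split-point f (toList Γ)
  extract-point (f ∷ Γ@(_ ∷ _)) (suc i) = begin
    ((id ⊗₁ j) ∘ (α⁻¹ ∘ ((σ ⊗₁ id) ∘ (α ∘ ((id ⊗₁ e) ∘ ⟪ embed (split ⌜ f ⌝ (toList Γ)) ⟫)))))
      ∘ point (f ∷ toList Γ)
      ≈⟨ pullʳ (pullʳ (pullʳ (pullʳ (pullʳ (split-point f (toList Γ)))))) ⟩
    (id ⊗₁ j) ∘ (α⁻¹ ∘ ((σ ⊗₁ id) ∘ (α ∘ ((id ⊗₁ e) ∘ ((n ⊗₁ point (toList Γ)) ∘ λ⁻¹)))))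
      ≈⟨ ∘ʳ (∘ʳ (∘ʳ (∘ʳ (Eq.trans ⊗-point (∘ˡ (⊗-resp-≈ identityˡ (extract-point Γ i))))))) ⟩
    (id ⊗₁ j) ∘ (α⁻¹ ∘ ((σ ⊗₁ id) ∘ (α ∘ ((n ⊗₁ ((m ⊗₁ k) ∘ λ⁻¹)) ∘ λ⁻¹))))
      ≈⟨ ∘ʳ (∘ʳ (∘ʳ α-point)) ⟩
    (id ⊗₁ j) ∘ (α⁻¹ ∘ ((σ ⊗₁ id) ∘ ((((n ⊗₁ m) ∘ λ⁻¹) ⊗₁ k) ∘ λ⁻¹)))
      ≈⟨ ∘ʳ (∘ʳ (Eq.trans ⊗-point (∘ˡ (⊗-resp-≈ σ-point identityˡ)))) ⟩
    (id ⊗₁ j) ∘ (α⁻¹ ∘ ((((m ⊗₁ n) ∘ λ⁻¹) ⊗₁ k) ∘ λ⁻¹))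
      ≈⟨ ∘ʳ α⁻¹-point ⟩
    (id ⊗₁ j) ∘ ((m ⊗₁ ((n ⊗₁ k) ∘ λ⁻¹)) ∘ λ⁻¹)
      ≈⟨ Eq.trans ⊗-point (∘ˡ (⊗ˡ identityˡ)) ⟩
    (m ⊗₁ point (f ∷ toList (removeAt Γ i))) ∘ λ⁻¹ ∎
    where
    j = ⟪ embed (join ⌜ f ⌝ (toList (removeAt Γ i))) ⟫
    e = ⟪ embed (extract Γ i) ⟫
    n = ⟪ nameₜ f ⟫
    m = ⟪ nameₜ (lookup Γ i) ⟫
    k = point (toList (removeAt Γ i))

  subst-point : ∀ {n} {Γ} {Δ Θ : Vec Op n} (p : Δ ≡ Θ) (f : ty Γ Cₓ.⇒ ty (toList Δ)) →
                ⟪ embed f ⟫ ∘ point Γ ≈ point (toList Δ) →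
                ⟪ embed (subst (λ Δ → ty Γ Cₓ.⇒ ty (toList Δ)) p f) ⟫ ∘ point Γ ≈ point (toList Θ)
  subst-point refl f q = q

  -- Follows the recursion of `perm`: `extract-point` brings one name to the front and induction
  -- arranges the others. It makes the two sides of `permuting` the same body evaluated at the same
  -- point.
  perm-point : ∀ {n} (π : Permutation n n) (Γ : Vec Op n) →
               ⟪ embed (perm π Γ) ⟫ ∘ point (toList Γ) ≈ point (toList (permute π Γ))
  perm-point {zero}  π []        = identityˡ
  perm-point {suc n} π Γ@(_ ∷ _) = Eq.trans
    (pullʳ (pullʳ (extract-point Γ j)))
    (∘ʳ (Eq.trans ⊗-point (∘ˡ (⊗-resp-≈ identityˡ
      (subst-point {Γ = toList (removeAt Γ j)} (permute-tail π Γ) (perm (remove zero π) (removeAt Γ j))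
        (perm-point (remove zero π) (removeAt Γ j)))))))
    where j = π ⟨$⟩ʳ zero

  eval : ∀ {U V} → Mor U V → Hom (extOb D obj U) (extOb D obj V)
  eval f = ⟪ read f ⟫

  eval-inc : ∀ {U V} (φ : U Cₓ.⇒ V) → eval (inc φ) ≈ ⟪ embed φ ⟫
  eval-inc φ = Eq.trans (pullʳ (∘ʳ (elimˡ ⊗-id))) (elimʳ λ-isoʳ)

  eval-id : ∀ {U} → eval (idₘ {U}) ≈ id
  eval-id = Eq.trans (∘ʳ (elimˡ ⊗-id)) λ-isoʳ

  eval-∘ₘ : ∀ {U V W} (g : Mor V W) (f : Mor U V) → eval (g ∘ₘ f) ≈ eval g ∘ eval f
  eval-∘ₘ (Δ , ψ) (Γ , φ) = eval-∘ (ty-++-point Δ Γ)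

  eval-⊗ₘ : ∀ {U V U′ V′} (f : Mor U V) (g : Mor U′ V′) → eval (f ⊗ₘ g) ≈ eval f ⊗₁ eval g
  eval-⊗ₘ (Γ , φ) (Δ , ψ) = eval-⊗ (ty-++-point Γ Δ)

  -- Since `f ⊸ₘ g` is a transpose, the body under it is evaluated by the cases of composition and
  -- tensor. `ε-⊸` recognises the result as ε after `eval f ⊸₁ eval g`, and `curry-ε` removes the
  -- transposition.
  eval-⊸ₘ : ∀ {U V U′ V′} (f : Mor U V) (g : Mor U′ V′) → eval (f ⊸ₘ g) ≈ eval f ⊸₁ eval g
  eval-⊸ₘ {V = V} {U′} f g = begin
    eval (f ⊸ₘ g)                                    ≈⟨ eval-curry ⟩
    (id ⊸₁ eval (g ∘ₘ (inc e ∘ₘ (idf ⊗ₘ f)))) ∘ η   ≈⟨ ∘ˡ (⊸-resp-≈ Eq.refl (begin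
      eval (g ∘ₘ (inc e ∘ₘ (idf ⊗ₘ f)))             ≈⟨ eval-∘ₘ g (inc e ∘ₘ (idf ⊗ₘ f)) ⟩
      eval g ∘ eval (inc e ∘ₘ (idf ⊗ₘ f))           ≈⟨ ∘ʳ (eval-∘ₘ (inc e) (idf ⊗ₘ f)) ⟩
      eval g ∘ (eval (inc e) ∘ eval (idf ⊗ₘ f))
        ≈⟨ ∘ʳ (∘-resp-≈ (eval-inc e) (Eq.trans (eval-⊗ₘ idf f) (⊗ˡ (eval-id {V ⊸ U′})))) ⟩
      eval g ∘ (ε ∘ (id ⊗₁ eval f))                  ≈⟨ ε-⊸ ⟨
      ε ∘ ((eval f ⊸₁ eval g) ⊗₁ id)                 ∎)) ⟩
    (id ⊸₁ (ε ∘ ((eval f ⊸₁ eval g) ⊗₁ id))) ∘ η     ≈⟨ curry-ε ⟩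
    eval f ⊸₁ eval g                                 ∎
    where
    e : ((V ⊸ U′) ⊗ V) Cₓ.⇒ U′
    e = εₜ
    idf : Mor (V ⊸ U′) (V ⊸ U′)
    idf = idₘ

  eval-↝ : ∀ {U V} {f g : Mor U V} → f ↝ g → eval f ≈ eval g
  eval-↝ (bodies p)         = ∘ˡ (⟪embed⟫-resp p)
  eval-↝ (permuting Γ π φ) = begin
    ⟪ embed φ ⟫ ∘ ((point (toList (permute π Γ)) ⊗₁ id) ∘ λ⁻¹)
      ≈⟨ ∘ʳ (∘ˡ (Eq.trans merge₁ (⊗ˡ (perm-point π Γ)))) ⟨
    ⟪ embed φ ⟫ ∘ (((⟪ embed (perm π Γ) ⟫ ⊗₁ id) ∘ (point (toList Γ) ⊗₁ id)) ∘ λ⁻¹)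
      ≈⟨ Eq.trans (∘ʳ assoc) (Eq.sym assoc) ⟩
    (⟪ embed φ ⟫ ∘ (⟪ embed (perm π Γ) ⟫ ⊗₁ id)) ∘ ((point (toList Γ) ⊗₁ id) ∘ λ⁻¹) ∎

  eval-∼ : ∀ {U V} {f g : Mor U V} → f ∼ g → eval f ≈ eval g
  eval-∼ []            = Eq.refl
  eval-∼ (fwd p ◅ ps) = Eq.trans (eval-↝ p) (eval-∼ ps)
  eval-∼ (bwd p ◅ ps) = Eq.trans (Eq.sym (eval-↝ p)) (eval-∼ ps)

  eval-op : ∀ {a b} (f : a ⟶ b) → eval (opₘ f) ≈ op f
  eval-op t@(f , refl , refl) = begin
    ε ∘ (((ρ ∘ ((n ⊗₁ id) ∘ λ⁻¹)) ⊗₁ id) ∘ λ⁻¹)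
      ≈⟨ ∘ʳ (∘ˡ (⊗ˡ (Eq.trans (extendʳ ρ-natural) (elimʳ (coherence {𝟙} (ρˢ ∘ˢ λ⁻ˢ) idˢ))))) ⟩
    ε ∘ ((n ⊗₁ id) ∘ λ⁻¹)   ≈⟨ pullˡ ε-curry ⟩
    (op t ∘ λ′) ∘ λ⁻¹       ≈⟨ cancelʳ λ-isoʳ ⟩
    op t                    ∎
    where n = ⟪ nameₜ f ⟫

  -- Evaluation preserves every term constructor, and on an operation ε undoes the transposition in
  -- `nameₜ`. Through this an equation of the theory becomes an equality of evaluations.
  eval-denote : ∀ {a b} (u : DerivedTerm S a b) → eval (denote u) ≈ ⟪ u ⟫
  eval-denote (gen f)  = eval-op f
  eval-denote (αₜ {a = a} {b} {c}) = eval-inc (αₜ {a = a} {b} {c})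
  eval-denote (α⁻¹ₜ {a = a} {b} {c}) = eval-inc (α⁻¹ₜ {a = a} {b} {c})
  eval-denote (λₜ {a = a}) = eval-inc (λₜ {a = a})
  eval-denote (λ⁻¹ₜ {a = a}) = eval-inc (λ⁻¹ₜ {a = a})
  eval-denote (ρₜ {a = a}) = eval-inc (ρₜ {a = a})
  eval-denote (ρ⁻¹ₜ {a = a}) = eval-inc (ρ⁻¹ₜ {a = a})
  eval-denote (σₜ {a = a} {b}) = eval-inc (σₜ {a = a} {b})
  eval-denote (εₜ {a = a} {b}) = eval-inc (εₜ {a = a} {b})
  eval-denote (ηₜ {a = a} {b}) = eval-inc (ηₜ {a = a} {b})
  eval-denote (idₜ {a = a}) = eval-id {a}
  eval-denote (g ∘ₜ f) = Eq.trans
    (eval-∘ₘ (denote g) (denote f))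
    (∘-resp-≈ (eval-denote g) (eval-denote f))
  eval-denote (f ⊗ₜ g) = Eq.trans
    (eval-⊗ₘ (denote f) (denote g))
    (⊗-resp-≈ (eval-denote f) (eval-denote g))
  eval-denote (f ⊸ₜ g) = Eq.trans
    (eval-⊸ₘ (denote f) (denote g))
    (⊸-resp-≈ (eval-denote f) (eval-denote g))

-- Dependence of the extension to terms on the interpretation.

module Transport {o ℓ r} (D : SMC o ℓ r) where
  open SMC D
  open HeterogeneousProperties D

  cong₁-≋ : {t u : Ob → Ob} (f : ∀ a → Hom (t a) (u a)) →
            ∀ {a a′} → a ≡ a′ → f a ≋ f a′
  cong₁-≋ f refl = ≋-refl

  cong₂-≋ : {t u : Ob → Ob → Ob} (f : ∀ a b → Hom (t a b) (u a b)) →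
            ∀ {a a′ b b′} → a ≡ a′ → b ≡ b′ → f a b ≋ f a′ b′
  cong₂-≋ f refl refl = ≋-refl

  cong₃-≋ : {t u : Ob → Ob → Ob → Ob} (f : ∀ a b c → Hom (t a b c) (u a b c)) →
            ∀ {a a′ b b′ c c′} → a ≡ a′ → b ≡ b′ → c ≡ c′ → f a b c ≋ f a′ b′ c′
  cong₃-≋ f refl refl refl = ≋-refl

  module _ {x} {X : Set x} {F F′ : X → Ob} (F≡F′ : ∀ v → F v ≡ F′ v) where

    extOb-cong : ∀ a → extOb D F a ≡ extOb D F′ a
    extOb-cong (var v) = F≡F′ v
    extOb-cong I       = refl
    extOb-cong (a ⊗ b) = cong₂ _⊗₀_ (extOb-cong a) (extOb-cong b)
    extOb-cong (a ⊸ b) = cong₂ _⊸₀_ (extOb-cong a) (extOb-cong b)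

    private e = extOb-cong

    module _ {g} {G : Ty X → Ty X → Set g}
             (h : ∀ {a b} → G a b → Hom (extOb D F a) (extOb D F b))
             (h′ : ∀ {a b} → G a b → Hom (extOb D F′ a) (extOb D F′ b))
             (h≋h′ : ∀ {a b} (f : G a b) → h f ≋ h′ f) where

      -- The objects at the two ends are equal only through `extOb-cong`, so each structure map is
      -- treated as a family over objects and moved along these equalities.
      extHom-cong : ∀ {a b} (u : Term G a b) → extHom D F h u ≋ extHom D F′ h′ u
      extHom-cong (gen f)              = h≋h′ f
      extHom-cong (αₜ {a = a} {b} {c})   = cong₃-≋ (λ a b c → α {a} {b} {c}) (e a) (e b) (e c)
      extHom-cong (α⁻¹ₜ {a = a} {b} {c}) = cong₃-≋ (λ a b c → α⁻¹ {a} {b} {c}) (e a) (e b) (e c)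
      extHom-cong (λₜ {a = a})         = cong₁-≋ (λ a → λ′ {a}) (e a)
      extHom-cong (λ⁻¹ₜ {a = a})       = cong₁-≋ (λ a → λ⁻¹ {a}) (e a)
      extHom-cong (ρₜ {a = a})         = cong₁-≋ (λ a → ρ {a}) (e a)
      extHom-cong (ρ⁻¹ₜ {a = a})       = cong₁-≋ (λ a → ρ⁻¹ {a}) (e a)
      extHom-cong (σₜ {a = a} {b})     = cong₂-≋ (λ a b → σ {a} {b}) (e a) (e b)
      extHom-cong (εₜ {a = a} {b})     = cong₂-≋ (λ a b → ε {a} {b}) (e a) (e b)
      extHom-cong (ηₜ {a = a} {b})     = cong₂-≋ (λ a b → η {a} {b}) (e a) (e b)
      extHom-cong (idₜ {a = a})        = cong₁-≋ (λ a → id {a}) (e a)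
      extHom-cong (g ∘ₜ f)             = ∘-resp-≋ (extHom-cong g) (extHom-cong f)
      extHom-cong (f ⊗ₜ g)             = ⊗-resp-≋ (extHom-cong f) (extHom-cong g)
      extHom-cong (f ⊸ₜ g)             = ⊸-resp-≋ (extHom-cong f) (extHom-cong g)

-- The classifying property

module Classifying {x s e} (T : Theory x s e) where
  open Theory T
  open CXΣ sig using (Mor; denote; opₘ)
  open Reading sig using (read)
  open DenoteRead sig (Equations T) using (denote-read)

  𝒞 : SMC _ _ _
  𝒞 = smc (CT T) (Quotient.quotient-isSMC sig (Equations T))

  module _ {o ℓ r} (D : SMC o ℓ r) where
    open SMC D
    open SMCProperties D using (module Eq)
    open HeterogeneousProperties D
    open Transport D

    module _ (F : Interpretation T D) where
      open Interpretation F
      open Evaluation sig D obj op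

      -- Having equal evaluations is a congruence that respects the SMC structure and contains the
      -- equations of the theory, hence it contains the smallest such congruence.
      eval-resp : ∀ {a b} {f g : Mor a b} → SMC._≈_ 𝒞 f g → eval f ≈ eval g
      eval-resp (incl (equation {u = u} {v} p)) =
        Eq.trans (eval-denote u) (Eq.trans (eqn p) (Eq.sym (eval-denote v)))
      eval-resp (base p)      = eval-∼ p
      eval-resp (symm p)      = Eq.sym (eval-resp p)
      eval-resp (transit p q) = Eq.trans (eval-resp p) (eval-resp q)
      eval-resp (∘-cong {g = g} {g′} {f} {f′} p q) =
        Eq.trans (eval-∘ₘ g f) (Eq.trans (∘-resp-≈ (eval-resp p) (eval-resp q))
          (Eq.sym (eval-∘ₘ g′ f′)))
      eval-resp (⊗-cong {f = f} {f′} {g} {g′} p q) =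
        Eq.trans (eval-⊗ₘ f g) (Eq.trans (⊗-resp-≈ (eval-resp p) (eval-resp q))
          (Eq.sym (eval-⊗ₘ f′ g′)))
      eval-resp (⊸-cong {f = f} {f′} {g} {g′} p q) =
        Eq.trans (eval-⊸ₘ f g) (Eq.trans (⊸-resp-≈ (eval-resp p) (eval-resp q))
          (Eq.sym (eval-⊸ₘ f′ g′)))

      toFunctor : StrictFunctor 𝒞 D
      toFunctor = record
        { F₀     = extOb D obj
        ; F₁     = eval
        ; F-resp = eval-resp
        ; F-id   = λ {a} → eval-id {a}
        ; F-∘    = λ {_} {_} {_} {g} {f} → eval-∘ₘ g f
        ; F₀-⊗   = λ _ _ → refl
        ; F₀-I   = refl
        ; F₀-⊸   = λ _ _ → refl
        ; F₁-⊗   = λ {_} {_} {_} {_} {f} {g} → ≈⇒≋ (eval-⊗ₘ f g)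
        ; F₁-⊸   = λ {_} {_} {_} {_} {f} {g} → ≈⇒≋ (eval-⊸ₘ f g)
        ; F-α    = λ {a} {b} {c} → ≈⇒≋ (eval-inc (αₜ {a = a} {b} {c}))
        ; F-α⁻¹  = λ {a} {b} {c} → ≈⇒≋ (eval-inc (α⁻¹ₜ {a = a} {b} {c}))
        ; F-λ    = λ {a} → ≈⇒≋ (eval-inc (λₜ {a = a}))
        ; F-λ⁻¹  = λ {a} → ≈⇒≋ (eval-inc (λ⁻¹ₜ {a = a}))
        ; F-ρ    = λ {a} → ≈⇒≋ (eval-inc (ρₜ {a = a}))
        ; F-ρ⁻¹  = λ {a} → ≈⇒≋ (eval-inc (ρ⁻¹ₜ {a = a}))
        ; F-σ    = λ {a} {b} → ≈⇒≋ (eval-inc (σₜ {a = a} {b}))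
        ; F-ε    = λ {a} {b} → ≈⇒≋ (eval-inc (εₜ {a = a} {b}))
        ; F-η    = λ {a} {b} → ≈⇒≋ (eval-inc (ηₜ {a = a} {b}))
        }

    module _ (G : StrictFunctor 𝒞 D) where
      open StrictFunctor G

      private
        obj′ : X → Ob
        obj′ v = F₀ (var v)

      F₀-ext : ∀ a → F₀ a ≡ extOb D obj′ a
      F₀-ext (var v) = refl
      F₀-ext I       = F₀-I
      F₀-ext (a ⊗ b) = trans (F₀-⊗ a b) (cong₂ _⊗₀_ (F₀-ext a) (F₀-ext b))
      F₀-ext (a ⊸ b) = trans (F₀-⊸ a b) (cong₂ _⊸₀_ (F₀-ext a) (F₀-ext b))

      private
        E = F₀-ext

        op′ : ∀ {a b} → a ⟶ b → Hom (extOb D obj′ a) (extOb D obj′ b)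
        op′ {a} {b} f = coe (E a) (E b) (F₁ (opₘ f))

      -- Strictness of `G`, one constructor at a time. At the two sides of an equation it makes
      -- `fromFunctor` an interpretation; at `read f` it shows that `G` is determined by its values
      -- on generators.
      F₁-denote : ∀ {a b} (u : DerivedTerm sig a b) → F₁ (denote u) ≋ extHom D obj′ op′ u
      F₁-denote (gen {a} {b} f)        = ≋-sym (coe-≋ (E a) (E b))
      F₁-denote (αₜ {a = a} {b} {c})   = ≋-trans F-α
        (cong₃-≋ (λ a b c → α {a} {b} {c}) (E a) (E b) (E c))
      F₁-denote (α⁻¹ₜ {a = a} {b} {c}) = ≋-trans F-α⁻¹
        (cong₃-≋ (λ a b c → α⁻¹ {a} {b} {c}) (E a) (E b) (E c))
      F₁-denote (λₜ {a = a})           = ≋-trans F-λ (cong₁-≋ (λ a → λ′ {a}) (E a))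
      F₁-denote (λ⁻¹ₜ {a = a})         = ≋-trans F-λ⁻¹ (cong₁-≋ (λ a → λ⁻¹ {a}) (E a))
      F₁-denote (ρₜ {a = a})           = ≋-trans F-ρ (cong₁-≋ (λ a → ρ {a}) (E a))
      F₁-denote (ρ⁻¹ₜ {a = a})         = ≋-trans F-ρ⁻¹ (cong₁-≋ (λ a → ρ⁻¹ {a}) (E a))
      F₁-denote (σₜ {a = a} {b})       = ≋-trans F-σ (cong₂-≋ (λ a b → σ {a} {b}) (E a) (E b))
      F₁-denote (εₜ {a = a} {b})       = ≋-trans F-ε (cong₂-≋ (λ a b → ε {a} {b}) (E a) (E b))
      F₁-denote (ηₜ {a = a} {b})       = ≋-trans F-η (cong₂-≋ (λ a b → η {a} {b}) (E a) (E b))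
      F₁-denote (idₜ {a = a})          = ≋-trans (≈⇒≋ F-id) (cong₁-≋ (λ a → id {a}) (E a))
      F₁-denote (g ∘ₜ f) =
        ≋-trans (≈⇒≋ (F-∘ {g = denote g} {denote f})) (∘-resp-≋ (F₁-denote g) (F₁-denote f))
      F₁-denote (f ⊗ₜ g) =
        ≋-trans (F₁-⊗ {f = denote f} {denote g}) (⊗-resp-≋ (F₁-denote f) (F₁-denote g))
      F₁-denote (f ⊸ₜ g) =
        ≋-trans (F₁-⊸ {f = denote f} {denote g}) (⊸-resp-≋ (F₁-denote f) (F₁-denote g))

      fromFunctor : Interpretation T D
      fromFunctor = record
        { obj = obj′
        ; op  = op′
        ; eqn = λ {_} {_} {u} {v} p → ≋⇒≈ (≋-trans (≋-sym (F₁-denote u))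
            (≋-trans (≈⇒≋ (F-resp (incl (equation p)))) (F₁-denote v)))
        }

    private
      module 𝓘 = Setoid (Interpretations T D)
      module 𝓕 = Setoid (StrictFunctors 𝒞 D)

    toFunctor-cong : ∀ {F F′} → F 𝓘.≈ F′ → toFunctor F 𝓕.≈ toFunctor F′
    toFunctor-cong {F} {F′} (p , q) =
      extOb-cong p , λ f → extHom-cong p (λ {a} {b} → op F {a} {b}) (λ {a} {b} → op F′ {a} {b})
                                       (λ {a} {b} → q {a} {b}) (read f)
      where open Interpretation

    op≋F₁ : ∀ G {a b} (f : a ⟶ b) →
            Interpretation.op (fromFunctor G) f ≋ StrictFunctor.F₁ G (opₘ f)
    op≋F₁ G {a} {b} f = coe-≋ (F₀-ext G a) (F₀-ext G b)

    fromFunctor-cong : ∀ {G G′} → G 𝓕.≈ G′ → fromFunctor G 𝓘.≈ fromFunctor G′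
    fromFunctor-cong {G} {G′} (p , q) =
      (λ v → p (var v)) , λ f → ≋-trans (op≋F₁ G f) (≋-trans (q (opₘ f)) (≋-sym (op≋F₁ G′ f)))

    -- By `denote-read`, `f` is the denotation of `read f`, and on denotations `F₁-denote` leaves no
    -- choice.
    to∘from : ∀ G → toFunctor (fromFunctor G) 𝓕.≈ G
    to∘from G = (λ a → sym (F₀-ext G a)) , λ f →
      ≋-trans (≋-sym (F₁-denote G (read f))) (≈⇒≋ (StrictFunctor.F-resp G (denote-read f)))

    from∘to : ∀ F → fromFunctor (toFunctor F) 𝓘.≈ F
    from∘to F = (λ _ → refl) , λ f →
      ≋-trans (op≋F₁ (toFunctor F) f) (≈⇒≋ (Evaluation.eval-op sig D obj (λ {a} {b} → op {a} {b}) f))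
      where open Interpretation F

    bijection : Inverse (Interpretations T D) (StrictFunctors 𝒞 D)
    bijection = record
      { to        = toFunctor
      ; from      = fromFunctor
      ; to-cong   = λ {F} {F′} → toFunctor-cong {F} {F′}
      ; from-cong = λ {G} {G′} → fromFunctor-cong {G} {G′}
      ; inverse   =
          (λ {G} {F} p → 𝓕.trans {toFunctor F} {toFunctor (fromFunctor G)} {G}
                           (toFunctor-cong {F} {fromFunctor G} p) (to∘from G))
        , (λ {F} {G} p → 𝓘.trans {fromFunctor G} {fromFunctor (toFunctor F)} {F}
                           (fromFunctor-cong {G} {toFunctor F} p) (from∘to F))
      }

  -- The functor attached to `F` is `extHom` at `read f`, and `read` does not involve the target
  -- category, so this is `extHom-∘` for one and the same term.
  naturality : ∀ {o ℓ r o′ ℓ′ r′} {D : SMC o ℓ r} {D′ : SMC o′ ℓ′ r′}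
    (H : StrictFunctor D D′) (F : Interpretation T D) →
    Setoid._≈_ (StrictFunctors 𝒞 D′) (toFunctor D′ (H ∘I F)) (H ∘F toFunctor D F)
  naturality {D′ = D′} H F = (λ a → sym (extOb-∘ H obj a)) , λ f →
    HeterogeneousProperties.≋-sym D′ (extHom-∘ H obj (λ {a} {b} → op {a} {b}) (read f))
    where open Interpretation F

theorem2 : ∀ {x s e o ℓ r} (T : Theory x s e) →
    Σ[ CT-isSMC ∈ IsSMC (CT T) ]
    (let 𝒞 = smc (CT T) CT-isSMC in
    Σ[ bij ∈ (∀ (D : SMC o ℓ r) → Inverse (Interpretations T D) (StrictFunctors 𝒞 D)) ]
    (∀ {D D′ : SMC o ℓ r} (H : StrictFunctor D D′) (F : Interpretation T D) →
    Setoid._≈_ (StrictFunctors 𝒞 D′)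
    (Inverse.to (bij D′) (H ∘I F))
    (H ∘F Inverse.to (bij D) F)))
theorem2 T = SMC.isSMC 𝒞 , bijection , naturality
  where open Classifying T
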